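{- Let $\mathrm{Pnest}_n(t)=\sum_{\mathbf a\in\mathcal{DP}(n)}t^{\mathrm{pnest}(\mathbf a)}$, and let $\mathrm{Pnest}^c_n(t)$ be the same sum restricted to those $\mathbf a\in\mathcal{DP}(n)$ with $\Gamma_{\mathbf a}$ connected. For all $n\ge 1$: (i) $[t]\mathrm{Pnest}_n(t)=2^{n-1}$ and $[t]\mathrm{Pnest}^c_n(t)=1$; (ii) $[t^2]\mathrm{Pnest}_n(t)=S(n,3)$ (Stirling number of the second kind, OEIS A000392) and $[t^2]\mathrm{Pnest}^c_n(t)=F_{2n-3}-1$, where $F_k$ is the $k$th Fibonacci number; (iii) if $i\ge\lceil (n+2)/4\rceil$, then $$[t^i]\mathrm{Pnest}_n(t)=\frac{4(2i+1)\,[8i(i+1)-3(n+1)]\,(2n+1)!}{(n-2i+1)!\,(n+2i+3)!};$$ in particular, for $n\ge1$, $[t^{\lceil n/2\rceil}]\mathrm{Pnest}_n(t)$ equals $1$ if $n$ is odd and $2(n-1)$ if $n$ is even; (iv) if $i>\lfloor (n+2)/4\rfloor$, then $$[t^i]\mathrm{Pnest}^c_n(t)=\frac{8i\,[8i^2(2n-1)-(6n^2+n-2)]\,(2n-2)!}{(n-2i+1)!\,(n+2i+1)!};$$ in particular, for $n\ge1$, $[t^{\lceil n/2\rceil}]\mathrm{Pnest}^c_n(t)$ equals $1$ if $n$ is odd and $2(n-2)$ if $n$ is even. Hence $$\bigl([t^i]\mathrm{Pnest}_n(t)\bigr)^2\ge [t^{i-1}]\mathrm{Pnest}_n(t)\cdot[t^{i+1}]\mathrm{Pnest}_n(t)\quad\text{if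 }\lceil (n+2)/4\rceil<i\le\lceil n/2\rceil,$$ and $$\bigl([t^i]\mathrm{Pnest}^c_n(t)\bigr)^2\ge [t^{i-1}]\mathrm{Pnest}^c_n(t)\cdot[t^{i+1}]\mathrm{Pnest}^c_n(t)\quad\text{if }\lfloor (n+2)/4\rfloor+1<i\le\lceil n/2\rceil.$$
   Context: $[t^i]p(t)$ denotes the coefficient of $t^i$ in $p(t)$. Fibonacci numbers: $F_0=0$, $F_1=1$, $F_{k}=F_{k-1}+F_{k-2}$, with $F_{ -1}=1$. The reciprocal of the factorial of a negative integer is read as $0$. Write $[n]=\{1,\dots,n\}$. An area sequence of size $n$ is a sequence $\mathbf a=(a_1,\dots,a_n)$ of nonnegative integers with $a_i<i$ for all $i$ and $a_i\le a_{i-1}+1$ for all $i\ge 2$; $\mathcal{DP}(n)$ is the set of all of them. Each $\mathbf a\in\mathcal{DP}(n)$ defines a graph $\Gamma_{\mathbf a}$ (a unit interval graph) on $[n]$ with edges $\{j,i\}$ for $1\le j<i\le n$ with $i-a_i\le j$. If $\{i,j\}$ with $i<j$ is an edge then $\{i,i+1,\dots,j\}$ is a clique. A peak-edge of $\Gamma_{\mathbf a}$ is either an isolated vertex $i$ (put $j=i$) or an edge $\{i,j\}$, $i<j$, such that neither $\{i,j+1\}$ nor $\{i-1,j\}$ is an edge (pairs not contained in $[n]$ are not edges). The corresponding peak-clique is $\{i,i+1,\dots,j\}$. The peak-nesting of a vertex is the number of peak-cliques containing it, and $\mathrm{pnest}(\mathbf a)$ is the maximum of these numbers over all vertices.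
   Formalization: In (iv), the clause that the coefficient of t^{⌈n/2⌉} in Pnest^c_n equals 2(n-2) for even n is proved for even n ≠ 2 only; at n = 2 it is false, since Pnest^c_2(t) = t has coefficient 1, not 0. -}

module Defs where

open import Data.Empty using (⊥-elim)
open import Data.Fin as Fin using (Fin; toℕ)
open import Data.Fin.Properties as Fin using (all?; toℕ-injective; toℕ<n; toℕ-fromℕ<)
open import Data.Integer as ℤ using (ℤ; +_; -[1+_]; 0ℤ; 1ℤ; -1ℤ)
open import Data.List using (List; []; _∷_; map; foldr; filter; length; upTo; allFin; cartesianProduct; cartesianProductWith; replicate; _++_)
open import Data.List.Membership.Propositional using (_∈_)
open import Data.List.Membership.Propositional.Properties using (∈-filter⁺; ∈-filter⁻; ∈-cartesianProductWith⁺; ∈-upTo⁺)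
open import Data.List.Relation.Unary.All using ([])
open import Data.List.Relation.Unary.AllPairs using ([]; _∷_)
open import Data.List.Relation.Unary.Any using (here)
open import Data.List.Relation.Unary.Unique.Propositional using (Unique)
open import Data.List.Relation.Unary.Unique.Propositional.Properties as Unique using ()
open import Data.Nat using (ℕ; zero; suc; _+_; _*_; _∸_; _⊔_; _≤_; _<_; _≤?_; _<?_; _!; NonZero; z≤n; s≤s)
open import Data.Nat.DivMod using (_/_)
open import Data.Nat.Properties as ℕ using (_!≢0)
open import Data.Product using (_×_; _,_; proj₁; proj₂)
open import Data.Rational as ℚ using (ℚ; 0ℚ)
open import Data.Sum using (_⊎_; inj₁; inj₂; swap)
open import Data.Vec using (Vec; []; _∷_; lookup)
open import Data.Vec.Properties using (∷-injective)
open import Function using (_∘_)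
open import Function.Bundles using (_⇔_; mk⇔)
open import Level using (0ℓ)
open import Relation.Binary using (Rel; Decidable)
open import Relation.Binary.Construct.Closure.ReflexiveTransitive using (Star; ε; _◅_; _◅◅_; reverse)
open import Relation.Binary.PropositionalEquality using (_≡_; refl; sym; trans; cong; subst)
open import Relation.Nullary using (¬_; Dec; yes; no; ¬?)
open import Relation.Nullary.Decidable as Dec using (_×-dec_; _⊎-dec_; _→-dec_)

private
  variable
    n : ℕ

------------------------------------------------------------------------
-- Area sequences

-- The i-th entry (1 ≤ i ≤ n) is looked up at the index of [n] whose toℕ is
-- i - 1, so that a_i < i reads  lookup a i ≤ toℕ i.

IsAreaSequence : Vec ℕ n → Set
IsAreaSequence {n} a =
    (∀ (i : Fin n) → lookup a i ≤ toℕ i)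
  × (∀ (i j : Fin n) → toℕ j ≡ suc (toℕ i) → lookup a j ≤ lookup a i + 1)

isAreaSequence? : (a : Vec ℕ n) → Dec (IsAreaSequence a)
isAreaSequence? a =
  all? (λ i → lookup a i ≤? toℕ i)
  ×-dec all? (λ i → all? λ j →
       (toℕ j ℕ.≟ suc (toℕ i)) →-dec (lookup a j ≤? lookup a i + 1))

words : List ℕ → (n : ℕ) → List (Vec ℕ n)
words xs zero    = [] ∷ []
words xs (suc n) = cartesianProductWith _∷_ xs (words xs n)

-- The entries of an area sequence of size n are all less than n.

DP : (n : ℕ) → List (Vec ℕ n)
DP n = filter isAreaSequence? (words (upTo n) n)

------------------------------------------------------------------------
-- The graph of an area sequence; connectedness

-- Moving from {1,…,n} to indices shifts both sides of  i - a_i ≤ j  by one,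
-- and the monus does not truncate when a is an area sequence.

Γ : Vec ℕ n → Rel (Fin n) 0ℓ
Γ a u v = LeftEnd u v ⊎ LeftEnd v u
  where
  LeftEnd : Rel (Fin _) 0ℓ
  LeftEnd j i = toℕ j < toℕ i × toℕ i ∸ lookup a i ≤ toℕ j

Γ? : (a : Vec ℕ n) → Decidable (Γ a)
Γ? a u v = leftEnd? u v ⊎-dec leftEnd? v u
  where
  leftEnd? : ∀ j i → Dec (toℕ j < toℕ i × toℕ i ∸ lookup a i ≤ toℕ j)
  leftEnd? j i = (toℕ j <? toℕ i) ×-dec (toℕ i ∸ lookup a i ≤? toℕ j)

Connected : Rel (Fin n) 0ℓ → Set
Connected E = ∀ u v → Star E u v

-- Used only to decide connectedness: for area sequences, Γ a is connected
-- iff every entry after the first is positive.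

Positive : Vec ℕ n → Set
Positive {n} a = ∀ (i : Fin n) → 0 < toℕ i → 0 < lookup a i

positive? : (a : Vec ℕ n) → Dec (Positive a)
positive? a = all? λ i → (0 <? toℕ i) →-dec (0 <? lookup a i)

positive⇒connected : (a : Vec ℕ n) → Positive a → Connected (Γ a)
positive⇒connected {n} a pos u v =
  down (toℕ u) u refl ◅◅ reverse swap (down (toℕ v) v refl)
  where
  root : Fin n → Fin n
  root w = Fin.fromℕ< (ℕ.≤-<-trans z≤n (toℕ<n w))

  down : ∀ m w → toℕ w ≡ m → Star (Γ a) w (root u)
  down zero w eq =
    subst (λ x → Star (Γ a) x (root u))
          (toℕ-injective (trans (toℕ-fromℕ< _) (sym eq))) ε
  down (suc m) w eq = inj₂ (w′<w , close) ◅ down m w′ toℕw′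
    where
    m<n : m < n
    m<n = ℕ.<-trans (ℕ.≤-reflexive (sym eq)) (toℕ<n w)

    w′ : Fin n
    w′ = Fin.fromℕ< m<n

    toℕw′ : toℕ w′ ≡ m
    toℕw′ = toℕ-fromℕ< m<n

    w′<w : toℕ w′ < toℕ w
    w′<w rewrite toℕw′ | eq = ℕ.≤-refl

    close : toℕ w ∸ lookup a w ≤ toℕ w′
    close rewrite toℕw′ =
      ℕ.≤-trans (ℕ.∸-monoʳ-≤ (toℕ w) (pos w (subst (0 <_) (sym eq) (s≤s z≤n))))
                (ℕ.≤-reflexive (cong (_∸ 1) eq))

connected⇒positive : (a : Vec ℕ n) → IsAreaSequence a →
                     Connected (Γ a) → Positive a
connected⇒positive {n} a (_ , step) conn i 0<i with 0 <? lookup a i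
... | yes p = p
... | no ¬p = ⊥-elim (ℕ.<-irrefl refl (stay (conn origin i) origin<i))
  where
  ai≡0 : lookup a i ≡ 0
  ai≡0 = ℕ.n≤0⇒n≡0 (ℕ.≮⇒≥ ¬p)

  origin : Fin n
  origin = Fin.fromℕ< (ℕ.≤-<-trans z≤n (toℕ<n i))

  origin<i : toℕ origin < toℕ i
  origin<i rewrite toℕ-fromℕ< (ℕ.≤-<-trans z≤n (toℕ<n i)) = 0<i

  bound : ∀ d k → toℕ k ≡ d + toℕ i → lookup a k ≤ d
  bound zero k eq =
    ℕ.≤-reflexive (trans (cong (lookup a) (toℕ-injective eq)) ai≡0)
  bound (suc d) k eq =
    ℕ.≤-trans (step k′ k (trans eq (cong suc (sym toℕk′))))
      (ℕ.≤-trans (ℕ.+-monoˡ-≤ 1 (bound d k′ toℕk′)) (ℕ.≤-reflexive (ℕ.+-comm d 1)))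
    where
    lt : d + toℕ i < n
    lt = ℕ.<-trans (ℕ.≤-reflexive (sym eq)) (toℕ<n k)

    k′ : Fin n
    k′ = Fin.fromℕ< lt

    toℕk′ : toℕ k′ ≡ d + toℕ i
    toℕk′ = toℕ-fromℕ< lt

  barrier : ∀ k → toℕ i ≤ toℕ k → toℕ i ≤ toℕ k ∸ lookup a k
  barrier k i≤k = ℕ.≤-trans
    (ℕ.≤-reflexive (sym (ℕ.m∸[m∸n]≡n i≤k)))
    (ℕ.∸-monoʳ-≤ (toℕ k) (bound (toℕ k ∸ toℕ i) k (sym (ℕ.m∸n+n≡m i≤k))))

  stay₁ : ∀ {x y} → Γ a x y → toℕ x < toℕ i → toℕ y < toℕ i
  stay₁ (inj₂ (y<x , _)) x<i = ℕ.<-trans y<x x<i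
  stay₁ {x} {y} (inj₁ (_ , r)) x<i with toℕ y <? toℕ i
  ... | yes y<i = y<i
  ... | no  y≮i = ⊥-elim (ℕ.<⇒≱ x<i (ℕ.≤-trans (barrier y (ℕ.≮⇒≥ y≮i)) r))

  stay : ∀ {x y} → Star (Γ a) x y → toℕ x < toℕ i → toℕ y < toℕ i
  stay ε        x<i = x<i
  stay (e ◅ es) x<i = stay es (stay₁ e x<i)

IsConnectedAreaSequence : Vec ℕ n → Set
IsConnectedAreaSequence a = IsAreaSequence a × Connected (Γ a)

isConnectedAreaSequence? : (a : Vec ℕ n) → Dec (IsConnectedAreaSequence a)
isConnectedAreaSequence? a = Dec.map′
  (λ { (area , pos)  → area , positive⇒connected a pos })
  (λ { (area , conn) → area , connected⇒positive a area conn })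
  (isAreaSequence? a ×-dec positive? a)

DPᶜ : (n : ℕ) → List (Vec ℕ n)
DPᶜ n = filter isConnectedAreaSequence? (words (upTo n) n)

-- DP n and DPᶜ n list each of the intended sequences exactly once.

words-complete : ∀ {xs} (a : Vec ℕ n) → (∀ i → lookup a i ∈ xs) → a ∈ words xs n
words-complete []      h = here refl
words-complete (x ∷ a) h =
  ∈-cartesianProductWith⁺ _∷_ (h Fin.zero) (words-complete a (h ∘ Fin.suc))

words-unique : ∀ {xs} → Unique xs → ∀ n → Unique (words xs n)
words-unique xs! zero    = [] ∷ []
words-unique xs! (suc n) =
  Unique.cartesianProductWith⁺ _∷_ ∷-injective xs! (words-unique xs! n)

area∈words : {a : Vec ℕ n} → IsAreaSequence a → a ∈ words (upTo n) n
area∈words (le , _) =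
  words-complete _ (λ i → ∈-upTo⁺ (ℕ.≤-<-trans (le i) (toℕ<n i)))

∈-DP : {a : Vec ℕ n} → a ∈ DP n ⇔ IsAreaSequence a
∈-DP {n} = mk⇔ (proj₂ ∘ ∈-filter⁻ isAreaSequence? {xs = words (upTo n) n})
               (λ area → ∈-filter⁺ isAreaSequence? (area∈words area) area)

∈-DPᶜ : {a : Vec ℕ n} → a ∈ DPᶜ n ⇔ IsConnectedAreaSequence a
∈-DPᶜ {n} = mk⇔ (proj₂ ∘ ∈-filter⁻ isConnectedAreaSequence? {xs = words (upTo n) n})
                (λ p → ∈-filter⁺ isConnectedAreaSequence? (area∈words (proj₁ p)) p)

DP-unique : ∀ n → Unique (DP n)
DP-unique n = Unique.filter⁺ isAreaSequence? (words-unique (Unique.upTo⁺ n) n)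

DPᶜ-unique : ∀ n → Unique (DPᶜ n)
DPᶜ-unique n = Unique.filter⁺ isConnectedAreaSequence? (words-unique (Unique.upTo⁺ n) n)

------------------------------------------------------------------------
-- Peak-edges and peak-nesting

Isolated : Rel (Fin n) 0ℓ → Fin n → Set
Isolated E i = ∀ j → ¬ E i j

-- A neighbour j + 1 or i - 1 falling outside [n] gives no index k, so the
-- corresponding condition is then vacuous.

PeakEdge : Rel (Fin n) 0ℓ → Rel (Fin n) 0ℓ
PeakEdge E i j =
    (i ≡ j × Isolated E i)
  ⊎ (toℕ i < toℕ j
     × E i j
     × (∀ k → toℕ k ≡ suc (toℕ j) → ¬ E i k)
     × (∀ k → toℕ i ≡ suc (toℕ k) → ¬ E k j))

peakEdge? : {E : Rel (Fin n) 0ℓ} → Decidable E → Decidable (PeakEdge E)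
peakEdge? E? i j =
  ((i Fin.≟ j) ×-dec all? (λ k → ¬? (E? i k)))
  ⊎-dec ((toℕ i <? toℕ j)
      ×-dec (E? i j
      ×-dec (all? (λ k → (toℕ k ℕ.≟ suc (toℕ j)) →-dec ¬? (E? i k))
      ×-dec all? (λ k → (toℕ i ℕ.≟ suc (toℕ k)) →-dec ¬? (E? k j)))))

-- Distinct pairs i ≤ j span distinct intervals {i,…,j}, so peak-cliques are
-- counted by their end points.

PeakCliqueContaining : Vec ℕ n → Fin n → Fin n × Fin n → Set
PeakCliqueContaining a v (i , j) = PeakEdge (Γ a) i j × (toℕ i ≤ toℕ v × toℕ v ≤ toℕ j)

peakCliqueContaining? : (a : Vec ℕ n) (v : Fin n) (e : Fin n × Fin n) →
                        Dec (PeakCliqueContaining a v e)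
peakCliqueContaining? a v (i , j) =
  peakEdge? (Γ? a) i j ×-dec ((toℕ i ≤? toℕ v) ×-dec (toℕ v ≤? toℕ j))

peakNesting : Vec ℕ n → Fin n → ℕ
peakNesting {n} a v =
  length (filter (peakCliqueContaining? a v) (cartesianProduct (allFin n) (allFin n)))

pnest : Vec ℕ n → ℕ
pnest {n} a = foldr _⊔_ 0 (map (peakNesting a) (allFin n))

------------------------------------------------------------------------
-- Polynomials in t over ℕ, as lists of coefficients in increasing degree

Poly : Set
Poly = List ℕ

infixl 6 _⊕_
infix  8 [t^_]_

_⊕_ : Poly → Poly → Poly
[]      ⊕ q       = q
(x ∷ p) ⊕ []      = x ∷ p
(x ∷ p) ⊕ (y ∷ q) = x + y ∷ p ⊕ q

t^_ : ℕ → Poly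
t^ k = replicate k 0 ++ 1 ∷ []

[t^_]_ : ℕ → Poly → ℕ
[t^ i     ] []      = 0
[t^ zero  ] (x ∷ p) = x
[t^ suc i ] (x ∷ p) = [t^ i ] p

∑t^pnest : List (Vec ℕ n) → Poly
∑t^pnest = foldr (λ a p → t^ (pnest a) ⊕ p) []

Pnest Pnestᶜ : ℕ → Poly
Pnest  n = ∑t^pnest (DP n)
Pnestᶜ n = ∑t^pnest (DPᶜ n)

------------------------------------------------------------------------
-- Special numbers

-- Fibonacci numbers at all integer indices, extended to negative ones by the
-- same recurrence; in particular F (- 1) = 1.

F : ℤ → ℤ
F (+ 0)              = 0ℤ
F (+ 1)              = 1ℤ
F (+ suc (suc k))    = F (+ suc k) ℤ.+ F (+ k)
F -[1+ 0 ]           = 1ℤ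
F -[1+ 1 ]           = -1ℤ
F -[1+ suc (suc k) ] = F -[1+ k ] ℤ.- F -[1+ suc k ]

-- Stirling numbers of the second kind.

S : ℕ → ℕ → ℕ
S zero    zero    = 1
S zero    (suc k) = 0
S (suc n) zero    = 0
S (suc n) (suc k) = suc k * S n (suc k) + S n k

⌈_/_⌉ : (m d : ℕ) → .{{_ : NonZero d}} → ℕ
⌈ m / d ⌉ = (m + (d ∸ 1)) / d

1/[_]! : ℤ → ℚ
1/[ + k      ]! = (1ℤ ℚ./ (k !)) {{k !≢0}}
1/[ -[1+ k ] ]! = 0ℚ

fromℤ : ℤ → ℚ
fromℤ z = z ℚ./ 1

{-# OPTIONS --safe #-}
module Submission where

-- The i-th vertex of Γ_a is joined to the smaller vertices down to ℓ_i = i - a_i, and the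
-- peak-cliques are the intervals {ℓ_i,…,i} with i the last index of its ℓ-value. They are
-- closed in the order in which they are opened, so a is determined by the sets O of left ends
-- and X of right ends. With h intervals containing both v and v + 1, the set O allows h to
-- grow by one at each vertex and X then allows it to shrink by one: this is a walk with steps
-- ±1, at height 2h between vertices and 2c - 1 at a vertex contained in c intervals. Hence the
-- area sequences with pnest ≤ k are the Dyck paths of length 2n with height at most 2k, and
-- those with connected graph (h ≥ 1 between vertices) are the Dyck paths of length 2(n - 1)
-- with height at most 2k - 1. The coefficients are differences of such counts, which are
-- found by recursion for small k and by the reflection principle for large k, where only the
-- first reflections matter.

open import Defs
open import Data.Integer as ℤ using (ℤ; +_; 1ℤ)
open import Data.Nat using (ℕ; _+_; _*_; _∸_; _^_; _≤_; _<_; _≥_; _>_; _!; ⌈_/2⌉)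
open import Data.Nat.Divisibility using (_∣_; _∤_)
open import Data.Nat.DivMod using (_/_)
open import Data.Product using (_×_)
open import Data.Rational as ℚ using (ℚ)
open import Relation.Binary.PropositionalEquality using (_≡_; _≢_)

open import Algebra.Properties.AbelianGroup using (∙-cancelʳ)
import Algebra.Properties.CommutativeSemigroup as CommutativeSemigroup
open import Data.Bool using (Bool; true; false; if_then_else_; _∧_; T; T?)
open import Data.Bool.Properties using (T-∧)
open import Data.Fin using (Fin; zero; suc; toℕ; fromℕ<; inject₁)
open import Data.Fin.Properties using (injective⇒≤; toℕ<n; toℕ-fromℕ<; toℕ-injective; toℕ-inject₁)
open import Data.Integer using (-[1+_]; 0ℤ; -1ℤ)
import Data.Integer.Properties as ℤ
open import Data.Integer.Tactic.RingSolver using (solve-∀)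
open import Data.List as List using (List; []; _∷_; length; filter; map; foldr; _++_; tabulate; allFin; cartesianProduct)
open import Data.List.Membership.Propositional using (_∈_)
open import Data.List.Membership.Propositional.Properties using (∈-lookup; ∈-filter⁺; ∈-filter⁻; ∈-cartesianProduct⁺; ∈-allFin; ∈-map⁺; ∈-map⁻; ∈-++⁺ˡ; ∈-++⁺ʳ; ∈-++⁻)
open import Data.List.Properties using (length-map; length-++)
open import Data.List.Relation.Unary.All as All using ([])
open import Data.List.Relation.Unary.AllPairs using ([]; _∷_)
open import Data.List.Relation.Unary.Any using (here; there; index)
open import Data.List.Relation.Unary.Any.Properties using (lookup-index)
open import Data.List.Relation.Unary.Unique.Propositional using (Unique)
import Data.List.Relation.Unary.Unique.Propositional.Properties as Unique
open import Data.Nat using (zero; suc; pred; _⊔_; ⌊_/2⌋; _≤?_; _<?_; _≤ᵇ_; _<ᵇ_; z≤n; s≤s; s≤s⁻¹; NonZero)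
open import Data.Nat.Divisibility using (divides; n∣m*n)
open import Data.Nat.DivMod using (_%_; m≡m%n+[m/n]*n; m%n<n)
import Data.Nat.Properties as ℕ
open import Data.Nat.Solver using (module +-*-Solver)
open import Data.Product using (_,_; proj₁; proj₂; ∃; ∃₂)
import Data.Rational.Properties as ℚ
open import Data.Rational.Unnormalised as ℚᵘ using (*≡*)
import Data.Rational.Unnormalised.Properties as ℚᵘ
open import Data.Sum using (_⊎_; inj₁; inj₂)
open import Data.Unit using (⊤)
open import Data.Vec using (Vec; []; _∷_; toList; lookup)
open import Function using (_∘_; flip; Equivalence)
open import Relation.Binary.PropositionalEquality using (refl; sym; trans; cong; cong₂; subst; subst₂; module ≡-Reasoning)
open import Relation.Nullary using (¬_; yes; no; does; contradiction)
open import Relation.Unary using (Decidable)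

-- The obstacle is the order of reading. An area sequence moves two heads, one at i and one at ℓ_i,
-- which advance separately, while a walk reads the two letters of the same vertex together; so the
-- recursion behind one does not follow that behind the other. Inequalities between the prefix
-- counts `ones` mediate, since they do not depend on an order of reading: they follow from
-- `Rising`, they suffice to rebuild it (`decode`), and they are equivalent to membership in
-- `points`. In this form the requirement that each vertex lies in some clique is the floor of the
-- strip, pnest ≤ k is its ceiling, and connectedness raises the floor by one.

private variable
  A B : Set
  a m n : ℕ
  as as′ : Vec ℕ n
  os os′ : List Bool

-- Counting

lookup-injective : {xs : List A} → Unique xs → ∀ i j → List.lookup xs i ≡ List.lookup xs j → i ≡ j
lookup-injective (_ ∷ _) zero zero _ = refl
lookup-injective {xs = _ ∷ xs} (x∉ ∷ _) zero (suc j) eq = contradiction eq (All.lookup x∉ (∈-lookup j))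
lookup-injective {xs = _ ∷ xs} (x∉ ∷ _) (suc i) zero eq = contradiction (sym eq) (All.lookup x∉ (∈-lookup i))
lookup-injective (_ ∷ u) (suc i) (suc j) eq = cong suc (lookup-injective u i j eq)

module _ (R : A → B → Set) where

  length-mono-≤ : {xs : List A} {ys : List B} → Unique xs →
                  (∀ {x} → x ∈ xs → ∃ λ y → y ∈ ys × R x y) →
                  (∀ {x x′ y} → R x y → R x′ y → x ≡ x′) →
                  length xs ≤ length ys
  length-mono-≤ {xs} {ys} xs! total left-unique = injective⇒≤ {f = f} f-injective
    where
    image : ∀ i → ∃ λ y → y ∈ ys × R (List.lookup xs i) y
    image i = total (∈-lookup i)

    f : Fin (length xs) → Fin (length ys)
    f i = index (proj₁ (proj₂ (image i)))

    lookup-f : ∀ i → proj₁ (image i) ≡ List.lookup ys (f i)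
    lookup-f i = lookup-index (proj₁ (proj₂ (image i)))

    f-injective : ∀ {i j} → f i ≡ f j → i ≡ j
    f-injective {i} {j} eq = lookup-injective xs! i j
      (left-unique (proj₂ (proj₂ (image i)))
        (subst (R (List.lookup xs j))
          (trans (lookup-f j) (trans (cong (List.lookup ys) (sym eq)) (sym (lookup-f i))))
          (proj₂ (proj₂ (image j)))))

-- Encoding and decoding make sense only under conditions on their arguments. A relation avoids
-- having to define total functions in both directions, and the two inequalities become one lemma,
-- applied to R and to its converse.
length-bijection : (R : A → B → Set) {xs : List A} {ys : List B} → Unique xs → Unique ys →
                   (∀ {x} → x ∈ xs → ∃ λ y → y ∈ ys × R x y) →
                   (∀ {y} → y ∈ ys → ∃ λ x → x ∈ xs × R x y) →
                   (∀ {x x′ y} → R x y → R x′ y → x ≡ x′) →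
                   (∀ {x y y′} → R x y → R x y′ → y ≡ y′) →
                   length xs ≡ length ys
length-bijection R xs! ys! total surjective left-unique right-unique = ℕ.≤-antisym
  (length-mono-≤ R xs! total left-unique)
  (length-mono-≤ (flip R) ys! surjective right-unique)

coeff-⊕ : ∀ i p q → [t^ i ] (p ⊕ q) ≡ [t^ i ] p + [t^ i ] q
coeff-⊕ i       []      q       = refl
coeff-⊕ i       (x ∷ p) []      = sym (ℕ.+-identityʳ _)
coeff-⊕ zero    (x ∷ p) (y ∷ q) = refl
coeff-⊕ (suc i) (x ∷ p) (y ∷ q) = coeff-⊕ i p q

-- Cumulative counts are used because pnest is a maximum: pnest ≤ k is a condition on each vertex
-- separately, which pnest = k is not.
atMost : ℕ → List (Vec ℕ n) → ℕ
atMost k as = length (filter (λ a → pnest a ≤? k) as)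

indicator : Bool → ℕ
indicator b = if b then 1 else 0

coeff-t^ : ∀ i k → [t^ suc i ] (t^ k) + indicator (k ≤ᵇ i) ≡ indicator (k ≤ᵇ suc i)
coeff-t^ i       zero          = refl
coeff-t^ zero    (suc zero)    = refl
coeff-t^ zero    (suc (suc k)) = refl
coeff-t^ (suc i) (suc zero)    = refl
coeff-t^ (suc i) (suc (suc k)) = coeff-t^ i (suc k)

length-filter-∷ : {P : A → Set} (P? : Decidable P) (x : A) (xs : List A) →
                  length (filter P? (x ∷ xs)) ≡ indicator (does (P? x)) + length (filter P? xs)
length-filter-∷ P? x xs with does (P? x)
... | true  = refl
... | false = refl

coeff+atMost : ∀ i (as : List (Vec ℕ n)) → [t^ suc i ] (∑t^pnest as) + atMost i as ≡ atMost (suc i) as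
coeff+atMost i [] = refl
coeff+atMost i (a ∷ as) = begin
  [t^ suc i ] (t^ pnest a ⊕ ∑t^pnest as) + atMost i (a ∷ as)
    ≡⟨ cong₂ _+_ (coeff-⊕ (suc i) (t^ pnest a) (∑t^pnest as)) (length-filter-∷ (λ a → pnest a ≤? i) a as) ⟩
  ([t^ suc i ] (t^ pnest a) + [t^ suc i ] (∑t^pnest as)) + (indicator (pnest a ≤ᵇ i) + atMost i as)
    ≡⟨ CommutativeSemigroup.interchange ℕ.+-commutativeSemigroup ([t^ suc i ] (t^ pnest a)) ([t^ suc i ] (∑t^pnest as)) (indicator (pnest a ≤ᵇ i)) (atMost i as) ⟩
  ([t^ suc i ] (t^ pnest a) + indicator (pnest a ≤ᵇ i)) + ([t^ suc i ] (∑t^pnest as) + atMost i as)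
    ≡⟨ cong₂ _+_ (coeff-t^ i (pnest a)) (coeff+atMost i as) ⟩
  indicator (pnest a ≤ᵇ suc i) + atMost (suc i) as
    ≡⟨ length-filter-∷ (λ a → pnest a ≤? suc i) a as ⟨
  atMost (suc i) (a ∷ as) ∎
  where open ≡-Reasoning

count : (Fin n → Bool) → ℕ
count {zero}  f = 0
count {suc n} f = indicator (f zero) + count (f ∘ suc)

length-filter-tabulate : {P : A → Set} (P? : Decidable P) (f : Fin n → A) →
                         length (filter P? (tabulate f)) ≡ count (λ i → does (P? (f i)))
length-filter-tabulate {n = zero}  P? f = refl
length-filter-tabulate {n = suc n} P? f = trans (length-filter-∷ P? (f zero) (tabulate (f ∘ suc)))
  (cong (λ x → indicator (does (P? (f zero))) + x) (length-filter-tabulate P? (f ∘ suc)))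

count-cong : {f g : Fin n → Bool} → (∀ i → f i ≡ g i) → count f ≡ count g
count-cong {zero}  eq = refl
count-cong {suc n} eq = cong₂ _+_ (cong indicator (eq zero)) (count-cong (eq ∘ suc))

count-+ : {f g h : Fin n → Bool} → (∀ i → indicator (f i) ≡ indicator (g i) + indicator (h i)) →
          count f ≡ count g + count h
count-+ {zero}  eq = refl
count-+ {suc n} {f} {g} {h} eq = trans (cong₂ _+_ (eq zero) (count-+ (eq ∘ suc)))
  (CommutativeSemigroup.interchange ℕ.+-commutativeSemigroup (indicator (g zero)) _ _ _)

-- Codes of area sequences

ones : ℕ → List Bool → ℕ
ones zero    bs       = 0
ones (suc t) []       = 0
ones (suc t) (b ∷ bs) = indicator b + ones t bs

total : List Bool → ℕ
total []       = 0
total (b ∷ bs) = indicator b + total bs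

-- An area sequence with left ends ℓ_i = i - a_i is encoded by two words: the i-th letter of
-- the first one tells whether i closes a peak-clique (ℓ_{i+1} ≠ ℓ_i), the ℓ-th letter of the
-- second one whether ℓ opens one (ℓ = ℓ_i for some i). The first word is read at i and the
-- second one at ℓ_i + 1; the entry a = i - ℓ_i is the distance between the two reading heads.
mutual
  data Rising : ℕ → Vec ℕ m → Vec Bool (suc m) → List Bool → Set where
    rise : {xs : Vec Bool (suc m)} → Rising (suc a) as xs os → Rising a (suc a ∷ as) (false ∷ xs) os
    peak : {xs : Vec Bool m} → Falling a as xs os → Rising a as (true ∷ xs) os

  data Falling : ℕ → Vec ℕ m → Vec Bool m → List Bool → Set where
    end  : Falling 0 [] [] []
    stop : {xs : Vec Bool (suc m)} → Rising a as xs os → Falling a (a ∷ as) xs (true ∷ os)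
    fall : {xs : Vec Bool m} → Falling a as xs os → Falling (suc a) as xs (false ∷ os)

Climbing : ℕ → Vec ℕ m → Set
Climbing b []       = ⊤
Climbing b (a ∷ as) = a ≤ b × Climbing (suc a) as

descend : ∀ a → ∃ λ os → Falling a [] [] os
descend zero    = _ , end
descend (suc a) = _ , fall (proj₂ (descend a))

descend-to : ∀ {a b} {xs : Vec Bool (suc m)} → b ≤ a → Rising b as xs os → ∃ λ os′ → Falling a (b ∷ as) xs os′
descend-to {a = a} b≤a c with ℕ.m≤n⇒m<n∨m≡n b≤a
... | inj₂ refl = _ , stop c
descend-to {a = suc a} _ c | inj₁ (s≤s b≤a) = _ , fall (proj₂ (descend-to b≤a c))

encode : ∀ a (as : Vec ℕ m) → Climbing (suc a) as → ∃₂ λ xs os → Rising a as xs os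
encode a [] _ = _ , _ , peak (proj₂ (descend a))
encode a (b ∷ as) (b≤ , cl) with encode b as cl | ℕ.m≤n⇒m<n∨m≡n b≤
... | _ , _ , c | inj₂ refl      = _ , _ , rise c
... | _ , _ , c | inj₁ (s≤s b≤a) = _ , _ , peak (proj₂ (descend-to b≤a c))

climbing-mono : ∀ {b b′} (as : Vec ℕ m) → b ≤ b′ → Climbing b as → Climbing b′ as
climbing-mono []       _    _         = _
climbing-mono (a ∷ as) b≤b′ (a≤b , c) = ℕ.≤-trans a≤b b≤b′ , c


mutual
  rising⇒climbing : {xs : Vec Bool (suc m)} → Rising a as xs os → Climbing (suc a) as
  rising⇒climbing (rise c) = ℕ.≤-refl , rising⇒climbing c
  rising⇒climbing {as = as} (peak c) = climbing-mono as (ℕ.n≤1+n _) (falling⇒climbing c)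

  falling⇒climbing : {xs : Vec Bool m} → Falling a as xs os → Climbing a as
  falling⇒climbing end = _
  falling⇒climbing (stop c) = ℕ.≤-refl , rising⇒climbing c
  falling⇒climbing {as = as} (fall c) = climbing-mono as (ℕ.n≤1+n _) (falling⇒climbing c)

mutual
  -- After `peak` the next entry is at most a, whereas `rise` makes it a + 1, so the entries
  -- determine the constructor. `stop` and `fall` are told apart in the same way.
  rising-code-unique : {xs xs′ : Vec Bool (suc m)} → Rising a as xs os → Rising a as xs′ os′ → (xs , os) ≡ (xs′ , os′)
  rising-code-unique (rise c) (rise c′) with rising-code-unique c c′
  ... | refl = refl
  rising-code-unique (rise c) (peak c′) = contradiction (proj₁ (falling⇒climbing c′)) ℕ.1+n≰n
  rising-code-unique (peak c) (rise c′) = contradiction (proj₁ (falling⇒climbing c)) ℕ.1+n≰n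
  rising-code-unique (peak c) (peak c′) with falling-code-unique c c′
  ... | refl = refl

  falling-code-unique : {xs xs′ : Vec Bool m} → Falling a as xs os → Falling a as xs′ os′ → (xs , os) ≡ (xs′ , os′)
  falling-code-unique end end = refl
  falling-code-unique (stop c) (stop c′) with rising-code-unique c c′
  ... | refl = refl
  falling-code-unique (stop c) (fall c′) = contradiction (proj₁ (falling⇒climbing c′)) ℕ.1+n≰n
  falling-code-unique (fall c) (stop c′) = contradiction (proj₁ (falling⇒climbing c)) ℕ.1+n≰n
  falling-code-unique (fall c) (fall c′) with falling-code-unique c c′
  ... | refl = refl

mutual
  rising-entries-unique : {xs : Vec Bool (suc m)} → Rising a as xs os → Rising a as′ xs os → as ≡ as′
  rising-entries-unique (rise c) (rise c′) = cong (_ ∷_) (rising-entries-unique c c′)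
  rising-entries-unique (peak c) (peak c′) = falling-entries-unique c c′

  falling-entries-unique : {xs : Vec Bool m} → Falling a as xs os → Falling a as′ xs os → as ≡ as′
  falling-entries-unique end end = refl
  falling-entries-unique (stop c) (stop c′) = cong (_ ∷_) (rising-entries-unique c c′)
  falling-entries-unique (fall c) (fall c′) = falling-entries-unique c c′

mutual
  rising-length : {as : Vec ℕ m} {xs : Vec Bool (suc m)} → Rising a as xs os → length os ≡ m + a
  rising-length {m = suc m} {a = a} (rise c) = trans (rising-length c) (ℕ.+-suc m a)
  rising-length (peak c) = falling-length c

  falling-length : {as : Vec ℕ m} {xs : Vec Bool m} → Falling a as xs os → length os ≡ m + a
  falling-length end = refl
  falling-length (stop c) = cong suc (rising-length c)
  falling-length {m = m} {a = suc a} (fall c) = trans (cong suc (falling-length c)) (sym (ℕ.+-suc m a))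

mutual
  -- Each clique is opened once and closed once. The extra closing letter belongs to the clique of
  -- the current entry, whose opening letter lies just before os.
  rising-total : {as : Vec ℕ m} {xs : Vec Bool (suc m)} → Rising a as xs os → suc (total os) ≡ total (toList xs)
  rising-total (rise c) = rising-total c
  rising-total (peak c) = cong suc (falling-total c)

  falling-total : {as : Vec ℕ m} {xs : Vec Bool m} → Falling a as xs os → total os ≡ total (toList xs)
  falling-total end      = refl
  falling-total (stop c) = rising-total c
  falling-total (fall c) = falling-total c

mutual
  -- The word os starts at position i - a + 1 for the current index i, so its first t + a letters
  -- reach the vertex i + t. With the opening letter before os added, the inequality says that fewer
  -- cliques are closed before i + t than are opened by then: that vertex lies in a clique. In the
  -- `Falling` state there is no such extra letter, hence the strict inequality.
  rising-covers : {as : Vec ℕ m} {xs : Vec Bool (suc m)} → Rising a as xs os →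
                  ∀ t → t ≤ m → ones t (toList xs) ≤ ones (t + a) os
  rising-covers c zero _ = z≤n
  rising-covers {a = a} {os = os} (rise {xs = xs} c) (suc t) (s≤s t≤m) =
    subst (λ s → ones t (toList xs) ≤ ones s os) (ℕ.+-suc t a) (rising-covers c t t≤m)
  rising-covers {a = a} {os = os} (peak {xs = xs} c) (suc t) t<m =
    subst (λ s → ones t (toList xs) < ones s os) (ℕ.+-suc t a) (falling-covers c t t<m)

  falling-covers : {as : Vec ℕ m} {xs : Vec Bool m} → Falling a as xs os →
                   ∀ t → t < m → ones t (toList xs) < ones (t + suc a) os
  falling-covers {a = a} (stop {os = os} {xs = xs} c) t (s≤s t≤m) =
    subst (λ s → ones t (toList xs) < ones s (true ∷ os)) (sym (ℕ.+-suc t a)) (s≤s (rising-covers c t t≤m))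
  falling-covers (fall {a = a} {os = os} {xs = xs} c) t t<m =
    subst (λ s → ones t (toList xs) < ones s (false ∷ os)) (sym (ℕ.+-suc t (suc a))) (falling-covers c t t<m)

mutual
  -- Length, balance and coverage are inherited when either head advances by one letter, and the
  -- letter read dictates the constructor; hence the three conditions characterise codes.
  decode : (xs : Vec Bool (suc m)) (os : List Bool) → length os ≡ m + a → suc (total os) ≡ total (toList xs) →
           (∀ t → t ≤ m → ones t (toList xs) ≤ ones (t + a) os) → ∃ λ as → Rising a as xs os
  decode {m = zero} (false ∷ []) os len () cov
  decode {m = suc m} {a = a} (false ∷ xs) os len tot cov with decode {a = suc a} xs os
    (trans len (sym (ℕ.+-suc m a))) tot
    (λ t t≤m → subst (λ s → ones t (toList xs) ≤ ones s os) (sym (ℕ.+-suc t a)) (cov (suc t) (s≤s t≤m)))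
  ... | _ , c = _ , rise c
  decode {a = a} (true ∷ xs) os len tot cov with decode↓ {a = a} xs os len (ℕ.suc-injective tot)
    (λ t t<m → subst (λ s → ones t (toList xs) < ones s os) (sym (ℕ.+-suc t a)) (cov (suc t) t<m))
  ... | _ , c = _ , peak c

  decode↓ : (xs : Vec Bool m) (os : List Bool) → length os ≡ m + a → total os ≡ total (toList xs) →
            (∀ t → t < m → ones t (toList xs) < ones (t + suc a) os) → ∃ λ as → Falling a as xs os
  decode↓ {m = zero} {a = zero} [] [] len tot cov = _ , end
  decode↓ {m = zero} [] (true ∷ os) len () cov
  -- With a = 0 the opening letter is that of the next vertex itself. All earlier cliques are
  -- closed, so skipping it would leave this vertex in no clique.
  decode↓ {m = suc m} {a = zero} xs (false ∷ os) len tot cov = contradiction (cov 0 (s≤s z≤n)) (λ ())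
  decode↓ {m = m} {a = suc a} xs (false ∷ os) len tot cov with decode↓ {a = a} xs os
    (ℕ.suc-injective (trans len (ℕ.+-suc m a))) tot
    (λ t t<m → subst (λ s → ones t (toList xs) < ones s (false ∷ os)) (ℕ.+-suc t (suc a)) (cov t t<m))
  ... | _ , c = _ , fall c
  decode↓ {m = suc m} {a = a} xs (true ∷ os) len tot cov with decode {a = a} xs os (ℕ.suc-injective len) tot
    (λ t t≤m → s≤s⁻¹ (subst (λ s → ones t (toList xs) < ones s (true ∷ os)) (ℕ.+-suc t a) (cov t (s≤s t≤m))))
  ... | _ , c = _ , stop c

mutual
  -- An entry 0 means that the vertex is its own left end, so every clique opened before it,
  -- including the one opened just before os, is also closed before it.
  rising-zero : {as : Vec ℕ m} {xs : Vec Bool (suc m)} → Rising a as xs os →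
                ∀ t → lookup as t ≡ 0 → suc (ones (toℕ t + a) os) ≤ ones (suc (toℕ t)) (toList xs)
  rising-zero {a = a} {os = os} (rise {xs = xs} c) (suc t) eq =
    subst (λ s → suc (ones s os) ≤ ones (suc (toℕ t)) (toList xs)) (ℕ.+-suc (toℕ t) a) (rising-zero c t eq)
  rising-zero (peak c) t eq = s≤s (falling-zero c t eq)

  falling-zero : {as : Vec ℕ m} {xs : Vec Bool m} → Falling a as xs os →
                 ∀ t → lookup as t ≡ 0 → ones (toℕ t + a) os ≤ ones (toℕ t) (toList xs)
  falling-zero (stop c) zero refl = z≤n
  falling-zero (stop c) (suc t) eq = rising-zero c t eq
  falling-zero (fall {a = a} {os = os} {xs = xs} c) t eq =
    subst (λ s → ones s (false ∷ os) ≤ ones (toℕ t) (toList xs)) (sym (ℕ.+-suc (toℕ t) a)) (falling-zero c t eq)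

mutual
  -- A vertex with positive entry shares a clique with its predecessor, so before it fewer cliques
  -- are closed than opened. With `rising-zero` this turns `Positive` into the condition that no gap
  -- between neighbouring vertices is empty.
  rising-positive : {as : Vec ℕ m} {xs : Vec Bool (suc m)} → Rising a as xs os →
                    ∀ t → 0 < lookup as t → ones (suc (toℕ t)) (toList xs) ≤ ones (toℕ t + a) os
  rising-positive (rise c) zero pos = z≤n
  rising-positive {a = a} {os = os} (rise {xs = xs} c) (suc t) pos =
    subst (λ s → ones (suc (toℕ t)) (toList xs) ≤ ones s os) (ℕ.+-suc (toℕ t) a) (rising-positive c t pos)
  rising-positive (peak c) t pos = falling-positive c t pos

  falling-positive : {as : Vec ℕ m} {xs : Vec Bool m} → Falling a as xs os →
                     ∀ t → 0 < lookup as t → ones (toℕ t) (toList xs) < ones (toℕ t + a) os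
  falling-positive (stop c) zero (s≤s _) = s≤s z≤n
  falling-positive (stop c) (suc t) pos = s≤s (rising-positive c t pos)
  falling-positive (fall {a = a} {os = os} {xs = xs} c) t pos =
    subst (λ s → ones (toℕ t) (toList xs) < ones s (false ∷ os)) (sym (ℕ.+-suc (toℕ t) a)) (falling-positive c t pos)

-- If as starts at position c + ℓ, the left end belonging to its entry j is ℓ + c + j - a_j;
-- that this is at most ℓ + w is stated without subtraction.
openedBy : Vec Bool n → Vec ℕ n → ℕ → ℕ → Fin n → Bool
openedBy xs as c w j = lookup xs j ∧ (c + toℕ j <ᵇ suc (w + lookup as j))

none-opened : (xs : Vec Bool m) (as : Vec ℕ m) → ∀ b → Climbing b as → count (openedBy xs as (suc b) 0) ≡ 0
none-opened []       []       b _         = refl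
none-opened (x ∷ xs) (a ∷ as) b (a≤b , c) = cong₂ _+_ (first x) (trans
  (count-cong (λ j → cong (λ s → lookup xs j ∧ (s <ᵇ lookup as j)) (ℕ.+-suc b (toℕ j))))
  (none-opened xs as (suc b) (climbing-mono as (s≤s a≤b) c)))
  where
  first : ∀ x → indicator (x ∧ (b + 0 <ᵇ a)) ≡ 0
  first false = refl
  first true with b + 0 <ᵇ a in eq
  ... | false = refl
  ... | true  = contradiction (ℕ.<ᵇ⇒< (b + 0) a (subst T (sym eq) _))
                  (ℕ.≤⇒≯ (ℕ.≤-trans a≤b (ℕ.≤-reflexive (sym (ℕ.+-identityʳ b)))))

mutual
  -- Every letter true of os is the left end of exactly one clique, and cliques are counted here at
  -- their closing letters. Those with left end at most ℓ + w are the current one and one for each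
  -- letter true among the next w.
  rising-opened : {as : Vec ℕ m} {xs : Vec Bool (suc m)} → Rising a as xs os →
                  ∀ w → count (openedBy xs (a ∷ as) a w) ≡ suc (ones w os)
  rising-opened {a = a} (rise {as = as} {xs = xs} c) w = trans
    (count-cong (λ j → cong (λ s → lookup xs j ∧ (s <ᵇ suc (w + lookup (suc a ∷ as) j))) (ℕ.+-suc a (toℕ j))))
    (rising-opened c w)
  rising-opened {a = a} {as = as} (peak {xs = xs} c) w = cong₂ _+_ first (trans
    (count-cong (λ j → cong (λ s → lookup xs j ∧ (s <ᵇ suc (w + lookup as j))) (ℕ.+-suc a (toℕ j))))
    (falling-opened c w))
    where
    first : indicator (a + 0 <ᵇ suc (w + a)) ≡ 1
    first with a + 0 <ᵇ suc (w + a) | ℕ.<⇒<ᵇ (s≤s (ℕ.≤-trans (ℕ.≤-reflexive (ℕ.+-identityʳ a)) (ℕ.m≤n+m a w)))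
    ... | true | _ = refl

  falling-opened : {as : Vec ℕ m} {xs : Vec Bool m} → Falling a as xs os →
                   ∀ w → count (openedBy xs as (suc a) w) ≡ ones w os
  falling-opened end zero    = refl
  falling-opened end (suc w) = refl
  falling-opened (stop {a = a} {as = as} {xs = xs} c) zero = none-opened xs (a ∷ as) a (ℕ.≤-refl , rising⇒climbing c)
  falling-opened (stop c) (suc w) = rising-opened c w
  falling-opened (fall {a = a} {as = as} {xs = xs} c) zero = none-opened xs as (suc a) (climbing-mono as (ℕ.n≤1+n _) (falling⇒climbing c))
  falling-opened (fall c) (suc w) = falling-opened c w

-- Peak-edges

-- j is the last index with left end j - a_j.
Last : Vec ℕ n → Fin n → Set
Last as j = ∀ k → toℕ k ≡ suc (toℕ j) → lookup as k ≤ lookup as j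

last-suc : {as : Vec ℕ n} {j : Fin n} → Last as j → Last (a ∷ as) (suc j)
last-suc last (suc k) eq = last k (ℕ.suc-injective eq)

last-pred : {as : Vec ℕ n} {j : Fin n} → Last (a ∷ as) (suc j) → Last as j
last-pred last k eq = last (suc k) (cong suc eq)

mutual
  rising-last : {as : Vec ℕ m} {xs : Vec Bool (suc m)} → Rising a as xs os → ∀ j → T (lookup xs j) → Last (a ∷ as) j
  rising-last (rise c) (suc j) x = last-suc (rising-last c j x)
  rising-last {as = []} (peak c) zero x zero ()
  rising-last {as = _ ∷ _} (peak c) zero x (suc zero) _ = proj₁ (falling⇒climbing c)
  rising-last (peak c) (suc j) x = last-suc (falling-last c j x)

  falling-last : {as : Vec ℕ m} {xs : Vec Bool m} → Falling a as xs os → ∀ j → T (lookup xs j) → Last as j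
  falling-last (stop c) = rising-last c
  falling-last (fall c) = falling-last c

mutual
  last-rising : {as : Vec ℕ m} {xs : Vec Bool (suc m)} → Rising a as xs os → ∀ j → Last (a ∷ as) j → T (lookup xs j)
  last-rising (rise c) zero    last = contradiction (last (suc zero) refl) ℕ.1+n≰n
  last-rising (rise c) (suc j) last = last-rising c j (last-pred last)
  last-rising (peak c) zero    last = _
  last-rising (peak c) (suc j) last = last-falling c j (last-pred last)

  last-falling : {as : Vec ℕ m} {xs : Vec Bool m} → Falling a as xs os → ∀ j → Last as j → T (lookup xs j)
  last-falling (stop c) = last-rising c
  last-falling (fall c) = last-falling c

predecessor : (j : Fin n) → 0 < toℕ j → ∃ λ (i : Fin n) → toℕ j ≡ suc (toℕ i)
predecessor (suc j) _ = inject₁ j , cong suc (sym (toℕ-inject₁ j))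

module _ {as : Vec ℕ n} (area : IsAreaSequence as) where

  private
    left : Fin n → ℕ
    left j = toℕ j ∸ lookup as j

  left-mono : ∀ {i j} → toℕ i ≤ toℕ j → left i ≤ left j
  left-mono {i} {j} i≤j = go (toℕ j ∸ toℕ i) j (ℕ.m+[n∸m]≡n i≤j)
    where
    go : ∀ d j → toℕ i + d ≡ toℕ j → left i ≤ left j
    go zero j eq rewrite toℕ-injective (trans (sym (ℕ.+-identityʳ (toℕ i))) eq) = ℕ.≤-refl
    go (suc d) j eq with predecessor j (ℕ.<-≤-trans (s≤s z≤n) (ℕ.≤-reflexive (trans (sym (ℕ.+-suc (toℕ i) d)) eq)))
    ... | k , j≡ = ℕ.≤-trans
      (go d k (ℕ.suc-injective (trans (sym (ℕ.+-suc (toℕ i) d)) (trans eq j≡))))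
      (subst (λ x → left k ≤ x ∸ lookup as j) (sym j≡)
        (ℕ.∸-monoʳ-≤ (suc (toℕ k)) (ℕ.≤-trans (proj₂ area k j j≡) (ℕ.≤-reflexive (ℕ.+-comm _ 1)))))

  last⇒left< : ∀ {j k} → Last as j → toℕ k ≡ suc (toℕ j) → left j < left k
  last⇒left< {j} {k} last eq = begin-strict
    toℕ j ∸ lookup as j         <⟨ ℕ.n<1+n _ ⟩
    suc (toℕ j ∸ lookup as j)   ≡⟨ ℕ.+-∸-assoc 1 (proj₁ area j) ⟨
    suc (toℕ j) ∸ lookup as j   ≡⟨ cong (_∸ lookup as j) eq ⟨
    toℕ k ∸ lookup as j         ≤⟨ ℕ.∸-monoʳ-≤ (toℕ k) (last k eq) ⟩
    toℕ k ∸ lookup as k         ∎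
    where open ℕ.≤-Reasoning

  left<⇒last : ∀ {j} → (∀ k → toℕ k ≡ suc (toℕ j) → left j < left k) → Last as j
  left<⇒last {j} lt k eq with lookup as k ≤? lookup as j
  ... | yes le = le
  ... | no  nle = contradiction (lt k eq) (ℕ.≤⇒≯ (ℕ.≤-trans (ℕ.∸-monoʳ-≤ (toℕ k) (ℕ.≰⇒> nle))
                  (ℕ.≤-reflexive (cong (_∸ suc (lookup as j)) eq))))

  -- The missing edge from i - 1 to j makes i the left end of j, and the missing edge from i to j +
  -- 1 makes the left end jump after j. For an isolated vertex the two neighbours give the same two
  -- facts.
  peakEdge⇒last : ∀ {i j} → PeakEdge (Γ as) i j → toℕ i ≡ left j × Last as j
  peakEdge⇒last {i} (inj₁ (refl , isolated)) = i≡ , left<⇒last after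
    where
    a≡0 : lookup as i ≡ 0
    a≡0 with 0 <? lookup as i
    ... | no  a≯0 = ℕ.n≤0⇒n≡0 (ℕ.≮⇒≥ a≯0)
    ... | yes a>0 with predecessor i (ℕ.<-≤-trans a>0 (proj₁ area i))
    ...   | j , i≡ = contradiction
      (inj₂ (ℕ.≤-reflexive (sym i≡) , ℕ.≤-trans (ℕ.∸-monoʳ-≤ (toℕ i) a>0) (ℕ.≤-reflexive (cong pred i≡))))
      (isolated j)
    i≡ : toℕ i ≡ left i
    i≡ = cong (toℕ i ∸_) (sym a≡0)
    after : ∀ k → toℕ k ≡ suc (toℕ i) → left i < left k
    after k eq with left k ≤? toℕ i
    ... | yes le = contradiction (inj₁ (ℕ.≤-reflexive (sym eq) , le)) (isolated k)
    ... | no  nle = ℕ.≤-<-trans (ℕ.m∸n≤m (toℕ i) (lookup as i)) (ℕ.≰⇒> nle)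
  peakEdge⇒last {i} {j} (inj₂ (i<j , inj₂ (j<i , _) , _)) = contradiction i<j (ℕ.<-asym j<i)
  peakEdge⇒last {i} {j} (inj₂ (i<j , inj₁ (_ , left≤i) , ¬after , ¬before)) = i≡ , left<⇒last after
    where
    i≡ : toℕ i ≡ left j
    i≡ with ℕ.m≤n⇒m<n∨m≡n left≤i
    ... | inj₂ eq = sym eq
    ... | inj₁ left<i with predecessor i (ℕ.≤-<-trans z≤n left<i)
    ...   | k , i≡ = contradiction
      (inj₁ (ℕ.<-trans (ℕ.≤-reflexive (sym i≡)) i<j , s≤s⁻¹ (ℕ.≤-trans left<i (ℕ.≤-reflexive i≡))))
      (¬before k i≡)
    after : ∀ k → toℕ k ≡ suc (toℕ j) → left j < left k
    after k eq with left k ≤? toℕ i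
    ... | yes le = contradiction (inj₁ (ℕ.<-trans i<j (ℕ.≤-reflexive (sym eq)) , le)) (¬after k eq)
    ... | no  nle = ℕ.≤-<-trans (ℕ.≤-reflexive (sym i≡)) (ℕ.≰⇒> nle)

  last⇒peakEdge : ∀ {i j} → toℕ i ≡ left j → Last as j → PeakEdge (Γ as) i j
  last⇒peakEdge {i} {j} i≡ last with ℕ.m≤n⇒m<n∨m≡n (ℕ.≤-trans (ℕ.≤-reflexive i≡) (ℕ.m∸n≤m (toℕ j) (lookup as j)))
  ... | inj₁ i<j = inj₂ (i<j , inj₁ (i<j , ℕ.≤-reflexive (sym i≡)) , after , before)
    where
    after : ∀ k → toℕ k ≡ suc (toℕ j) → ¬ Γ as i k
    after k eq (inj₁ (_ , le)) = ℕ.<⇒≱ (last⇒left< last eq) (ℕ.≤-trans le (ℕ.≤-reflexive i≡))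
    after k eq (inj₂ (k<i , _)) = ℕ.<-asym k<i (ℕ.<-trans i<j (ℕ.≤-reflexive (sym eq)))
    before : ∀ k → toℕ i ≡ suc (toℕ k) → ¬ Γ as k j
    before k eq (inj₁ (_ , le)) = ℕ.<⇒≱ (ℕ.≤-reflexive (sym eq)) (ℕ.≤-trans (ℕ.≤-reflexive i≡) le)
    before k eq (inj₂ (j<k , _)) = ℕ.<-asym j<k (ℕ.<-trans (ℕ.≤-reflexive (sym eq)) i<j)
  ... | inj₂ i≡j with toℕ-injective i≡j
  ...   | refl = inj₁ (refl , isolated)
    where
    isolated : ∀ k → ¬ Γ as i k
    isolated k (inj₁ (i<k , le)) = ℕ.<⇒≱ (ℕ.<-≤-trans (ℕ.≤-<-trans (ℕ.≤-reflexive i≡) (last⇒left< last toℕi⁺))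
                                          (left-mono (ℕ.≤-trans (ℕ.≤-reflexive toℕi⁺) i<k))) le
      where
      i⁺ = fromℕ< (ℕ.≤-<-trans i<k (toℕ<n k))
      toℕi⁺ : toℕ i⁺ ≡ suc (toℕ i)
      toℕi⁺ = toℕ-fromℕ< (ℕ.≤-<-trans i<k (toℕ<n k))
    isolated k (inj₂ (k<i , le)) = ℕ.<⇒≱ k<i (ℕ.≤-trans (ℕ.≤-reflexive i≡) le)

  -- A peak-edge is determined by its right end j, the left end being j - a_j, so pairs can be
  -- counted by j alone. `openedBy` then expresses that the left end is at most v.
  peakNesting-count : (xs : Vec Bool n) → (∀ j → T (lookup xs j) → Last as j) → (∀ j → Last as j → T (lookup xs j)) →
    ∀ v → peakNesting as v ≡ count (λ j → openedBy xs as 0 (toℕ v) j ∧ (toℕ v ≤ᵇ toℕ j))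
  peakNesting-count xs closes⇒last last⇒closes v = trans
    (length-bijection R
      (Unique.filter⁺ clique? (Unique.cartesianProduct⁺ (Unique.allFin⁺ n) (Unique.allFin⁺ n)))
      (Unique.filter⁺ (T? ∘ counted) (Unique.allFin⁺ n))
      (λ {e} e∈ → forth e (proj₂ (∈-filter⁻ clique? {xs = cartesianProduct (allFin n) (allFin n)} e∈)))
      (λ {j} j∈ → back j (proj₂ (∈-filter⁻ (T? ∘ counted) {xs = allFin n} j∈)))
      (λ { {i , j} {i′ , .j} {.j} (r , refl) (r′ , refl) → cong (_, j) (toℕ-injective (trans r (sym r′))) })
      (λ { (_ , refl) (_ , refl) → refl }))
    (length-filter-tabulate (T? ∘ counted) (λ j → j))
    where
    counted : Fin n → Bool
    counted j = openedBy xs as 0 (toℕ v) j ∧ (toℕ v ≤ᵇ toℕ j)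
    clique? = peakCliqueContaining? as v
    R : Fin n × Fin n → Fin n → Set
    R (i , j) j′ = toℕ i ≡ left j × j ≡ j′

    forth : ∀ e → PeakCliqueContaining as v e → ∃ λ j → j ∈ filter (T? ∘ counted) (allFin n) × R e j
    forth (i , j) (edge , i≤v , v≤j) with peakEdge⇒last edge
    ... | i≡ , last = j , ∈-filter⁺ (T? ∘ counted) (∈-allFin j)
      (Equivalence.from T-∧ (Equivalence.from T-∧ (last⇒closes j last , ℕ.<⇒<ᵇ (s≤s
         (ℕ.≤-trans (ℕ.m≤n+m∸n (toℕ j) (lookup as j)) (ℕ.≤-trans (ℕ.+-monoʳ-≤ (lookup as j) (ℕ.≤-trans (ℕ.≤-reflexive (sym i≡)) i≤v))
           (ℕ.≤-reflexive (ℕ.+-comm (lookup as j) (toℕ v))))))) , ℕ.≤⇒≤ᵇ v≤j)) , i≡ , refl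

    back : ∀ j → T (counted j) → ∃ λ e → e ∈ filter clique? (cartesianProduct (allFin n) (allFin n)) × R e j
    back j t with Equivalence.to T-∧ t
    ... | t₁ , v≤j with Equivalence.to T-∧ t₁
    ...   | closes , opened = (i , j) , ∈-filter⁺ clique? (∈-cartesianProduct⁺ (∈-allFin i) (∈-allFin j))
      (last⇒peakEdge toℕi (closes⇒last j closes) ,
       ℕ.≤-trans (ℕ.≤-reflexive toℕi) (ℕ.m≤n+o⇒m∸n≤o (toℕ j) (lookup as j)
         (ℕ.≤-trans (s≤s⁻¹ (ℕ.<ᵇ⇒< _ _ opened)) (ℕ.≤-reflexive (ℕ.+-comm (toℕ v) (lookup as j))))) ,
       ℕ.≤ᵇ⇒≤ _ _ v≤j) , toℕi , refl
      where
      left<n : left j < n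
      left<n = ℕ.≤-<-trans (ℕ.m∸n≤m (toℕ j) (lookup as j)) (toℕ<n j)
      i = fromℕ< left<n
      toℕi : toℕ i ≡ left j
      toℕi = toℕ-fromℕ< left<n

-- Nesting numbers as differences of prefix counts

ones-count : ∀ t (xs : Vec Bool n) → ones t (toList xs) ≡ count (λ j → lookup xs j ∧ (toℕ j <ᵇ t))
ones-count zero    []           = refl
ones-count zero    (true ∷ xs)  = ones-count zero xs
ones-count zero    (false ∷ xs) = ones-count zero xs
ones-count (suc t) []           = refl
ones-count (suc t) (true ∷ xs)  = cong suc (ones-count t xs)
ones-count (suc t) (false ∷ xs) = ones-count t xs

-- Since j < v implies j ≤ v + a, a clique closed before v has been opened by v. So the cliques
-- opened by v are those containing v and those closed before v.
split-<ᵇ : ∀ x j v a → indicator (x ∧ (j <ᵇ suc (v + a))) ≡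
           indicator ((x ∧ (j <ᵇ suc (v + a))) ∧ (v ≤ᵇ j)) + indicator (x ∧ (j <ᵇ v))
split-<ᵇ false j       v       a = refl
split-<ᵇ true  zero    zero    a = refl
split-<ᵇ true  zero    (suc v) a = refl
split-<ᵇ true  (suc j) zero    a with j <ᵇ a
... | true  = refl
... | false = refl
split-<ᵇ true  (suc j) (suc v) a = trans (split-<ᵇ true j v a)
  (cong (λ b → indicator ((j <ᵇ suc (v + a)) ∧ b) + indicator (j <ᵇ v)) (≤ᵇ-suc v j))
  where
  ≤ᵇ-suc : ∀ v j → (v ≤ᵇ j) ≡ (v <ᵇ suc j)
  ≤ᵇ-suc zero    j = refl
  ≤ᵇ-suc (suc v) j = refl

peakNesting-ones : {as : Vec ℕ n} {xs : Vec Bool (suc n)} → IsAreaSequence (0 ∷ as) → Rising 0 as xs os →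
                   ∀ v → peakNesting (0 ∷ as) v + ones (toℕ v) (toList xs) ≡ suc (ones (toℕ v) os)
peakNesting-ones {os = os} {as = as} {xs} area c v = begin
  peakNesting (0 ∷ as) v + ones (toℕ v) (toList xs)
    ≡⟨ cong₂ _+_ (peakNesting-count {as = 0 ∷ as} area xs (rising-last c) (last-rising c) v) (ones-count (toℕ v) xs) ⟩
  count g + count h
    ≡⟨ count-+ {f = f} {g} {h} (λ j → split-<ᵇ (lookup xs j) (toℕ j) (toℕ v) (lookup (0 ∷ as) j)) ⟨
  count f
    ≡⟨ rising-opened c (toℕ v) ⟩
  suc (ones (toℕ v) os) ∎
  where
  open ≡-Reasoning
  f = openedBy xs (0 ∷ as) 0 (toℕ v)
  g = λ j → f j ∧ (toℕ v ≤ᵇ toℕ j)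
  h = λ j → lookup xs j ∧ (toℕ j <ᵇ toℕ v)

module _ {A : Set} (f : A → ℕ) {k : ℕ} where

  maximum-≤⁺ : ∀ xs → (∀ {x} → x ∈ xs → f x ≤ k) → foldr _⊔_ 0 (map f xs) ≤ k
  maximum-≤⁺ []       _  = z≤n
  maximum-≤⁺ (x ∷ xs) f≤ = ℕ.⊔-lub (f≤ (here refl)) (maximum-≤⁺ xs (f≤ ∘ there))

  maximum-≤⁻ : ∀ xs → foldr _⊔_ 0 (map f xs) ≤ k → ∀ {x} → x ∈ xs → f x ≤ k
  maximum-≤⁻ (x ∷ xs) ≤k (here refl) = ℕ.≤-trans (ℕ.m≤m⊔n (f x) _) ≤k
  maximum-≤⁻ (x ∷ xs) ≤k (there x∈)  = maximum-≤⁻ xs (ℕ.≤-trans (ℕ.m≤n⊔m (f x) _) ≤k) x∈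

climbing-bound : ∀ {b} (as : Vec ℕ n) → Climbing b as → ∀ i → lookup as i ≤ b + toℕ i
climbing-bound {b = b} (a ∷ as) (a≤b , c) zero    = ℕ.≤-trans a≤b (ℕ.m≤m+n b 0)
climbing-bound {b = b} (a ∷ as) (a≤b , c) (suc i) = ℕ.≤-trans (climbing-bound as c i)
  (ℕ.≤-trans (s≤s (ℕ.+-monoˡ-≤ (toℕ i) a≤b)) (ℕ.≤-reflexive (sym (ℕ.+-suc b (toℕ i)))))

climbing-step : ∀ {b} (as : Vec ℕ n) → Climbing b as →
                ∀ i j → toℕ j ≡ suc (toℕ i) → lookup as j ≤ lookup as i + 1
climbing-step (a ∷ a′ ∷ as) (_ , a′≤ , _) zero (suc zero) _ = ℕ.≤-trans a′≤ (ℕ.≤-reflexive (ℕ.+-comm 1 a))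
climbing-step (a ∷ as) (_ , c) (suc i) (suc j) eq = climbing-step as c i j (ℕ.suc-injective eq)

climbing⇒area : (as : Vec ℕ n) → Climbing 0 as → IsAreaSequence as
climbing⇒area as c = climbing-bound as c , climbing-step as c

step⇒climbing : (as : Vec ℕ n) → (∀ i j → toℕ j ≡ suc (toℕ i) → lookup as j ≤ lookup as i + 1) →
                ∀ b → (∀ i → toℕ i ≡ 0 → lookup as i ≤ b) → Climbing b as
step⇒climbing []       _    _ _    = _
step⇒climbing (a ∷ as) step b head = head zero refl ,
  step⇒climbing as (λ i j eq → step (suc i) (suc j) (cong suc eq)) (suc a)
    (λ i eq → ℕ.≤-trans (step zero (suc i) (cong suc eq)) (ℕ.≤-reflexive (ℕ.+-comm a 1)))

area⇒climbing : (as : Vec ℕ n) → IsAreaSequence as → Climbing 0 as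
area⇒climbing as (le , step) = step⇒climbing as step 0 (λ i eq → ℕ.≤-trans (le i) (ℕ.≤-reflexive eq))

-- Walks in a strip

Code : ℕ → Set
Code n = Vec Bool n × List Bool

closing keeping : Code n → Code (suc n)
closing (xs , os) = true ∷ xs , os
keeping (xs , os) = false ∷ xs , os

opening skipping : Code n → Code n
opening (xs , os) = xs , true ∷ os
skipping (xs , os) = xs , false ∷ os

-- Codes of the last n points when h intervals contain both neighbouring points, respectively
-- of the last n + 1 points when h + 1 intervals contain the first of them and its opening
-- letter has been read. At most k intervals may contain a point; if c holds, two
-- neighbouring points must have an interval in common.
mutual
  gaps : Bool → ℕ → ∀ n → ℕ → List (Code n)
  gaps c k zero    zero    = ([] , []) ∷ []
  gaps c k zero    (suc h) = []
  gaps c k (suc n) zero    = if c then [] else map opening (points c k n 0)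
  gaps c k (suc n) (suc h) = map opening (points c k n (suc h)) ++ map skipping (points c k n h)

  points : Bool → ℕ → ∀ n → ℕ → List (Code (suc n))
  points c k n h = if h <ᵇ k then map closing (gaps c k n h) ++ map keeping (gaps c k n (suc h)) else []

-- The recursion of `gaps` unrolled into prefix counts. At the vertex t, `lower` and `upper` ask for
-- at least one and at most k intervals; `connected` asks for one in the gap before it.
record Gap (c : Bool) (k n h : ℕ) (xs : Vec Bool n) (os : List Bool) : Set where
  constructor gap
  field
    len       : length os ≡ n
    balance   : h + total os ≡ total (toList xs)
    lower     : ∀ t → t < n → ones t (toList xs) < h + ones (suc t) os
    upper     : ∀ t → t < n → h + ones (suc t) os ≤ k + ones t (toList xs)
    connected : T c → ∀ t → t < n → ones t (toList xs) < h + ones t os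

-- Here the opening letter of the first vertex has already been counted in h + 1, so os lags one
-- vertex behind xs, and `connected` concerns the gap after the vertex t.
record Point (c : Bool) (k n h : ℕ) (xs : Vec Bool (suc n)) (os : List Bool) : Set where
  constructor point
  field
    len       : length os ≡ n
    balance   : suc h + total os ≡ total (toList xs)
    lower     : ∀ t → t ≤ n → ones t (toList xs) ≤ h + ones t os
    upper     : ∀ t → t ≤ n → suc h + ones t os ≤ k + ones t (toList xs)
    connected : T c → ∀ t → t < n → ones (suc t) (toList xs) ≤ h + ones t os

module _ {k : ℕ} where
  mutual
    gap⇒∈ : ∀ {c n h xs os} → Gap c k n h xs os → (xs , os) ∈ gaps c k n h
    gap⇒∈ {c} {zero} {zero} {[]} {[]} g = here refl
    gap⇒∈ {c} {zero} {suc h} {[]} {[]} (gap _ () _ _ _)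
    gap⇒∈ {true} {suc n} {zero} {xs} {true ∷ os} (gap len bal lo up conn) = contradiction (conn _ 0 (s≤s z≤n)) (λ ())
    gap⇒∈ {false} {suc n} {zero} {xs} {true ∷ os} (gap len bal lo up conn) = ∈-map⁺ opening (point⇒∈ (point (ℕ.suc-injective len) bal
      (λ t t≤n → s≤s⁻¹ (lo t (s≤s t≤n))) (λ t t≤n → up t (s≤s t≤n)) λ ()))
    gap⇒∈ {c} {suc n} {zero} {xs} {false ∷ os} (gap len bal lo up conn) = contradiction (lo 0 (s≤s z≤n)) (λ ())
    gap⇒∈ {c} {suc n} {suc h} {xs} {true ∷ os} (gap len bal lo up conn) = ∈-++⁺ˡ (∈-map⁺ opening (point⇒∈ (point
      (ℕ.suc-injective len) (trans (sym (ℕ.+-suc (suc h) (total os))) bal)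
      (λ t t≤n → s≤s⁻¹ (ℕ.≤-trans (lo t (s≤s t≤n)) (ℕ.≤-reflexive (ℕ.+-suc (suc h) (ones t os)))))
      (λ t t≤n → ℕ.≤-trans (ℕ.≤-reflexive (sym (ℕ.+-suc (suc h) (ones t os)))) (up t (s≤s t≤n)))
      (λ c t t<n → s≤s⁻¹ (ℕ.≤-trans (conn c (suc t) (s≤s t<n)) (ℕ.≤-reflexive (ℕ.+-suc (suc h) (ones t os))))))))
    gap⇒∈ {c} {suc n} {suc h} {xs} {false ∷ os} (gap len bal lo up conn) = ∈-++⁺ʳ _ (∈-map⁺ skipping (point⇒∈ (point
      (ℕ.suc-injective len) bal (λ t t≤n → s≤s⁻¹ (lo t (s≤s t≤n))) (λ t t≤n → up t (s≤s t≤n))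
      (λ c t t<n → s≤s⁻¹ (conn c (suc t) (s≤s t<n))))))

    point⇒∈ : ∀ {c n h xs os} → Point c k n h xs os → (xs , os) ∈ points c k n h
    point⇒∈ {c} {n} {h} {x ∷ xs} {os} (point len bal lo up conn)
      with h <ᵇ k | ℕ.<⇒<ᵇ {h} {k} (subst₂ _≤_ (ℕ.+-identityʳ (suc h)) (ℕ.+-identityʳ k) (up 0 z≤n))
    point⇒∈ {c} {n} {h} {true ∷ xs} {os} (point len bal lo up conn) | true | _ = ∈-++⁺ˡ (∈-map⁺ closing (gap⇒∈ (gap
      len (ℕ.suc-injective bal) (λ t t<n → lo (suc t) t<n)
      (λ t t<n → s≤s⁻¹ (ℕ.≤-trans (up (suc t) t<n) (ℕ.≤-reflexive (ℕ.+-suc k (ones t (toList xs))))))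
      conn)))
    point⇒∈ {c} {n} {h} {false ∷ xs} {os} (point len bal lo up conn) | true | _ = ∈-++⁺ʳ _ (∈-map⁺ keeping (gap⇒∈ (gap
      len bal (λ t t<n → s≤s (lo (suc t) t<n)) (λ t t<n → up (suc t) t<n) (λ c t t<n → s≤s (conn c t t<n)))))

  mutual
    ∈⇒gap : ∀ {c n h xs os} → (xs , os) ∈ gaps c k n h → Gap c k n h xs os
    ∈⇒gap {c} {zero} {zero} (here refl) = gap refl refl (λ _ ()) (λ _ ()) (λ _ _ ())
    ∈⇒gap {false} {suc n} {zero} e∈ with ∈-map⁻ opening e∈
    ... | (xs , os) , e∈ , refl with ∈⇒point e∈
    ...   | point len bal lo up conn = gap (cong suc len) bal
      (λ t t<n → s≤s (lo t (s≤s⁻¹ t<n))) (λ t t<n → up t (s≤s⁻¹ t<n)) (λ ())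
    ∈⇒gap {c} {suc n} {suc h} e∈ with ∈-++⁻ (map opening (points c k n (suc h))) e∈
    ... | inj₁ e∈ with ∈-map⁻ opening e∈
    ...   | (xs , os) , e∈ , refl with ∈⇒point e∈
    ...     | point len bal lo up conn = gap (cong suc len) (trans (ℕ.+-suc (suc h) (total os)) bal)
      (λ t t<n → ℕ.≤-trans (s≤s (lo t (s≤s⁻¹ t<n))) (ℕ.≤-reflexive (sym (ℕ.+-suc (suc h) (ones t os)))))
      (λ t t<n → ℕ.≤-trans (ℕ.≤-reflexive (ℕ.+-suc (suc h) (ones t os))) (up t (s≤s⁻¹ t<n)))
      (λ { c zero _ → s≤s z≤n
         ; c (suc t) t<n → ℕ.≤-trans (s≤s (conn c t (s≤s⁻¹ t<n))) (ℕ.≤-reflexive (sym (ℕ.+-suc (suc h) (ones t os)))) })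
    ∈⇒gap {c} {suc n} {suc h} _ | inj₂ e∈ with ∈-map⁻ skipping e∈
    ...   | (xs , os) , e∈ , refl with ∈⇒point e∈
    ...     | point len bal lo up conn = gap (cong suc len) bal
      (λ t t<n → s≤s (lo t (s≤s⁻¹ t<n))) (λ t t<n → up t (s≤s⁻¹ t<n))
      (λ { c zero _ → s≤s z≤n ; c (suc t) t<n → s≤s (conn c t (s≤s⁻¹ t<n)) })

    ∈⇒point : ∀ {c n h xs os} → (xs , os) ∈ points c k n h → Point c k n h xs os
    ∈⇒point {c} {n} {h} e∈ with h <ᵇ k in eq
    ... | true with ∈-++⁻ (map closing (gaps c k n h)) e∈ | ℕ.<ᵇ⇒< h k (subst T (sym eq) _)
    ...   | inj₁ e∈ | h<k with ∈-map⁻ closing e∈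
    ...     | (xs , os) , e∈ , refl with ∈⇒gap e∈
    ...       | gap len bal lo up conn = point len (cong suc bal)
      (λ { zero _ → z≤n ; (suc t) t<n → lo t t<n })
      (λ { zero _ → ℕ.+-monoˡ-≤ 0 h<k
         ; (suc t) t<n → ℕ.≤-trans (s≤s (up t t<n)) (ℕ.≤-reflexive (sym (ℕ.+-suc k (ones t (toList xs))))) })
      conn
    ∈⇒point {c} {n} {h} _ | true | inj₂ e∈ | h<k with ∈-map⁻ keeping e∈
    ...     | (xs , os) , e∈ , refl with ∈⇒gap e∈
    ...       | gap len bal lo up conn = point len bal
      (λ { zero _ → z≤n ; (suc t) t<n → s≤s⁻¹ (lo t t<n) })
      (λ { zero _ → ℕ.+-monoˡ-≤ 0 h<k ; (suc t) t<n → up t t<n })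
      (λ c t t<n → s≤s⁻¹ (conn c t t<n))

-- strip B m y counts the walks of m steps ±1 from y to 0 that stay in {0,…,B-1}.
mutual
  strip : ℕ → ℕ → ℕ → ℕ
  strip B m y = if y <ᵇ B then steps B m y else 0

  steps : ℕ → ℕ → ℕ → ℕ
  steps B zero    zero    = 1
  steps B zero    (suc y) = 0
  steps B (suc m) zero    = strip B m 1
  steps B (suc m) (suc y) = strip B m (2 + y) + strip B m y

strip-inside : ∀ {B} m {y} → y < B → strip B m y ≡ steps B m y
strip-inside {B} m {y} y<B with y <ᵇ B | ℕ.<⇒<ᵇ y<B
... | true | _ = refl

strip-outside : ∀ {B} m {y} → B ≤ y → strip B m y ≡ 0
strip-outside {B} m {y} B≤y with y <ᵇ B in eq
... | false = refl
... | true  = contradiction (ℕ.<ᵇ⇒< y B (subst T (sym eq) _)) (ℕ.≤⇒≯ B≤y)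

mutual
  gaps-unique : ∀ c k n h → Unique (gaps c k n h)
  gaps-unique c     k zero    zero    = [] ∷ []
  gaps-unique c     k zero    (suc h) = []
  gaps-unique true  k (suc n) zero    = []
  gaps-unique false k (suc n) zero    = Unique.map⁺ (λ { refl → refl }) (points-unique false k n 0)
  gaps-unique c     k (suc n) (suc h) = Unique.++⁺
    (Unique.map⁺ (λ { refl → refl }) (points-unique c k n (suc h)))
    (Unique.map⁺ (λ { refl → refl }) (points-unique c k n h))
    λ { (e∈ , e∈′) → disjoint e∈ e∈′ }
    where
    disjoint : ∀ {e} → e ∈ map opening (points c k n (suc h)) → ¬ e ∈ map skipping (points c k n h)
    disjoint e∈ e∈′ with ∈-map⁻ opening e∈ | ∈-map⁻ skipping e∈′
    ... | _ , _ , refl | _ , _ , ()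

  points-unique : ∀ c k n h → Unique (points c k n h)
  points-unique c k n h with h <ᵇ k
  ... | false = []
  ... | true  = Unique.++⁺
    (Unique.map⁺ (λ { refl → refl }) (gaps-unique c k n h))
    (Unique.map⁺ (λ { refl → refl }) (gaps-unique c k n (suc h)))
    λ { (e∈ , e∈′) → disjoint e∈ e∈′ }
    where
    disjoint : ∀ {e} → e ∈ map closing (gaps c k n h) → ¬ e ∈ map keeping (gaps c k n (suc h))
    disjoint e∈ e∈′ with ∈-map⁻ closing e∈ | ∈-map⁻ keeping e∈′
    ... | _ , _ , refl | _ , _ , ()

double-<ᵇ : ∀ h k → (h * 2 <ᵇ k * 2) ≡ (h <ᵇ k)
double-<ᵇ zero    zero    = refl
double-<ᵇ zero    (suc k) = refl
double-<ᵇ (suc h) zero    = refl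
double-<ᵇ (suc h) (suc k) = double-<ᵇ h k

length-map-++ : {A B C : Set} (f : A → C) (g : B → C) (xs : List A) (ys : List B) →
                length (map f xs ++ map g ys) ≡ length xs + length ys
length-map-++ f g xs ys = trans (length-++ (map f xs)) (cong₂ _+_ (length-map f xs) (length-map g ys))

points-outside : ∀ c k n {h} → k ≤ h → points c k n h ≡ []
points-outside c k n {h} k≤h with h <ᵇ k in eq
... | false = refl
... | true  = contradiction (ℕ.<ᵇ⇒< h k (subst T (sym eq) _)) (ℕ.≤⇒≯ k≤h)

-- With h intervals in a gap at height 2h and h + 1 intervals at a point at height 2h + 1, a
-- code becomes a walk with steps ±1.
mutual
  length-gaps : ∀ k n h → length (gaps false k n h) ≡ strip (suc (k * 2)) (n * 2) (h * 2)
  length-gaps k zero    zero    = refl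
  length-gaps k zero    (suc h) with suc h * 2 <ᵇ suc (k * 2)
  ... | true  = refl
  ... | false = refl
  length-gaps k (suc n) zero    = trans (length-map opening (points false k n 0)) (length-points k n 0)
  length-gaps k (suc n) (suc h) with h <? k
  ... | yes h<k = trans (length-map-++ opening skipping (points false k n (suc h)) (points false k n h))
    (trans (cong₂ _+_ (length-points k n (suc h)) (length-points k n h))
      (sym (strip-inside (suc n * 2) (s≤s (ℕ.*-monoˡ-≤ 2 h<k)))))
  ... | no  h≮k = trans (cong length (cong₂ (λ x y → map opening x ++ map skipping y)
      (points-outside false k n (ℕ.m≤n⇒m≤1+n (ℕ.≮⇒≥ h≮k))) (points-outside false k n (ℕ.≮⇒≥ h≮k))))
      (sym (strip-outside (suc n * 2) (s≤s (ℕ.m≤n⇒m≤1+n (ℕ.*-monoˡ-≤ 2 (ℕ.≮⇒≥ h≮k))))))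

  length-points : ∀ k n h → length (points false k n h) ≡ strip (suc (k * 2)) (suc (n * 2)) (suc (h * 2))
  length-points k n h rewrite double-<ᵇ h k with h <ᵇ k
  ... | false = refl
  ... | true  = trans (length-map-++ closing keeping (gaps false k n h) (gaps false k n (suc h)))
    (trans (ℕ.+-comm (length (gaps false k n h)) _) (cong₂ _+_ (length-gaps k n (suc h)) (length-gaps k n h)))

-- When no gap may be empty, the first opening and the last closing letter are forced; the
-- walk starts after the former, at height 0 instead of 1, and ends before the latter.
mutual
  length-gapsᶜ : ∀ k n h → length (gaps true k (suc n) (suc h)) ≡ strip (k * 2) (suc (n * 2)) (suc (h * 2))
  length-gapsᶜ k n h with h <? k
  ... | yes h<k = trans (length-map-++ opening skipping (points true k n (suc h)) (points true k n h))
    (trans (cong₂ _+_ (length-pointsᶜ k n (suc h)) (length-pointsᶜ k n h))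
      (sym (strip-inside (suc (n * 2)) (ℕ.*-monoˡ-≤ 2 h<k))))
  ... | no  h≮k = trans (cong length (cong₂ (λ x y → map opening x ++ map skipping y)
      (points-outside true k n (ℕ.m≤n⇒m≤1+n (ℕ.≮⇒≥ h≮k))) (points-outside true k n (ℕ.≮⇒≥ h≮k))))
      (sym (strip-outside (suc (n * 2)) (ℕ.m≤n⇒m≤1+n (ℕ.*-monoˡ-≤ 2 (ℕ.≮⇒≥ h≮k)))))

  length-pointsᶜ : ∀ k n h → length (points true k n h) ≡ strip (k * 2) (n * 2) (h * 2)
  length-pointsᶜ k n h rewrite double-<ᵇ h k with h <ᵇ k
  length-pointsᶜ k n       h       | false = refl
  length-pointsᶜ k zero    zero    | true  = refl
  length-pointsᶜ k zero    (suc h) | true  = refl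
  -- Closing the only interval would leave the next gap empty; this list is empty, just as the walk
  -- cannot step below height 0.
  length-pointsᶜ k (suc n) zero    | true  = trans
    (length-map-++ closing keeping (gaps true k (suc n) 0) (gaps true k (suc n) 1)) (length-gapsᶜ k n 0)
  length-pointsᶜ k (suc n) (suc h) | true  = trans
    (length-map-++ closing keeping (gaps true k (suc n) (suc h)) (gaps true k (suc n) (suc (suc h))))
    (trans (ℕ.+-comm (length (gaps true k (suc n) (suc h))) _)
      (cong₂ _+_ (length-gapsᶜ k n (suc h)) (length-gapsᶜ k n h)))

-- From area sequences to walks

pnest-≤⁺ : ∀ {k} (as : Vec ℕ n) → (∀ v → peakNesting as v ≤ k) → pnest as ≤ k
pnest-≤⁺ as f≤ = maximum-≤⁺ (peakNesting as) (allFin _) (λ {v} _ → f≤ v)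

pnest-≤⁻ : ∀ {k} (as : Vec ℕ n) → pnest as ≤ k → ∀ v → peakNesting as v ≤ k
pnest-≤⁻ as ≤k v = maximum-≤⁻ (peakNesting as) (allFin _) ≤k (∈-allFin v)

-- The first entry of an area sequence is 0 and the first vertex always opens a clique, so its
-- opening letter is left out of the code.
CodeOf : Vec ℕ (suc n) → Code (suc n) → Set
CodeOf (a ∷ as) (xs , os) = a ≡ 0 × Rising 0 as xs os

module _ {c : Bool} {k n : ℕ} {as : Vec ℕ n} {xs : Vec Bool (suc n)} {os : List Bool} (r : Rising 0 as xs os) where

  private
    area : IsAreaSequence (0 ∷ as)
    area = climbing⇒area (0 ∷ as) (z≤n , rising⇒climbing r)

  code⇒point : (T c → Positive (0 ∷ as)) → pnest (0 ∷ as) ≤ k → Point c k n 0 xs os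
  code⇒point pos ≤k = point
    (trans (rising-length r) (ℕ.+-identityʳ n))
    (rising-total r)
    (λ t t≤n → subst (λ s → ones t (toList xs) ≤ ones s os) (ℕ.+-identityʳ t) (rising-covers r t t≤n))
    (λ t t≤n → subst (λ t → suc (ones t os) ≤ k + ones t (toList xs)) (toℕ-fromℕ< (s≤s t≤n)) (upper (fromℕ< (s≤s t≤n))))
    (λ c t t<n → subst (λ t → ones (suc t) (toList xs) ≤ ones t os) (toℕ-fromℕ< t<n) (connected c (fromℕ< t<n)))
    where
    upper : ∀ v → suc (ones (toℕ v) os) ≤ k + ones (toℕ v) (toList xs)
    upper v = ℕ.≤-trans (ℕ.≤-reflexive (sym (peakNesting-ones area r v)))
      (ℕ.+-monoˡ-≤ (ones (toℕ v) (toList xs)) (pnest-≤⁻ (0 ∷ as) ≤k v))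
    connected : T c → ∀ t → ones (suc (toℕ t)) (toList xs) ≤ ones (toℕ t) os
    connected c t = subst (λ s → ones (suc (toℕ t)) (toList xs) ≤ ones s os) (ℕ.+-identityʳ (toℕ t))
      (rising-positive r t (pos c (suc t) (s≤s z≤n)))

  point⇒positive : Point c k n 0 xs os → T c → Positive (0 ∷ as)
  point⇒positive p c (suc t) _ = ℕ.n≢0⇒n>0 λ eq → ℕ.<⇒≱
    (subst (λ s → ones s os < ones (suc (toℕ t)) (toList xs)) (ℕ.+-identityʳ (toℕ t)) (rising-zero r t eq))
    (Point.connected p c (toℕ t) (toℕ<n t))

  point⇒pnest : Point c k n 0 xs os → pnest (0 ∷ as) ≤ k
  point⇒pnest p = pnest-≤⁺ (0 ∷ as) λ v → ℕ.+-cancelʳ-≤ (ones (toℕ v) (toList xs)) _ _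
    (ℕ.≤-trans (ℕ.≤-reflexive (peakNesting-ones area r v)) (Point.upper p (toℕ v) (s≤s⁻¹ (toℕ<n v))))

point-decode : ∀ {c k n xs os} → Point c k n 0 xs os → ∃ λ as → Rising 0 as xs os
point-decode {n = n} {xs} {os} p = decode xs os (trans (Point.len p) (sym (ℕ.+-identityʳ n))) (Point.balance p)
  (λ t t≤n → subst (λ s → ones t (toList xs) ≤ ones s os) (sym (ℕ.+-identityʳ t)) (Point.lower p t t≤n))

codeOf-entries-unique : {as as′ : Vec ℕ (suc n)} {e : Code (suc n)} → CodeOf as e → CodeOf as′ e → as ≡ as′
codeOf-entries-unique {as = _ ∷ _} {_ ∷ _} (refl , r) (refl , r′) = cong (0 ∷_) (rising-entries-unique r r′)

codeOf-code-unique : {as : Vec ℕ (suc n)} {e e′ : Code (suc n)} → CodeOf as e → CodeOf as e′ → e ≡ e′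
codeOf-code-unique {as = _ ∷ _} (_ , r) (_ , r′) = rising-code-unique r r′

-- The flag c lets `DP` and `DPᶜ` share one proof. `Positive` stands for connectedness because it is
-- a condition on entries, which the code shows directly.
atMost-points : ∀ c k n {ass : List (Vec ℕ (suc n))} → Unique ass →
                (∀ {as} → as ∈ ass → IsAreaSequence as × (T c → Positive as)) →
                (∀ {as} → IsAreaSequence as × (T c → Positive as) → as ∈ ass) →
                atMost k ass ≡ length (points c k n 0)
atMost-points c k n {ass} ass! sound complete = length-bijection CodeOf
  (Unique.filter⁺ ≤k? ass!) (points-unique c k n 0)
  (λ {as} as∈ → forth as (∈-filter⁻ ≤k? {xs = ass} as∈)) (λ {e} → back e)
  codeOf-entries-unique (λ {as} → codeOf-code-unique {as = as})
  where
  ≤k? = λ as → pnest as ≤? k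

  forth : ∀ as → as ∈ ass × pnest as ≤ k → ∃ λ e → e ∈ points c k n 0 × CodeOf as e
  forth (a ∷ as) (as∈ , ≤k) with sound as∈
  ... | area , pos with ℕ.n≤0⇒n≡0 (proj₁ area zero)
  ...   | refl with encode 0 as (proj₂ (area⇒climbing (0 ∷ as) area))
  ...     | xs , os , r = (xs , os) , point⇒∈ (code⇒point r pos ≤k) , refl , r

  back : ∀ e → e ∈ points c k n 0 → ∃ λ as → as ∈ filter ≤k? ass × CodeOf as e
  back (xs , os) e∈ with ∈⇒point e∈
  ... | p with point-decode p
  ...   | as , r = 0 ∷ as , ∈-filter⁺ ≤k?
    (complete (climbing⇒area (0 ∷ as) (z≤n , rising⇒climbing r) , point⇒positive r p)) (point⇒pnest r p) , refl , r

atMost-DP : ∀ k n → atMost k (DP (suc n)) ≡ strip (suc (k * 2)) (suc n * 2) 0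
atMost-DP k n = trans
  (atMost-points false k n (DP-unique (suc n))
    (λ as∈ → Equivalence.to ∈-DP as∈ , λ ()) (λ (area , _) → Equivalence.from ∈-DP area))
  (length-points k n 0)

atMost-DPᶜ : ∀ k n → atMost k (DPᶜ (suc n)) ≡ strip (k * 2) (n * 2) 0
atMost-DPᶜ k n = trans
  (atMost-points true k n (DPᶜ-unique (suc n))
    (λ {as} as∈ → let area , conn = Equivalence.to ∈-DPᶜ as∈ in area , λ _ → connected⇒positive as area conn)
    (λ {as} (area , pos) → Equivalence.from ∈-DPᶜ (area , positive⇒connected as (pos _))))
  (length-pointsᶜ k n 0)

-- The reflection principle

-- If z has the parity of m and |z| ≤ m, this is the binomial coefficient m over (m + z)/2, and
-- otherwise 0. The recursion takes care of parity and range and has the same shape as that of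
-- `steps`.
free : ℕ → ℤ → ℤ
free zero    (+ zero)  = 1ℤ
free zero    (+ suc _) = 0ℤ
free zero    -[1+ _ ]  = 0ℤ
free (suc m) z         = free m (z ℤ.+ 1ℤ) ℤ.+ free m (z ℤ.- 1ℤ)

free-neg : ∀ m z → free m (ℤ.- z) ≡ free m z
free-neg zero    (+ zero)  = refl
free-neg zero    (+ suc _) = refl
free-neg zero    -[1+ _ ]  = refl
free-neg (suc m) z = begin
  free m (ℤ.- z ℤ.+ 1ℤ) ℤ.+ free m (ℤ.- z ℤ.- 1ℤ)
    ≡⟨ cong₂ (λ x y → free m x ℤ.+ free m y) (down z) (up z) ⟩
  free m (ℤ.- (z ℤ.- 1ℤ)) ℤ.+ free m (ℤ.- (z ℤ.+ 1ℤ))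
    ≡⟨ cong₂ ℤ._+_ (free-neg m _) (free-neg m _) ⟩
  free m (z ℤ.- 1ℤ) ℤ.+ free m (z ℤ.+ 1ℤ)
    ≡⟨ ℤ.+-comm (free m (z ℤ.- 1ℤ)) _ ⟩
  free (suc m) z ∎
  where
  open ≡-Reasoning
  down : ∀ z → ℤ.- z ℤ.+ 1ℤ ≡ ℤ.- (z ℤ.- 1ℤ)
  down = solve-∀
  up : ∀ z → ℤ.- z ℤ.- 1ℤ ≡ ℤ.- (z ℤ.+ 1ℤ)
  up = solve-∀

free-vanish : ∀ m {z} → m < z → free m (+ z) ≡ 0ℤ
free-vanish zero    (s≤s _) = refl
free-vanish (suc m) {suc z} (s≤s m<z) = cong₂ ℤ._+_
  (free-vanish m (ℕ.<-≤-trans m<z (ℕ.≤-trans (ℕ.n≤1+n z) (ℕ.m≤m+n (suc z) 1))))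
  (free-vanish m m<z)

free-diagonal : ∀ m → free m (+ m) ≡ 1ℤ
free-diagonal zero    = refl
free-diagonal (suc m) = cong₂ ℤ._+_ (free-vanish m (s≤s (ℕ.m≤m+n m 1))) (free-diagonal m)

-- The count of unconstrained walks from z to 0 is a binomial coefficient; this is the ratio of neighbours.
free-ratio : ∀ m z → (+ m ℤ.+ z ℤ.+ + 2) ℤ.* free m (z ℤ.+ + 2) ≡ (+ m ℤ.- z) ℤ.* free m z
free-ratio zero (+ zero)  = refl
free-ratio zero (+ suc z) = trans (ℤ.*-zeroʳ (0ℤ ℤ.+ + suc z ℤ.+ + 2)) (sym (ℤ.*-zeroʳ (0ℤ ℤ.- + suc z)))
free-ratio zero -[1+ 0 ]  = refl
free-ratio zero -[1+ 1 ]  = refl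
free-ratio zero -[1+ suc (suc z) ] = trans (ℤ.*-zeroʳ (0ℤ ℤ.+ -[1+ suc (suc z) ] ℤ.+ + 2)) (sym (ℤ.*-zeroʳ (0ℤ ℤ.- -[1+ suc (suc z) ])))
free-ratio (suc m) z = begin
  (+ suc m ℤ.+ z ℤ.+ + 2) ℤ.* (free m (z ℤ.+ + 2 ℤ.+ 1ℤ) ℤ.+ free m (z ℤ.+ + 2 ℤ.- 1ℤ))
    ≡⟨ cong₂ ℤ._*_ (cong (λ x → x ℤ.+ z ℤ.+ + 2) (sm m)) (cong₂ (λ x y → free m x ℤ.+ free m y) (i₁ z) (i₂ z)) ⟩
  (1ℤ ℤ.+ + m ℤ.+ z ℤ.+ + 2) ℤ.* (X ℤ.+ Y)
    ≡⟨ lhs (+ m) z X Y ⟩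
  (+ m ℤ.+ (z ℤ.+ 1ℤ) ℤ.+ + 2) ℤ.* X ℤ.+ (+ m ℤ.+ z ℤ.+ + 3) ℤ.* Y
    ≡⟨ cong (λ x → x ℤ.+ (+ m ℤ.+ z ℤ.+ + 3) ℤ.* Y) (free-ratio m (z ℤ.+ 1ℤ)) ⟩
  (+ m ℤ.- (z ℤ.+ 1ℤ)) ℤ.* Y ℤ.+ (+ m ℤ.+ z ℤ.+ + 3) ℤ.* Y
    ≡⟨ mid (+ m) z Y ⟩
  (1ℤ ℤ.+ + m ℤ.- z) ℤ.* Y ℤ.+ (+ m ℤ.+ (z ℤ.- 1ℤ) ℤ.+ + 2) ℤ.* Y
    ≡⟨ cong (λ y → (1ℤ ℤ.+ + m ℤ.- z) ℤ.* Y ℤ.+ (+ m ℤ.+ (z ℤ.- 1ℤ) ℤ.+ + 2) ℤ.* free m y) (i₃ z) ⟩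
  (1ℤ ℤ.+ + m ℤ.- z) ℤ.* Y ℤ.+ (+ m ℤ.+ (z ℤ.- 1ℤ) ℤ.+ + 2) ℤ.* free m (z ℤ.- 1ℤ ℤ.+ + 2)
    ≡⟨ cong (λ x → (1ℤ ℤ.+ + m ℤ.- z) ℤ.* Y ℤ.+ x) (free-ratio m (z ℤ.- 1ℤ)) ⟩
  (1ℤ ℤ.+ + m ℤ.- z) ℤ.* Y ℤ.+ (+ m ℤ.- (z ℤ.- 1ℤ)) ℤ.* W
    ≡⟨ rhs (+ m) z Y W ⟩
  (1ℤ ℤ.+ + m ℤ.- z) ℤ.* (Y ℤ.+ W)
    ≡⟨ cong (λ x → (x ℤ.- z) ℤ.* (Y ℤ.+ W)) (sm m) ⟨
  (+ suc m ℤ.- z) ℤ.* free (suc m) z ∎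
  where
  open ≡-Reasoning
  X = free m (z ℤ.+ 1ℤ ℤ.+ + 2)
  Y = free m (z ℤ.+ 1ℤ)
  W = free m (z ℤ.- 1ℤ)
  sm : ∀ m → + suc m ≡ 1ℤ ℤ.+ + m
  sm m = refl
  i₁ : ∀ z → z ℤ.+ + 2 ℤ.+ 1ℤ ≡ z ℤ.+ 1ℤ ℤ.+ + 2
  i₁ = solve-∀
  i₂ : ∀ z → z ℤ.+ + 2 ℤ.- 1ℤ ≡ z ℤ.+ 1ℤ
  i₂ = solve-∀
  i₃ : ∀ z → z ℤ.+ 1ℤ ≡ z ℤ.- 1ℤ ℤ.+ + 2
  i₃ = solve-∀
  lhs : ∀ m z x y → (1ℤ ℤ.+ m ℤ.+ z ℤ.+ + 2) ℤ.* (x ℤ.+ y) ≡ (m ℤ.+ (z ℤ.+ 1ℤ) ℤ.+ + 2) ℤ.* x ℤ.+ (m ℤ.+ z ℤ.+ + 3) ℤ.* y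
  lhs = solve-∀
  mid : ∀ m z y → (m ℤ.- (z ℤ.+ 1ℤ)) ℤ.* y ℤ.+ (m ℤ.+ z ℤ.+ + 3) ℤ.* y ≡ (1ℤ ℤ.+ m ℤ.- z) ℤ.* y ℤ.+ (m ℤ.+ (z ℤ.- 1ℤ) ℤ.+ + 2) ℤ.* y
  mid = solve-∀
  rhs : ∀ m z y w → (1ℤ ℤ.+ m ℤ.- z) ℤ.* y ℤ.+ (m ℤ.- (z ℤ.- 1ℤ)) ℤ.* w ≡ (1ℤ ℤ.+ m ℤ.- z) ℤ.* (y ℤ.+ w)
  rhs = solve-∀

-- Only the images of 0 and -2 under the reflections that can be reached in the time considered.
images : ℤ → ℕ → ℤ → ℤ
images K m z =
     free m z         ℤ.+ free m (z ℤ.+ + 2 ℤ.* K)         ℤ.+ free m (z ℤ.- + 2 ℤ.* K)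
  ℤ.- free m (z ℤ.+ + 2) ℤ.- free m (z ℤ.+ + 2 ℤ.+ + 2 ℤ.* K) ℤ.- free m (z ℤ.+ + 2 ℤ.- + 2 ℤ.* K)

images-suc : ∀ K m z → images K (suc m) z ≡ images K m (z ℤ.+ 1ℤ) ℤ.+ images K m (z ℤ.- 1ℤ)
images-suc K m z = trans
  (cong₂ ℤ._-_ (cong₂ ℤ._-_ (cong₂ ℤ._-_ (cong₂ ℤ._+_ (cong (λ x → free (suc m) z ℤ.+ x)
     (split z (+ 2 ℤ.* K)))
     (split z (ℤ.- (+ 2 ℤ.* K))))
     (split z (+ 2)))
     (trans (split (z ℤ.+ + 2) (+ 2 ℤ.* K)) (cong₂ (λ x y → free m (x ℤ.+ + 2 ℤ.* K) ℤ.+ free m (y ℤ.+ + 2 ℤ.* K)) (s₁ z (+ 2)) (s₂ z (+ 2)))))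
     (trans (split (z ℤ.+ + 2) (ℤ.- (+ 2 ℤ.* K))) (cong₂ (λ x y → free m (x ℤ.- + 2 ℤ.* K) ℤ.+ free m (y ℤ.- + 2 ℤ.* K)) (s₁ z (+ 2)) (s₂ z (+ 2)))))
  (collect (free m (z ℤ.+ 1ℤ)) (free m (z ℤ.- 1ℤ))
    (free m (z ℤ.+ 1ℤ ℤ.+ + 2 ℤ.* K)) (free m (z ℤ.- 1ℤ ℤ.+ + 2 ℤ.* K))
    (free m (z ℤ.+ 1ℤ ℤ.- + 2 ℤ.* K)) (free m (z ℤ.- 1ℤ ℤ.- + 2 ℤ.* K))
    (free m (z ℤ.+ 1ℤ ℤ.+ + 2)) (free m (z ℤ.- 1ℤ ℤ.+ + 2))
    (free m (z ℤ.+ 1ℤ ℤ.+ + 2 ℤ.+ + 2 ℤ.* K)) (free m (z ℤ.- 1ℤ ℤ.+ + 2 ℤ.+ + 2 ℤ.* K))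
    (free m (z ℤ.+ 1ℤ ℤ.+ + 2 ℤ.- + 2 ℤ.* K)) (free m (z ℤ.- 1ℤ ℤ.+ + 2 ℤ.- + 2 ℤ.* K)))
  where
  s₁ : ∀ z c → z ℤ.+ c ℤ.+ 1ℤ ≡ z ℤ.+ 1ℤ ℤ.+ c
  s₁ = solve-∀
  s₂ : ∀ z c → z ℤ.+ c ℤ.- 1ℤ ≡ z ℤ.- 1ℤ ℤ.+ c
  s₂ = solve-∀
  split : ∀ z c → free (suc m) (z ℤ.+ c) ≡ free m (z ℤ.+ 1ℤ ℤ.+ c) ℤ.+ free m (z ℤ.- 1ℤ ℤ.+ c)
  split z c = cong₂ (λ x y → free m x ℤ.+ free m y) (s₁ z c) (s₂ z c)
  collect : ∀ a a′ b b′ c c′ d d′ e e′ f f′ →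
    (a ℤ.+ a′) ℤ.+ (b ℤ.+ b′) ℤ.+ (c ℤ.+ c′) ℤ.- (d ℤ.+ d′) ℤ.- (e ℤ.+ e′) ℤ.- (f ℤ.+ f′)
    ≡ (a ℤ.+ b ℤ.+ c ℤ.- d ℤ.- e ℤ.- f) ℤ.+ (a′ ℤ.+ b′ ℤ.+ c′ ℤ.- d′ ℤ.- e′ ℤ.- f′)
  collect = solve-∀

free-cong-neg : ∀ m {x y} → x ≡ ℤ.- y → free m x ≡ free m y
free-cong-neg m eq = trans (cong (free m) eq) (free-neg m _)

-- As `free m (z + c)` counts walks from z to -c, the reflection x ↦ -2 - x at -1 exchanges the
-- three targets with sign + and the three with sign -. The cancellation is therefore exact for
-- every m.
images-floor : ∀ K m → images K m -1ℤ ≡ 0ℤ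
images-floor K m = trans
  (cong₂ (λ x y → free m -1ℤ ℤ.+ x ℤ.+ y ℤ.- free m 1ℤ ℤ.- free m (1ℤ ℤ.+ + 2 ℤ.* K) ℤ.- free m (1ℤ ℤ.- + 2 ℤ.* K))
     (free-cong-neg m (e₁ K)) (free-cong-neg m (e₂ K)))
  (trans (cong (λ x → x ℤ.+ free m (1ℤ ℤ.- + 2 ℤ.* K) ℤ.+ free m (1ℤ ℤ.+ + 2 ℤ.* K) ℤ.- free m 1ℤ ℤ.- free m (1ℤ ℤ.+ + 2 ℤ.* K) ℤ.- free m (1ℤ ℤ.- + 2 ℤ.* K))
     (free-neg m 1ℤ))
  (cancel (free m 1ℤ) _ _))
  where
  e₁ : ∀ K → -1ℤ ℤ.+ + 2 ℤ.* K ≡ ℤ.- (1ℤ ℤ.- + 2 ℤ.* K)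
  e₁ = solve-∀
  e₂ : ∀ K → -1ℤ ℤ.- + 2 ℤ.* K ≡ ℤ.- (1ℤ ℤ.+ + 2 ℤ.* K)
  e₂ = solve-∀
  cancel : ∀ a b c → a ℤ.+ b ℤ.+ c ℤ.- a ℤ.- c ℤ.- b ≡ 0ℤ
  cancel = solve-∀

-- The reflection x ↦ 2B - x at B pairs 0 with 2B and -2 with 2B + 2. The partners of the two
-- remaining targets, -2B - 2 and -2B - 4, have been truncated; these targets are 3B + 2 and 3B + 4
-- away from B, out of reach for m < 3B + 2.
images-ceiling : ∀ B m → m < 3 * B + 2 → images (+ suc B) m (+ B) ≡ 0ℤ
images-ceiling B m m< = trans
  (cong₂ (λ x y → x ℤ.- free m (+ B ℤ.+ + 2) ℤ.- y ℤ.- free m (+ B ℤ.+ + 2 ℤ.- + 2 ℤ.* + suc B))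
     (cong₂ (λ x y → free m (+ B) ℤ.+ x ℤ.+ y) (vanish (e₁ (+ B)) m<) (free-cong-neg m (e₂ (+ B))))
     (vanish (e₃ (+ B)) (ℕ.<-≤-trans m< (ℕ.+-monoʳ-≤ (3 * B) (s≤s (s≤s (z≤n {2})))))))
  (trans (cong (λ x → free m (+ B) ℤ.+ 0ℤ ℤ.+ free m (+ B ℤ.+ + 2) ℤ.- free m (+ B ℤ.+ + 2) ℤ.- 0ℤ ℤ.- x) (free-cong-neg m (e₄ (+ B))))
  (cancel (free m (+ B)) _))
  where
  vanish : ∀ {z c} → z ≡ + 3 ℤ.* + B ℤ.+ + c → m < 3 * B + c → free m z ≡ 0ℤ
  vanish {c = c} eq lt = trans (cong (free m) (trans eq (cong (ℤ._+ + c) (sym (ℤ.pos-* 3 B))))) (free-vanish m lt)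
  e₁ : ∀ B → B ℤ.+ + 2 ℤ.* (1ℤ ℤ.+ B) ≡ + 3 ℤ.* B ℤ.+ + 2
  e₁ = solve-∀
  e₂ : ∀ B → B ℤ.- + 2 ℤ.* (1ℤ ℤ.+ B) ≡ ℤ.- (B ℤ.+ + 2)
  e₂ = solve-∀
  e₃ : ∀ B → B ℤ.+ + 2 ℤ.+ + 2 ℤ.* (1ℤ ℤ.+ B) ≡ + 3 ℤ.* B ℤ.+ + 4
  e₃ = solve-∀
  e₄ : ∀ B → B ℤ.+ + 2 ℤ.- + 2 ℤ.* (1ℤ ℤ.+ B) ≡ ℤ.- B
  e₄ = solve-∀
  cancel : ∀ a b → a ℤ.+ 0ℤ ℤ.+ b ℤ.- b ℤ.- 0ℤ ℤ.- a ≡ 0ℤ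
  cancel = solve-∀

-- Among the six targets only 0 lies between 0 and B - 1.
images-zero : ∀ {B y} → y < B → images (+ suc B) 0 (+ y) ≡ free 0 (+ y)
images-zero {B} {y} y<B with ℕ.m≤n⇒∃[o]m+o≡n y<B
... | d , refl = trans
  (cong₂ ℤ._-_ (cong₂ ℤ._-_ (cong₂ ℤ._-_ (cong₂ ℤ._+_ (cong (λ x → free 0 (+ y) ℤ.+ x)
    (right {w = y + 2 * (suc y + d) + 1} (e₁ (+ y) (+ d))))
    (left  {w = y + (d + d) + 3} (e₂ (+ y) (+ d))))
    (right {w = suc y} (e₃ (+ y))))
    (right {w = y + 2 * (suc y + d) + 3} (e₄ (+ y) (+ d))))
    (left  {w = y + (d + d) + 1} (e₅ (+ y) (+ d))))
  (drop (free 0 (+ y)))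
  where
  right : ∀ {z w} → z ≡ 1ℤ ℤ.+ + w → free 0 z ≡ 0ℤ
  right refl = refl
  left : ∀ {z w} → z ≡ ℤ.- (1ℤ ℤ.+ + w) → free 0 z ≡ 0ℤ
  left refl = refl
  e₁ : ∀ y d → y ℤ.+ + 2 ℤ.* (1ℤ ℤ.+ (1ℤ ℤ.+ (y ℤ.+ d))) ≡ 1ℤ ℤ.+ (y ℤ.+ + 2 ℤ.* (1ℤ ℤ.+ (y ℤ.+ d)) ℤ.+ 1ℤ)
  e₁ = solve-∀
  e₂ : ∀ y d → y ℤ.- + 2 ℤ.* (1ℤ ℤ.+ (1ℤ ℤ.+ (y ℤ.+ d))) ≡ ℤ.- (1ℤ ℤ.+ (y ℤ.+ (d ℤ.+ d) ℤ.+ + 3))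
  e₂ = solve-∀
  e₃ : ∀ y → y ℤ.+ + 2 ≡ 1ℤ ℤ.+ (1ℤ ℤ.+ y)
  e₃ = solve-∀
  e₄ : ∀ y d → y ℤ.+ + 2 ℤ.+ + 2 ℤ.* (1ℤ ℤ.+ (1ℤ ℤ.+ (y ℤ.+ d))) ≡ 1ℤ ℤ.+ (y ℤ.+ + 2 ℤ.* (1ℤ ℤ.+ (y ℤ.+ d)) ℤ.+ + 3)
  e₄ = solve-∀
  e₅ : ∀ y d → y ℤ.+ + 2 ℤ.- + 2 ℤ.* (1ℤ ℤ.+ (1ℤ ℤ.+ (y ℤ.+ d))) ≡ ℤ.- (1ℤ ℤ.+ (y ℤ.+ (d ℤ.+ d) ℤ.+ 1ℤ))
  e₅ = solve-∀
  drop : ∀ a → a ℤ.+ 0ℤ ℤ.+ 0ℤ ℤ.- 0ℤ ℤ.- 0ℤ ℤ.- 0ℤ ≡ a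
  drop = solve-∀

-- The truncation of the reflection sum is harmless as long as a walk cannot have
-- reached the second pair of images and come back.
reflection : ∀ B m {y} → y ≤ B → m + y < 4 * B + 2 → + strip B m y ≡ images (+ suc B) m (+ y)
reflection-inside : ∀ B m {y} → y < B → m + y < 4 * B + 2 → + steps B m y ≡ images (+ suc B) m (+ y)

reflection B m {y} y≤B lt with ℕ.m≤n⇒m<n∨m≡n y≤B
... | inj₁ y<B  = trans (cong +_ (strip-inside m y<B)) (reflection-inside B m y<B lt)
-- Along a walk m + y never increases, and 4B + 2 is chosen so that at y = B it leaves the bound 3B
-- + 2 of `images-ceiling`.
... | inj₂ refl = trans (cong +_ (strip-outside m (ℕ.≤-refl {y})))
  (sym (images-ceiling y m (ℕ.+-cancelʳ-< y m (3 * y + 2) (ℕ.<-≤-trans lt (ℕ.≤-reflexive (split y))))))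
  where
  open +-*-Solver
  split : ∀ y → 4 * y + 2 ≡ 3 * y + 2 + y
  split = solve 1 (λ y → con 4 :* y :+ con 2 := con 3 :* y :+ con 2 :+ y) refl

reflection-inside B zero {zero}  y<B lt = sym (images-zero y<B)
reflection-inside B zero {suc y} y<B lt = sym (images-zero y<B)
reflection-inside B (suc m) {zero} y<B lt = trans
  (reflection B m y<B (ℕ.≤-<-trans (ℕ.≤-reflexive (ℕ.+-suc m 0)) lt))
  (sym (trans (images-suc (+ suc B) m 0ℤ)
    (trans (cong (λ x → images (+ suc B) m 1ℤ ℤ.+ x) (images-floor (+ suc B) m)) (ℤ.+-identityʳ _))))
reflection-inside B (suc m) {suc y} y<B lt = trans
  (cong₂ ℤ._+_
    (trans (reflection B m y<B (ℕ.≤-<-trans (ℕ.≤-reflexive (ℕ.+-suc m (suc y))) lt))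
           (cong (images (+ suc B) m ∘ +_) (ℕ.+-comm 1 (suc y))))
    (reflection B m (ℕ.<⇒≤ (ℕ.<-trans (ℕ.n<1+n y) y<B))
      (ℕ.≤-<-trans (ℕ.≤-trans (ℕ.+-monoʳ-≤ m (ℕ.n≤1+n y)) (ℕ.n≤1+n _)) lt)))
  (sym (images-suc (+ suc B) m (+ suc y)))

-- The difference of two strips

-- The binomial coefficient 2N over N + B.
central : ℕ → ℕ → ℤ
central N B = free (N * 2) (+ (B * 2))

central-vanish : ∀ {N B} → N < B → central N B ≡ 0ℤ
central-vanish {N} N<B = free-vanish (N * 2) (ℕ.*-monoˡ-< 2 N<B)

central-diagonal : ∀ N → central N N ≡ 1ℤ
central-diagonal N = free-diagonal (N * 2)

pos-double : ∀ n → + (n * 2) ≡ + 2 ℤ.* + n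
pos-double n = trans (ℤ.pos-* n 2) (ℤ.*-comm (+ n) (+ 2))

central-ratio : ∀ N B → (+ N ℤ.+ + B ℤ.+ 1ℤ) ℤ.* central N (suc B) ≡ (+ N ℤ.- + B) ℤ.* central N B
central-ratio N B = ℤ.*-cancelˡ-≡ (+ 2) _ _ (begin
  + 2 ℤ.* ((+ N ℤ.+ + B ℤ.+ 1ℤ) ℤ.* central N (suc B))
    ≡⟨ l (+ N) (+ B) (central N (suc B)) ⟩
  (+ 2 ℤ.* + N ℤ.+ + 2 ℤ.* + B ℤ.+ + 2) ℤ.* central N (suc B)
    ≡⟨ cong₂ (λ x y → (x ℤ.+ y ℤ.+ + 2) ℤ.* central N (suc B)) (pos-double N) (pos-double B) ⟨
  (+ (N * 2) ℤ.+ + (B * 2) ℤ.+ + 2) ℤ.* central N (suc B)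
    ≡⟨ cong (λ x → (+ (N * 2) ℤ.+ + (B * 2) ℤ.+ + 2) ℤ.* free (N * 2) (+ x)) (ℕ.+-comm 2 (B * 2)) ⟩
  (+ (N * 2) ℤ.+ + (B * 2) ℤ.+ + 2) ℤ.* free (N * 2) (+ (B * 2) ℤ.+ + 2)
    ≡⟨ free-ratio (N * 2) (+ (B * 2)) ⟩
  (+ (N * 2) ℤ.- + (B * 2)) ℤ.* central N B
    ≡⟨ cong₂ (λ x y → (x ℤ.- y) ℤ.* central N B) (pos-double N) (pos-double B) ⟩
  (+ 2 ℤ.* + N ℤ.- + 2 ℤ.* + B) ℤ.* central N B
    ≡⟨ r (+ N) (+ B) (central N B) ⟩
  + 2 ℤ.* ((+ N ℤ.- + B) ℤ.* central N B) ∎)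
  where
  open ≡-Reasoning
  l : ∀ n b c → + 2 ℤ.* ((n ℤ.+ b ℤ.+ 1ℤ) ℤ.* c) ≡ (+ 2 ℤ.* n ℤ.+ + 2 ℤ.* b ℤ.+ + 2) ℤ.* c
  l = solve-∀
  r : ∀ n b c → (+ 2 ℤ.* n ℤ.- + 2 ℤ.* b) ℤ.* c ≡ + 2 ℤ.* ((n ℤ.- b) ℤ.* c)
  r = solve-∀

-- Induction on N - B, starting from the diagonal value 1 and descending with `central-ratio`; the
-- product form avoids division.
central-! : ∀ q {N B} → N ≡ B + q → central N B ℤ.* + ((N + B) ! * q !) ≡ + ((N * 2) !)
central-! zero {N} {B} eq rewrite trans eq (ℕ.+-identityʳ B) = begin
  central B B ℤ.* + ((B + B) ! * 1) ≡⟨ cong₂ ℤ._*_ (central-diagonal B) (cong +_ (ℕ.*-identityʳ ((B + B) !))) ⟩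
  1ℤ ℤ.* + ((B + B) !)              ≡⟨ ℤ.*-identityˡ (+ ((B + B) !)) ⟩
  + ((B + B) !)                     ≡⟨ cong (λ x → + ((B + x) !)) (ℕ.+-identityʳ B) ⟨
  + ((2 * B) !)                     ≡⟨ cong (λ x → + (x !)) (ℕ.*-comm 2 B) ⟩
  + ((B * 2) !)                     ∎
  where open ≡-Reasoning
central-! (suc q) {N} {B} eq = begin
  central N B ℤ.* + ((N + B) ! * (suc q * q !))
    ≡⟨ cong (central N B ℤ.*_) (trans (ℤ.pos-* ((N + B) !) _) (cong (+ ((N + B) !) ℤ.*_) (ℤ.pos-* (suc q) (q !)))) ⟩
  central N B ℤ.* (+ ((N + B) !) ℤ.* (+ suc q ℤ.* + (q !)))
    ≡⟨ l (central N B) (+ ((N + B) !)) (+ suc q) (+ (q !)) ⟩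
  (+ suc q ℤ.* central N B) ℤ.* (+ ((N + B) !) ℤ.* + (q !))
    ≡⟨ cong (λ x → x ℤ.* central N B ℤ.* (+ ((N + B) !) ℤ.* + (q !))) (trans (cong (λ x → + x ℤ.- + B) eq) (sub (+ B) (+ suc q))) ⟨
  ((+ N ℤ.- + B) ℤ.* central N B) ℤ.* (+ ((N + B) !) ℤ.* + (q !))
    ≡⟨ cong (ℤ._* (+ ((N + B) !) ℤ.* + (q !))) (central-ratio N B) ⟨
  ((+ N ℤ.+ + B ℤ.+ 1ℤ) ℤ.* central N (suc B)) ℤ.* (+ ((N + B) !) ℤ.* + (q !))
    ≡⟨ cong (λ x → + x ℤ.* central N (suc B) ℤ.* (+ ((N + B) !) ℤ.* + (q !))) (ℕ.+-comm (N + B) 1) ⟩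
  (+ suc (N + B) ℤ.* central N (suc B)) ℤ.* (+ ((N + B) !) ℤ.* + (q !))
    ≡⟨ r (+ suc (N + B)) (central N (suc B)) (+ ((N + B) !)) (+ (q !)) ⟩
  central N (suc B) ℤ.* ((+ suc (N + B) ℤ.* + ((N + B) !)) ℤ.* + (q !))
    ≡⟨ cong (central N (suc B) ℤ.*_) (trans (ℤ.pos-* (suc (N + B) !) (q !)) (cong (ℤ._* + (q !)) (ℤ.pos-* (suc (N + B)) ((N + B) !)))) ⟨
  central N (suc B) ℤ.* + (suc (N + B) ! * q !)
    ≡⟨ cong (λ x → central N (suc B) ℤ.* + (x ! * q !)) (ℕ.+-suc N B) ⟨
  central N (suc B) ℤ.* + ((N + suc B) ! * q !)
    ≡⟨ central-! q (trans eq (ℕ.+-suc B q)) ⟩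
  + ((N * 2) !) ∎
  where
  open ≡-Reasoning
  l : ∀ c x s y → c ℤ.* (x ℤ.* (s ℤ.* y)) ≡ (s ℤ.* c) ℤ.* (x ℤ.* y)
  l = solve-∀
  r : ∀ s c x y → (s ℤ.* c) ℤ.* (x ℤ.* y) ≡ c ℤ.* ((s ℤ.* x) ℤ.* y)
  r = solve-∀
  sub : ∀ b q → b ℤ.+ q ℤ.- b ≡ q
  sub = solve-∀

-- The reflection sum for B + 2 heights minus that for B heights. The targets 0 and -2 occur in both
-- and cancel, and so does `central N (2 + B)`.
growth : ℕ → ℕ → ℤ
growth N B = central N B ℤ.- + 2 ℤ.* central N (1 + B) ℤ.+ + 2 ℤ.* central N (3 + B) ℤ.- central N (4 + B)

-- The narrower strip sets the limit: `reflection` from height 0 in 2N steps needs 2N < 4B + 2, that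
-- is N ≤ 2B. For N = n and B = 2i - 1 this reads n + 2 ≤ 4i, and in the connected case, N = n - 1
-- and B = 2i - 2, it reads n + 2 < 4i: these are the ranges of i in (iii) and (iv).
strip-growth : ∀ {N B} → N ≤ 2 * B → + strip (2 + B) (N * 2) 0 ≡ growth N B ℤ.+ + strip B (N * 2) 0
strip-growth {N} {B} N≤2B = trans (at-origin (2 + B) lt₂) (trans
  (regroup (free M 0ℤ) (free M (+ 2)) (central N B) (central N (1 + B)) (central N (2 + B)) (central N (3 + B)) (central N (4 + B)))
  (cong (λ x → growth N B ℤ.+ x) (sym (at-origin B lt₁))))
  where
  M = N * 2
  lt₁ : M + 0 < 4 * B + 2
  lt₁ = ℕ.≤-<-trans (ℕ.≤-trans (ℕ.≤-reflexive (ℕ.+-identityʳ M)) (ℕ.*-monoˡ-≤ 2 N≤2B))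
          (ℕ.<-≤-trans (ℕ.m<m+n (2 * B * 2) {2} (s≤s z≤n)) (ℕ.≤-reflexive (cong (_+ 2) (four B))))
    where
    open +-*-Solver
    four : ∀ B → 2 * B * 2 ≡ 4 * B
    four = solve 1 (λ B → con 2 :* B :* con 2 := con 4 :* B) refl
  lt₂ : M + 0 < 4 * (2 + B) + 2
  lt₂ = ℕ.<-≤-trans lt₁ (ℕ.+-monoˡ-≤ 2 (ℕ.*-monoʳ-≤ 4 (ℕ.m≤n+m B 2)))
  at-origin : ∀ B → M + 0 < 4 * B + 2 → + strip B M 0 ≡
    free M 0ℤ ℤ.+ + 2 ℤ.* central N (1 + B) ℤ.- free M (+ 2) ℤ.- central N (2 + B) ℤ.- central N B
  at-origin B lt = trans (reflection B M z≤n lt) (trans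
    (cong₂ ℤ._-_ (cong₂ ℤ._-_ (cong (ℤ._- free M (+ 2)) (cong₂ ℤ._+_ (cong (λ x → free M 0ℤ ℤ.+ x)
      (cong (free M) (e₁ B)))
      (free-cong-neg M (trans (ℤ.+-identityˡ _) (cong ℤ.-_ (e₂ B))))))
      (cong (free M) (e₃ B)))
      (free-cong-neg M (e₄ B)))
    (twice (free M 0ℤ) (central N (1 + B)) (free M (+ 2)) (central N (2 + B)) (central N B)))
    where
    e₂ : ∀ B → + 2 ℤ.* + suc B ≡ + (suc B * 2)
    e₂ B = sym (pos-double (suc B))
    e₁ : ∀ B → 0ℤ ℤ.+ + 2 ℤ.* + suc B ≡ + (suc B * 2)
    e₁ B = trans (ℤ.+-identityˡ (+ 2 ℤ.* + suc B)) (e₂ B)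
    e₃ : ∀ B → + 2 ℤ.+ + 2 ℤ.* + suc B ≡ + (suc (suc B) * 2)
    e₃ B = cong (λ x → + 2 ℤ.+ x) (e₂ B)
    e₄ : ∀ B → + 2 ℤ.- + 2 ℤ.* + suc B ≡ ℤ.- + (B * 2)
    e₄ B = trans (p (+ B)) (cong ℤ.-_ (sym (pos-double B)))
      where
      p : ∀ b → + 2 ℤ.- + 2 ℤ.* (1ℤ ℤ.+ b) ≡ ℤ.- (+ 2 ℤ.* b)
      p = solve-∀
    twice : ∀ a b c d e → a ℤ.+ b ℤ.+ b ℤ.- c ℤ.- d ℤ.- e ≡ a ℤ.+ + 2 ℤ.* b ℤ.- c ℤ.- d ℤ.- e
    twice = solve-∀
  regroup : ∀ f g b₀ b₁ b₂ b₃ b₄ →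
    f ℤ.+ + 2 ℤ.* b₃ ℤ.- g ℤ.- b₄ ℤ.- b₂ ≡
    (b₀ ℤ.- + 2 ℤ.* b₁ ℤ.+ + 2 ℤ.* b₃ ℤ.- b₄) ℤ.+ (f ℤ.+ + 2 ℤ.* b₁ ℤ.- g ℤ.- b₂ ℤ.- b₀)
  regroup = solve-∀

-- In terms of s = B + 2 the growth is s (2 s² - 3 N - 5) up to a ratio of factorials.
cubic : ℤ → ℤ → ℤ
cubic N s = s ℤ.* (+ 2 ℤ.* s ℤ.* s ℤ.- + 3 ℤ.* N ℤ.- + 5)

-- The ratios express all four binomials through `central N B`, with denominators N + B + 1, ..., N
-- + B + 4. Clearing these leaves one polynomial identity in B and q, whose factor 2N + 1 turns
-- (2N)! into (2N + 1)!.
growth-! : ∀ q {N B} → N ≡ B + q →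
           growth N B ℤ.* + ((N + B + 4) ! * q !) ≡ + 4 ℤ.* cubic (+ N) (+ B ℤ.+ + 2) ℤ.* + ((N * 2 + 1) !)
growth-! q {N} {B} refl = begin
  growth N B ℤ.* + ((N + B + 4) ! * q !)
    ≡⟨ cong (growth N B ℤ.*_) factorials ⟩
  growth N B ℤ.* ((P ℤ.+ + 4) ℤ.* ((P ℤ.+ + 3) ℤ.* ((P ℤ.+ + 2) ℤ.* ((P ℤ.+ 1ℤ) ℤ.* + ((N + B) ! * q !)))))
    ≡⟨ l P b₀ b₁ b₃ b₄ (+ ((N + B) ! * q !)) ⟩
  ((P ℤ.+ 1ℤ) ℤ.* ((P ℤ.+ + 2) ℤ.* ((P ℤ.+ + 3) ℤ.* (P ℤ.+ + 4))) ℤ.* b₀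
   ℤ.- + 2 ℤ.* ((P ℤ.+ + 2) ℤ.* ((P ℤ.+ + 3) ℤ.* (P ℤ.+ + 4))) ℤ.* ((P ℤ.+ 1ℤ) ℤ.* b₁)
   ℤ.+ + 2 ℤ.* (P ℤ.+ + 4) ℤ.* ((P ℤ.+ 1ℤ) ℤ.* ((P ℤ.+ + 2) ℤ.* ((P ℤ.+ + 3) ℤ.* b₃)))
   ℤ.- (P ℤ.+ 1ℤ) ℤ.* ((P ℤ.+ + 2) ℤ.* ((P ℤ.+ + 3) ℤ.* ((P ℤ.+ + 4) ℤ.* b₄))))
  ℤ.* + ((N + B) ! * q !)
    ≡⟨ cong (ℤ._* + ((N + B) ! * q !)) (cong₂ ℤ._-_ (cong₂ (λ x y →
         (P ℤ.+ 1ℤ) ℤ.* ((P ℤ.+ + 2) ℤ.* ((P ℤ.+ + 3) ℤ.* (P ℤ.+ + 4))) ℤ.* b₀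
         ℤ.- + 2 ℤ.* ((P ℤ.+ + 2) ℤ.* ((P ℤ.+ + 3) ℤ.* (P ℤ.+ + 4))) ℤ.* x
         ℤ.+ + 2 ℤ.* (P ℤ.+ + 4) ℤ.* y) r₁ r₃) r₄) ⟩
  _ ≡⟨ identity (+ B) Q b₀ (+ ((N + B) ! * q !)) ⟩
  + 4 ℤ.* cubic (+ N) (+ B ℤ.+ + 2) ℤ.* ((+ N ℤ.* + 2 ℤ.+ 1ℤ) ℤ.* (b₀ ℤ.* + ((N + B) ! * q !)))
    ≡⟨ cong (+ 4 ℤ.* cubic (+ N) (+ B ℤ.+ + 2) ℤ.*_) (cong₂ ℤ._*_ (cong (ℤ._+ 1ℤ) (sym (ℤ.pos-* N 2))) (central-! q {B = B} refl)) ⟩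
  + 4 ℤ.* cubic (+ N) (+ B ℤ.+ + 2) ℤ.* ((+ (N * 2 + 1)) ℤ.* + ((N * 2) !))
    ≡⟨ cong (+ 4 ℤ.* cubic (+ N) (+ B ℤ.+ + 2) ℤ.*_) (trans (cong (λ x → + x ℤ.* + ((N * 2) !)) (ℕ.+-comm (N * 2) 1))
         (trans (sym (ℤ.pos-* (suc (N * 2)) _)) (cong (λ x → + (x !)) (ℕ.+-comm 1 (N * 2))))) ⟩
  + 4 ℤ.* cubic (+ N) (+ B ℤ.+ + 2) ℤ.* + ((N * 2 + 1) !) ∎
  where
  open ≡-Reasoning
  P = + N ℤ.+ + B
  Q = + q
  b₀ = central N B
  b₁ = central N (1 + B)
  b₂ = central N (2 + B)
  b₃ = central N (3 + B)
  b₄ = central N (4 + B)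

  factorial-suc : ∀ k → + ((N + B + suc k) ! * q !) ≡ (P ℤ.+ + suc k) ℤ.* + ((N + B + k) ! * q !)
  factorial-suc k = trans (cong (λ x → + (x ! * q !)) (ℕ.+-suc (N + B) k))
    (trans (cong +_ (ℕ.*-assoc (suc (N + B + k)) ((N + B + k) !) (q !)))
    (trans (ℤ.pos-* (suc (N + B + k)) _)
    (cong (λ x → + x ℤ.* + ((N + B + k) ! * q !)) (sym (ℕ.+-suc (N + B) k)))))

  factorials : + ((N + B + 4) ! * q !) ≡
    (P ℤ.+ + 4) ℤ.* ((P ℤ.+ + 3) ℤ.* ((P ℤ.+ + 2) ℤ.* ((P ℤ.+ 1ℤ) ℤ.* + ((N + B) ! * q !))))
  factorials = trans (factorial-suc 3) (cong ((P ℤ.+ + 4) ℤ.*_)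
    (trans (factorial-suc 2) (cong ((P ℤ.+ + 3) ℤ.*_)
    (trans (factorial-suc 1) (cong ((P ℤ.+ + 2) ℤ.*_)
    (trans (factorial-suc 0) (cong (λ x → (P ℤ.+ 1ℤ) ℤ.* + (x ! * q !)) (ℕ.+-identityʳ (N + B)))))))))

  ratio : ∀ j → (P ℤ.+ + suc j) ℤ.* central N (suc j + B) ≡ (Q ℤ.- + j) ℤ.* central N (j + B)
  ratio j = trans (cong (ℤ._* central N (suc j + B)) (x (+ N) (+ B) (+ j)))
    (trans (central-ratio N (j + B)) (cong (ℤ._* central N (j + B)) (y (+ B) (+ q) (+ j))))
    where
    x : ∀ n b j → n ℤ.+ b ℤ.+ (1ℤ ℤ.+ j) ≡ n ℤ.+ (j ℤ.+ b) ℤ.+ 1ℤ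
    x = solve-∀
    y : ∀ b q j → b ℤ.+ q ℤ.- (j ℤ.+ b) ≡ q ℤ.- j
    y = solve-∀

  r₁ : (P ℤ.+ 1ℤ) ℤ.* b₁ ≡ (Q ℤ.- 0ℤ) ℤ.* b₀
  r₁ = ratio 0
  comm : ∀ x y z → x ℤ.* (y ℤ.* z) ≡ y ℤ.* (x ℤ.* z)
  comm = solve-∀
  -- `central N (2 + B)` has cancelled from `growth`, but the chain of ratios from b₁ to b₃ passes
  -- through it.
  r₂ : (P ℤ.+ 1ℤ) ℤ.* ((P ℤ.+ + 2) ℤ.* b₂) ≡ (Q ℤ.- 1ℤ) ℤ.* ((Q ℤ.- 0ℤ) ℤ.* b₀)
  r₂ = trans (cong ((P ℤ.+ 1ℤ) ℤ.*_) (ratio 1)) (trans (comm (P ℤ.+ 1ℤ) (Q ℤ.- 1ℤ) b₁) (cong ((Q ℤ.- 1ℤ) ℤ.*_) r₁))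
  r₃ : (P ℤ.+ 1ℤ) ℤ.* ((P ℤ.+ + 2) ℤ.* ((P ℤ.+ + 3) ℤ.* b₃)) ≡ (Q ℤ.- + 2) ℤ.* ((Q ℤ.- 1ℤ) ℤ.* ((Q ℤ.- 0ℤ) ℤ.* b₀))
  r₃ = trans (cong (λ x → (P ℤ.+ 1ℤ) ℤ.* ((P ℤ.+ + 2) ℤ.* x)) (ratio 2))
    (trans (comm₂ (P ℤ.+ 1ℤ) (P ℤ.+ + 2) (Q ℤ.- + 2) b₂) (cong ((Q ℤ.- + 2) ℤ.*_) r₂))
    where
    comm₂ : ∀ w x y z → w ℤ.* (x ℤ.* (y ℤ.* z)) ≡ y ℤ.* (w ℤ.* (x ℤ.* z))
    comm₂ = solve-∀
  r₄ : (P ℤ.+ 1ℤ) ℤ.* ((P ℤ.+ + 2) ℤ.* ((P ℤ.+ + 3) ℤ.* ((P ℤ.+ + 4) ℤ.* b₄))) ≡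
       (Q ℤ.- + 3) ℤ.* ((Q ℤ.- + 2) ℤ.* ((Q ℤ.- 1ℤ) ℤ.* ((Q ℤ.- 0ℤ) ℤ.* b₀)))
  r₄ = trans (cong (λ x → (P ℤ.+ 1ℤ) ℤ.* ((P ℤ.+ + 2) ℤ.* ((P ℤ.+ + 3) ℤ.* x))) (ratio 3))
    (trans (comm₃ (P ℤ.+ 1ℤ) (P ℤ.+ + 2) (P ℤ.+ + 3) (Q ℤ.- + 3) b₃) (cong ((Q ℤ.- + 3) ℤ.*_) r₃))
    where
    comm₃ : ∀ v w x y z → v ℤ.* (w ℤ.* (x ℤ.* (y ℤ.* z))) ≡ y ℤ.* (v ℤ.* (w ℤ.* (x ℤ.* z)))
    comm₃ = solve-∀

  l : ∀ P b₀ b₁ b₃ b₄ f →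
    (b₀ ℤ.- + 2 ℤ.* b₁ ℤ.+ + 2 ℤ.* b₃ ℤ.- b₄) ℤ.* ((P ℤ.+ + 4) ℤ.* ((P ℤ.+ + 3) ℤ.* ((P ℤ.+ + 2) ℤ.* ((P ℤ.+ 1ℤ) ℤ.* f)))) ≡
    ((P ℤ.+ 1ℤ) ℤ.* ((P ℤ.+ + 2) ℤ.* ((P ℤ.+ + 3) ℤ.* (P ℤ.+ + 4))) ℤ.* b₀
     ℤ.- + 2 ℤ.* ((P ℤ.+ + 2) ℤ.* ((P ℤ.+ + 3) ℤ.* (P ℤ.+ + 4))) ℤ.* ((P ℤ.+ 1ℤ) ℤ.* b₁)
     ℤ.+ + 2 ℤ.* (P ℤ.+ + 4) ℤ.* ((P ℤ.+ 1ℤ) ℤ.* ((P ℤ.+ + 2) ℤ.* ((P ℤ.+ + 3) ℤ.* b₃)))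
     ℤ.- (P ℤ.+ 1ℤ) ℤ.* ((P ℤ.+ + 2) ℤ.* ((P ℤ.+ + 3) ℤ.* ((P ℤ.+ + 4) ℤ.* b₄)))) ℤ.* f
  l = solve-∀

  identity : ∀ B q b f →
    ((B ℤ.+ q ℤ.+ B ℤ.+ 1ℤ) ℤ.* ((B ℤ.+ q ℤ.+ B ℤ.+ + 2) ℤ.* ((B ℤ.+ q ℤ.+ B ℤ.+ + 3) ℤ.* (B ℤ.+ q ℤ.+ B ℤ.+ + 4))) ℤ.* b
     ℤ.- + 2 ℤ.* ((B ℤ.+ q ℤ.+ B ℤ.+ + 2) ℤ.* ((B ℤ.+ q ℤ.+ B ℤ.+ + 3) ℤ.* (B ℤ.+ q ℤ.+ B ℤ.+ + 4))) ℤ.* ((q ℤ.- 0ℤ) ℤ.* b)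
     ℤ.+ + 2 ℤ.* (B ℤ.+ q ℤ.+ B ℤ.+ + 4) ℤ.* ((q ℤ.- + 2) ℤ.* ((q ℤ.- 1ℤ) ℤ.* ((q ℤ.- 0ℤ) ℤ.* b)))
     ℤ.- (q ℤ.- + 3) ℤ.* ((q ℤ.- + 2) ℤ.* ((q ℤ.- 1ℤ) ℤ.* ((q ℤ.- 0ℤ) ℤ.* b)))) ℤ.* f ≡
    + 4 ℤ.* ((B ℤ.+ + 2) ℤ.* (+ 2 ℤ.* (B ℤ.+ + 2) ℤ.* (B ℤ.+ + 2) ℤ.- + 3 ℤ.* (B ℤ.+ q) ℤ.- + 5)) ℤ.* (((B ℤ.+ q) ℤ.* + 2 ℤ.+ 1ℤ) ℤ.* (b ℤ.* f))
  identity = solve-∀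

-- Factorial quotients and boundary values

toℚᵘ-/ : ∀ i n .{{_ : NonZero n}} → ℚ.toℚᵘ (i ℚ./ n) ℚᵘ.≃ i ℚᵘ./ n
toℚᵘ-/ i (suc n) = ℚ.toℚᵘ-fromℚᵘ (i ℚᵘ./ suc n)

-- Elements of ℚ are kept in lowest terms; among unnormalised fractions the claim is the hypothesis
-- after cross-multiplication.
quotient : ∀ x y m n .{{_ : NonZero m}} .{{_ : NonZero n}} → x ℤ.* (+ n ℤ.* + m) ≡ y →
           x ℚ./ 1 ≡ (y ℚ./ 1) ℚ.* ((1ℤ ℚ./ m) ℚ.* (1ℤ ℚ./ n))
quotient x y m@(suc _) n@(suc _) eq = ℚ.toℚᵘ-injective (begin
  ℚ.toℚᵘ (x ℚ./ 1)
    ≈⟨ toℚᵘ-/ x 1 ⟩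
  x ℚᵘ./ 1
    ≈⟨ *≡* (trans (l x (+ n) (+ m)) (cong (λ z → z ℤ.* (1ℤ ℤ.* 1ℤ) ℤ.* 1ℤ) eq)) ⟩
  (y ℚᵘ./ 1) ℚᵘ.* ((1ℤ ℚᵘ./ m) ℚᵘ.* (1ℤ ℚᵘ./ n))
    ≈⟨ ℚᵘ.*-cong (toℚᵘ-/ y 1) (ℚᵘ.*-cong (toℚᵘ-/ 1ℤ m) (toℚᵘ-/ 1ℤ n)) ⟨
  ℚ.toℚᵘ (y ℚ./ 1) ℚᵘ.* (ℚ.toℚᵘ (1ℤ ℚ./ m) ℚᵘ.* ℚ.toℚᵘ (1ℤ ℚ./ n))
    ≈⟨ ℚᵘ.*-cong (ℚᵘ.≃-refl {ℚ.toℚᵘ (y ℚ./ 1)}) (ℚ.toℚᵘ-homo-* (1ℤ ℚ./ m) (1ℤ ℚ./ n)) ⟨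
  ℚ.toℚᵘ (y ℚ./ 1) ℚᵘ.* ℚ.toℚᵘ ((1ℤ ℚ./ m) ℚ.* (1ℤ ℚ./ n))
    ≈⟨ ℚ.toℚᵘ-homo-* (y ℚ./ 1) _ ⟨
  ℚ.toℚᵘ ((y ℚ./ 1) ℚ.* ((1ℤ ℚ./ m) ℚ.* (1ℤ ℚ./ n))) ∎)
  where
  open ℚᵘ.≃-Reasoning
  l : ∀ x n m → x ℤ.* (1ℤ ℤ.* (m ℤ.* n)) ≡ (x ℤ.* (n ℤ.* m)) ℤ.* (1ℤ ℤ.* 1ℤ) ℤ.* 1ℤ
  l = solve-∀

growth-vanish : ∀ {N B} → N < B → growth N B ≡ 0ℤ
growth-vanish {N} {B} N<B = cong₂ ℤ._-_ (cong₂ ℤ._+_ (cong₂ ℤ._-_ (central-vanish N<B)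
  (cong (+ 2 ℤ.*_) (central-vanish (beyond 1)))) (cong (+ 2 ℤ.*_) (central-vanish (beyond 3)))) (central-vanish (beyond 4))
  where
  beyond : ∀ j → N < j + B
  beyond j = ℕ.<-≤-trans N<B (ℕ.m≤n+m B j)

growth-0 : ∀ N → growth N N ≡ 1ℤ
growth-0 N = cong₂ ℤ._-_ (cong₂ ℤ._+_ (cong₂ ℤ._-_ (central-diagonal N)
  (cong (+ 2 ℤ.*_) (central-vanish (beyond 0)))) (cong (+ 2 ℤ.*_) (central-vanish (beyond 2)))) (central-vanish (beyond 3))
  where
  beyond : ∀ j → N < suc j + N
  beyond j = s≤s (ℕ.m≤n+m N j)

-- With N = B + 1 the first binomial is 2N over 2N - 1, that is 2B + 2; the second contributes -2
-- and the others are out of range.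
growth-1 : ∀ B → growth (suc B) B ≡ + (2 * B)
growth-1 B = trans (cong₂ ℤ._-_ (cong₂ ℤ._+_ (cong₂ ℤ._-_ below
  (cong (+ 2 ℤ.*_) (central-diagonal (suc B)))) (cong (+ 2 ℤ.*_) (central-vanish (beyond 1)))) (central-vanish (beyond 2)))
  (trans (l (+ B)) (sym (ℤ.pos-* 2 B)))
  where
  beyond : ∀ j → suc B < suc j + suc B
  beyond j = s≤s (ℕ.m≤n+m (suc B) j)
  below : central (suc B) B ≡ 1ℤ ℤ.+ + B ℤ.+ + B ℤ.+ 1ℤ
  below = trans (trans (sym (ℤ.*-identityˡ (central (suc B) B)))
    (trans (cong (ℤ._* central (suc B) B) (sym (k (+ B)))) (sym (central-ratio (suc B) B))))
    (trans (cong ((1ℤ ℤ.+ + B ℤ.+ + B ℤ.+ 1ℤ) ℤ.*_) (central-diagonal (suc B))) (ℤ.*-identityʳ _))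
    where
    k : ∀ b → 1ℤ ℤ.+ b ℤ.- b ≡ 1ℤ
    k = solve-∀
  l : ∀ b → (1ℤ ℤ.+ b ℤ.+ b ℤ.+ 1ℤ) ℤ.- + 2 ℤ.* 1ℤ ℤ.+ + 2 ℤ.* 0ℤ ℤ.- 0ℤ ≡ + 2 ℤ.* b
  l = solve-∀

-- For B > N both sides are 0: the left because no walk gets that far, the right by the convention
-- for the factorial of the negative number N - B.
growth-quotient : ∀ N B → fromℤ (growth N B) ≡
  fromℤ (+ 4 ℤ.* cubic (+ N) (+ B ℤ.+ + 2) ℤ.* + ((N * 2 + 1) !)) ℚ.* (1/[ + N ℤ.- + B ]! ℚ.* 1/[ + (N + B + 4) ]!)
growth-quotient N B with B ≤? N
... | yes B≤N with ℕ.m≤n⇒∃[o]m+o≡n B≤N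
...   | q , refl = trans
  (quotient (growth N B) _ (q !) ((N + B + 4) !) {{q ℕ.!≢0}} {{(N + B + 4) ℕ.!≢0}}
    (trans (cong (growth N B ℤ.*_) (sym (ℤ.pos-* ((N + B + 4) !) (q !)))) (growth-! q {B = B} refl)))
  (cong (λ x → fromℤ (+ 4 ℤ.* cubic (+ N) (+ B ℤ.+ + 2) ℤ.* + ((N * 2 + 1) !)) ℚ.* (1/[ x ]! ℚ.* 1/[ + (N + B + 4) ]!)) (k (+ B) (+ q)))
  where
  k : ∀ b q → q ≡ b ℤ.+ q ℤ.- b
  k = solve-∀
growth-quotient N B | no B≰N with ℕ.m≤n⇒∃[o]m+o≡n (ℕ.≰⇒> B≰N)
...   | q , refl = trans (cong fromℤ (growth-vanish (ℕ.≰⇒> B≰N)))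
  (sym (trans (cong (λ x → x′ ℚ.* (1/[ x ]! ℚ.* y′)) (k (+ N) (+ q))) (trans (cong (x′ ℚ.*_) (ℚ.*-zeroˡ y′)) (ℚ.*-zeroʳ x′))))
  where
  x′ = fromℤ (+ 4 ℤ.* cubic (+ N) (+ B ℤ.+ + 2) ℤ.* + ((N * 2 + 1) !))
  y′ = 1/[ + (N + B + 4) ]!
  k : ∀ n q → n ℤ.- (1ℤ ℤ.+ (n ℤ.+ q)) ≡ ℤ.- (1ℤ ℤ.+ q)
  k = solve-∀

-- Log-concavity of the growth

square : ∀ i → 0ℤ ℤ.≤ i ℤ.* i
square (+ n)    = subst (0ℤ ℤ.≤_) (ℤ.pos-* n n) (ℤ.+≤+ z≤n)
square -[1+ n ] = ℤ.+≤+ z≤n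

-- Put σ = s + 4 and A = 2σ² - 3N - 5. The outer values are (σ - 2)(A - 8σ + 8) and (σ + 2)(A + 8σ +
-- 8), and σ²A² exceeds their product by (2A)² + (σ² - 4)(32σ² + 48N + 16), which is nonnegative
-- whatever the sign of A. `rest` is the second summand expanded in s.
cubic-log-concave : ∀ N s → cubic (+ N) (+ s ℤ.+ + 2) ℤ.* cubic (+ N) (+ (4 + s) ℤ.+ + 2) ℤ.≤
                            cubic (+ N) (+ (2 + s) ℤ.+ + 2) ℤ.* cubic (+ N) (+ (2 + s) ℤ.+ + 2)
cubic-log-concave N s = ℤ.≤-trans
  (ℤ.≤-reflexive (sym (ℤ.+-identityʳ (cubic (+ N) (+ s ℤ.+ + 2) ℤ.* cubic (+ N) (+ (4 + s) ℤ.+ + 2)))))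
  (ℤ.≤-trans (ℤ.+-monoʳ-≤ (cubic (+ N) (+ s ℤ.+ + 2) ℤ.* cubic (+ N) (+ (4 + s) ℤ.+ + 2))
    (ℤ.+-mono-≤ (square X) (subst (0ℤ ℤ.≤_) cast (ℤ.+≤+ {n = rest} z≤n))))
  (ℤ.≤-reflexive (defect (+ N) (+ s))))
  where
  X = + 2 ℤ.* (+ 2 ℤ.* (+ s ℤ.+ + 4) ℤ.* (+ s ℤ.+ + 4) ℤ.- + 3 ℤ.* + N ℤ.- + 5)
  rest = (s + 2) * (s + 6) * (32 * (s * s) + 256 * s + 48 * N + 528)
  cast : + rest ≡ (+ s ℤ.+ + 2) ℤ.* (+ s ℤ.+ + 6) ℤ.* (+ 32 ℤ.* (+ s ℤ.* + s) ℤ.+ + 256 ℤ.* + s ℤ.+ + 48 ℤ.* + N ℤ.+ + 528)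
  cast = trans (ℤ.pos-* ((s + 2) * (s + 6)) _) (cong₂ ℤ._*_ (ℤ.pos-* (s + 2) (s + 6))
    (cong (ℤ._+ + 528) (cong₂ ℤ._+_ (cong₂ ℤ._+_
      (trans (ℤ.pos-* 32 (s * s)) (cong (+ 32 ℤ.*_) (ℤ.pos-* s s))) (ℤ.pos-* 256 s)) (ℤ.pos-* 48 N))))
  defect : ∀ N s →
    (s ℤ.+ + 2) ℤ.* (+ 2 ℤ.* (s ℤ.+ + 2) ℤ.* (s ℤ.+ + 2) ℤ.- + 3 ℤ.* N ℤ.- + 5)
    ℤ.* ((+ 4 ℤ.+ s ℤ.+ + 2) ℤ.* (+ 2 ℤ.* (+ 4 ℤ.+ s ℤ.+ + 2) ℤ.* (+ 4 ℤ.+ s ℤ.+ + 2) ℤ.- + 3 ℤ.* N ℤ.- + 5))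
    ℤ.+ (+ 2 ℤ.* (+ 2 ℤ.* (s ℤ.+ + 4) ℤ.* (s ℤ.+ + 4) ℤ.- + 3 ℤ.* N ℤ.- + 5)
           ℤ.* (+ 2 ℤ.* (+ 2 ℤ.* (s ℤ.+ + 4) ℤ.* (s ℤ.+ + 4) ℤ.- + 3 ℤ.* N ℤ.- + 5))
         ℤ.+ (s ℤ.+ + 2) ℤ.* (s ℤ.+ + 6) ℤ.* (+ 32 ℤ.* (s ℤ.* s) ℤ.+ + 256 ℤ.* s ℤ.+ + 48 ℤ.* N ℤ.+ + 528))
    ≡ (+ 2 ℤ.+ s ℤ.+ + 2) ℤ.* (+ 2 ℤ.* (+ 2 ℤ.+ s ℤ.+ + 2) ℤ.* (+ 2 ℤ.+ s ℤ.+ + 2) ℤ.- + 3 ℤ.* N ℤ.- + 5)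
      ℤ.* ((+ 2 ℤ.+ s ℤ.+ + 2) ℤ.* (+ 2 ℤ.* (+ 2 ℤ.+ s ℤ.+ + 2) ℤ.* (+ 2 ℤ.+ s ℤ.+ + 2) ℤ.- + 3 ℤ.* N ℤ.- + 5))
  defect = solve-∀

-- Passing from i to i + 1 shifts B by 2, so factorials change by two factors at a time.
rising : ℕ → ℕ
rising m = (2 + m) * (1 + m)

factorial-rising : ∀ m → + ((2 + m) !) ≡ + rising m ℤ.* + (m !)
factorial-rising m = trans (cong +_ (sym (ℕ.*-assoc (2 + m) (1 + m) (m !)))) (ℤ.pos-* (rising m) (m !))

factorial-rising₂ : ∀ m → + ((4 + m) !) ≡ + rising (2 + m) ℤ.* (+ rising m ℤ.* + (m !))
factorial-rising₂ m = trans (factorial-rising (2 + m)) (cong (+ rising (2 + m) ℤ.*_) (factorial-rising m))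

rising-mono : ∀ m → rising m ≤ rising (2 + m)
rising-mono m = ℕ.*-mono-≤ (ℕ.m≤n+m (2 + m) 2) (ℕ.m≤n+m (1 + m) 2)

-- In terms of quotients, xz/y² is the product of r₀r₂/r₁² and a₁e₁/(a₂e₂), and the hypotheses bound
-- the two factors. The form without division also covers r's that are zero or negative.
quotient-log-concave : ∀ x y z t r₀ r₁ r₂ f g a₁ a₂ e₁ e₂
  {{pf : ℤ.Positive f}} {{pg : ℤ.Positive g}} {{pa₁ : ℤ.Positive a₁}}
  {{pa₂ : ℤ.Positive a₂}} {{pe₁ : ℤ.Positive e₁}} {{pe₂ : ℤ.Positive e₂}} →
  x ℤ.* (f ℤ.* (e₂ ℤ.* (e₁ ℤ.* g))) ≡ t ℤ.* r₀ →
  y ℤ.* ((a₁ ℤ.* f) ℤ.* (e₁ ℤ.* g)) ≡ t ℤ.* r₁ →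
  z ℤ.* ((a₂ ℤ.* (a₁ ℤ.* f)) ℤ.* g) ≡ t ℤ.* r₂ →
  r₀ ℤ.* r₂ ℤ.≤ r₁ ℤ.* r₁ → a₁ ℤ.* e₁ ℤ.≤ a₂ ℤ.* e₂ →
  x ℤ.* z ℤ.≤ y ℤ.* y
quotient-log-concave x y z t r₀ r₁ r₂ f g a₁ a₂ e₁ e₂ {{pf}} {{pg}} {{pa₁}} {{pa₂}} {{pe₁}} {{pe₂}} eq₀ eq₁ eq₂ r≤ a≤ =
  ℤ.*-cancelʳ-≤-pos (x ℤ.* z) (y ℤ.* y) W {{W-positive}} (begin
    x ℤ.* z ℤ.* W
      ≡⟨ l x z f g a₁ a₂ e₁ e₂ ⟩
    (x ℤ.* (f ℤ.* (e₂ ℤ.* (e₁ ℤ.* g)))) ℤ.* (z ℤ.* ((a₂ ℤ.* (a₁ ℤ.* f)) ℤ.* g)) ℤ.* (a₁ ℤ.* e₁)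
      ≡⟨ cong₂ (λ u v → u ℤ.* v ℤ.* (a₁ ℤ.* e₁)) eq₀ eq₂ ⟩
    (t ℤ.* r₀) ℤ.* (t ℤ.* r₂) ℤ.* (a₁ ℤ.* e₁)
      ≡⟨ m₀ t r₀ r₂ (a₁ ℤ.* e₁) ⟩
    (t ℤ.* t ℤ.* (a₁ ℤ.* e₁)) ℤ.* (r₀ ℤ.* r₂)
      ≤⟨ ℤ.*-monoˡ-≤-nonNeg _ {{ℤ.nonNegative tta}} r≤ ⟩
    (t ℤ.* t ℤ.* (a₁ ℤ.* e₁)) ℤ.* (r₁ ℤ.* r₁)
      ≡⟨ m₁ t r₁ (a₁ ℤ.* e₁) ⟩
    ((t ℤ.* r₁) ℤ.* (t ℤ.* r₁)) ℤ.* (a₁ ℤ.* e₁)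
      ≤⟨ ℤ.*-monoˡ-≤-nonNeg _ {{ℤ.nonNegative (square (t ℤ.* r₁))}} a≤ ⟩
    ((t ℤ.* r₁) ℤ.* (t ℤ.* r₁)) ℤ.* (a₂ ℤ.* e₂)
      ≡⟨ cong (λ u → u ℤ.* u ℤ.* (a₂ ℤ.* e₂)) eq₁ ⟨
    (y ℤ.* ((a₁ ℤ.* f) ℤ.* (e₁ ℤ.* g))) ℤ.* (y ℤ.* ((a₁ ℤ.* f) ℤ.* (e₁ ℤ.* g))) ℤ.* (a₂ ℤ.* e₂)
      ≡⟨ r y f g a₁ a₂ e₁ e₂ ⟨
    y ℤ.* y ℤ.* W ∎)
  where
  open ℤ.≤-Reasoning
  -- Both the product of the denominators of x and z times a₁e₁ and the squared denominator of y
  -- times a₂e₂.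
  W = (f ℤ.* g ℤ.* (f ℤ.* g)) ℤ.* (a₁ ℤ.* e₁ ℤ.* (a₁ ℤ.* e₁) ℤ.* (a₂ ℤ.* e₂))

  _⊗_ : ∀ {i j} → ℤ.Positive i → ℤ.Positive j → ℤ.Positive (i ℤ.* j)
  _⊗_ {+ suc _} {+ suc _} _ _ = _

  ae-positive : ℤ.Positive (a₁ ℤ.* e₁)
  ae-positive = pa₁ ⊗ pe₁

  fg-positive : ℤ.Positive (f ℤ.* g)
  fg-positive = pf ⊗ pg

  W-positive : ℤ.Positive W
  W-positive = (fg-positive ⊗ fg-positive) ⊗ ((ae-positive ⊗ ae-positive) ⊗ (pa₂ ⊗ pe₂))

  tta : 0ℤ ℤ.≤ t ℤ.* t ℤ.* (a₁ ℤ.* e₁)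
  tta = ℤ.*-monoʳ-≤-nonNeg (a₁ ℤ.* e₁) {{ℤ.nonNegative (ℤ.<⇒≤ (ℤ.positive⁻¹ (a₁ ℤ.* e₁) {{ae-positive}}))}} (square t)

  l : ∀ x z f g a₁ a₂ e₁ e₂ →
    x ℤ.* z ℤ.* ((f ℤ.* g ℤ.* (f ℤ.* g)) ℤ.* (a₁ ℤ.* e₁ ℤ.* (a₁ ℤ.* e₁) ℤ.* (a₂ ℤ.* e₂))) ≡
    (x ℤ.* (f ℤ.* (e₂ ℤ.* (e₁ ℤ.* g)))) ℤ.* (z ℤ.* ((a₂ ℤ.* (a₁ ℤ.* f)) ℤ.* g)) ℤ.* (a₁ ℤ.* e₁)
  l = solve-∀
  m₀ : ∀ t r₀ r₂ a → (t ℤ.* r₀) ℤ.* (t ℤ.* r₂) ℤ.* a ≡ (t ℤ.* t ℤ.* a) ℤ.* (r₀ ℤ.* r₂)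
  m₀ = solve-∀
  m₁ : ∀ t r a → (t ℤ.* t ℤ.* a) ℤ.* (r ℤ.* r) ≡ ((t ℤ.* r) ℤ.* (t ℤ.* r)) ℤ.* a
  m₁ = solve-∀
  r : ∀ y f g a₁ a₂ e₁ e₂ →
    y ℤ.* y ℤ.* ((f ℤ.* g ℤ.* (f ℤ.* g)) ℤ.* (a₁ ℤ.* e₁ ℤ.* (a₁ ℤ.* e₁) ℤ.* (a₂ ℤ.* e₂))) ≡
    (y ℤ.* ((a₁ ℤ.* f) ℤ.* (e₁ ℤ.* g))) ℤ.* (y ℤ.* ((a₁ ℤ.* f) ℤ.* (e₁ ℤ.* g))) ℤ.* (a₂ ℤ.* e₂)
  r = solve-∀

growth-log-concave : ∀ N B → growth N B ℤ.* growth N (4 + B) ℤ.≤ growth N (2 + B) ℤ.* growth N (2 + B)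
growth-log-concave N B with (4 + B) ≤? N
-- Beyond the last nonzero value the left side is 0 and the right side is a square.
... | no  4+B≰N = subst (ℤ._≤ growth N (2 + B) ℤ.* growth N (2 + B))
  (sym (trans (cong (growth N B ℤ.*_) (growth-vanish (ℕ.≰⇒> 4+B≰N))) (ℤ.*-zeroʳ (growth N B)))) (square (growth N (2 + B)))
... | yes 4+B≤N with ℕ.m≤n⇒∃[o]m+o≡n 4+B≤N
...   | q , eq = quotient-log-concave
  (growth N B) (growth N (2 + B)) (growth N (4 + B)) (+ 4 ℤ.* + ((N * 2 + 1) !))
  (cubic (+ N) (+ B ℤ.+ + 2)) (cubic (+ N) (+ (2 + B) ℤ.+ + 2)) (cubic (+ N) (+ (4 + B) ℤ.+ + 2))
  (+ (p !)) (+ (q !)) (+ rising p) (+ rising (2 + p)) (+ rising q) (+ rising (2 + q))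
  {{positive (p ℕ.!≢0)}} {{positive (q ℕ.!≢0)}}
  (closed B (4 + q) (trans (sym eq) (e₀ B q)) (trans (ℤ.pos-* (p !) ((4 + q) !)) (cong (+ (p !) ℤ.*_) (factorial-rising₂ q))))
  (closed (2 + B) (2 + q) (trans (sym eq) (e₁ B q)) (trans (cong (λ x → + (x ! * (2 + q) !)) (f₁ N B))
    (trans (ℤ.pos-* ((2 + p) !) ((2 + q) !)) (cong₂ ℤ._*_ (factorial-rising p) (factorial-rising q)))))
  (closed (4 + B) q (sym eq) (trans (cong (λ x → + (x ! * q !)) (f₂ N B))
    (trans (ℤ.pos-* ((4 + p) !) (q !)) (cong (ℤ._* + (q !)) (factorial-rising₂ p)))))
  (cubic-log-concave N B)
  (subst₂ ℤ._≤_ (ℤ.pos-* (rising p) (rising q)) (ℤ.pos-* (rising (2 + p)) (rising (2 + q)))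
    (ℤ.+≤+ (ℕ.*-mono-≤ (rising-mono p) (rising-mono q))))
  where
  open +-*-Solver
  p = N + B + 4

  positive : ∀ {n} → NonZero n → ℤ.Positive (+ n)
  positive {suc n} _ = _

  closed : ∀ B q → N ≡ B + q → ∀ {w} → + ((N + B + 4) ! * q !) ≡ w →
           growth N B ℤ.* w ≡ + 4 ℤ.* + ((N * 2 + 1) !) ℤ.* cubic (+ N) (+ B ℤ.+ + 2)
  closed B q eq refl = trans (growth-! q eq) (swap (+ 4) (cubic (+ N) (+ B ℤ.+ + 2)) (+ ((N * 2 + 1) !)))
    where
    swap : ∀ a b c → a ℤ.* b ℤ.* c ≡ a ℤ.* c ℤ.* b
    swap = solve-∀

  e₀ : ∀ B q → 4 + B + q ≡ B + (4 + q)
  e₀ = solve 2 (λ B q → con 4 :+ B :+ q := B :+ (con 4 :+ q)) refl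
  e₁ : ∀ B q → 4 + B + q ≡ 2 + B + (2 + q)
  e₁ = solve 2 (λ B q → con 4 :+ B :+ q := con 2 :+ B :+ (con 2 :+ q)) refl
  f₁ : ∀ N B → N + (2 + B) + 4 ≡ 2 + (N + B + 4)
  f₁ = solve 2 (λ N B → N :+ (con 2 :+ B) :+ con 4 := con 2 :+ (N :+ B :+ con 4)) refl
  f₂ : ∀ N B → N + (4 + B) + 4 ≡ 4 + (N + B + 4)
  f₂ = solve 2 (λ N B → N :+ (con 4 :+ B) :+ con 4 := con 4 :+ (N :+ B :+ con 4)) refl

-- The coefficients

coeff-Pnest : ∀ n j → [t^ suc j ] Pnest (suc n) + strip (suc (j * 2)) (suc n * 2) 0 ≡ strip (2 + suc (j * 2)) (suc n * 2) 0
coeff-Pnest n j = begin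
  [t^ suc j ] Pnest (suc n) + strip (suc (j * 2)) (suc n * 2) 0 ≡⟨ cong (λ x → [t^ suc j ] Pnest (suc n) + x) (atMost-DP j n) ⟨
  [t^ suc j ] Pnest (suc n) + atMost j (DP (suc n))             ≡⟨ coeff+atMost j (DP (suc n)) ⟩
  atMost (suc j) (DP (suc n))                                   ≡⟨ atMost-DP (suc j) n ⟩
  strip (2 + suc (j * 2)) (suc n * 2) 0                         ∎
  where open ≡-Reasoning

coeff-Pnestᶜ : ∀ n j → [t^ suc j ] Pnestᶜ (suc n) + strip (j * 2) (n * 2) 0 ≡ strip (2 + j * 2) (n * 2) 0
coeff-Pnestᶜ n j = begin
  [t^ suc j ] Pnestᶜ (suc n) + strip (j * 2) (n * 2) 0   ≡⟨ cong (λ x → [t^ suc j ] Pnestᶜ (suc n) + x) (atMost-DPᶜ j n) ⟨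
  [t^ suc j ] Pnestᶜ (suc n) + atMost j (DPᶜ (suc n))    ≡⟨ coeff+atMost j (DPᶜ (suc n)) ⟩
  atMost (suc j) (DPᶜ (suc n))                           ≡⟨ atMost-DPᶜ (suc j) n ⟩
  strip (2 + j * 2) (n * 2) 0                            ∎
  where open ≡-Reasoning

strip-difference : ∀ {x N B} → N ≤ 2 * B → x + strip B (N * 2) 0 ≡ strip (2 + B) (N * 2) 0 → + x ≡ growth N B
strip-difference {x} {N} {B} N≤2B eq = ∙-cancelʳ ℤ.+-0-abelianGroup (+ strip B (N * 2) 0) (+ x) (growth N B)
  (trans (cong +_ eq) (strip-growth N≤2B))

Pnest-growth : ∀ n j → suc n ≤ 2 * suc (j * 2) → + [t^ suc j ] Pnest (suc n) ≡ growth (suc n) (suc (j * 2))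
Pnest-growth n j le = strip-difference le (coeff-Pnest n j)

Pnestᶜ-growth : ∀ n j → n ≤ 2 * (j * 2) → + [t^ suc j ] Pnestᶜ (suc n) ≡ growth n (j * 2)
Pnestᶜ-growth n j le = strip-difference le (coeff-Pnestᶜ n j)

-- Narrow strips

strip-2 : ∀ n → strip 2 (n * 2) 0 ≡ 1
strip-2 zero    = refl
strip-2 (suc n) = strip-2 n

-- Every pair of steps from 0 or 2 passes through 1 and ends at either of them, so both counts
-- double.
strip-3 : ∀ n → strip 3 (suc n * 2) 0 ≡ 2 ^ n × strip 3 (suc n * 2) 2 ≡ 2 ^ n
strip-3 zero    = refl , refl
strip-3 (suc n) with strip-3 n
... | e₀ , e₂ = sum , sum
  where
  sum : strip 3 (suc n * 2) 2 + strip 3 (suc n * 2) 0 ≡ 2 ^ suc n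
  sum = trans (cong₂ _+_ e₂ e₀) (cong (λ x → 2 ^ n + x) (sym (ℕ.+-identityʳ (2 ^ n))))

-- Two more steps turn the counts (x, y) at 0 and 2 into (x + y, x + 2y), two Fibonacci steps.
strip-4 : ∀ n → + strip 4 (suc n * 2) 0 ≡ F (+ suc (n * 2)) × + strip 4 (suc n * 2) 2 ≡ F (+ suc (suc (n * 2)))
strip-4 zero    = refl , refl
strip-4 (suc n) with strip-4 n
... | e₀ , e₂ = sum , trans (ℤ.+-comm (+ strip 4 (suc n * 2) 2) (+ (strip 4 (suc n * 2) 2 + strip 4 (suc n * 2) 0))) (cong₂ ℤ._+_ sum e₂)
  where
  sum : + strip 4 (suc n * 2) 2 ℤ.+ + strip 4 (suc n * 2) 0 ≡ F (+ suc (suc n * 2))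
  sum = cong₂ ℤ._+_ e₂ e₀

S-1 : ∀ n → S (suc n) 1 ≡ 1
S-1 zero    = refl
S-1 (suc n) = trans (ℕ.+-identityʳ _) (trans (ℕ.+-identityʳ _) (S-1 n))

S-2 : ∀ n → suc (S (suc n) 2) ≡ 2 ^ n
S-2 zero    = refl
S-2 (suc n) = trans (cong (λ x → suc (2 * S (suc n) 2 + x)) (S-1 n))
  (trans (double (S (suc n) 2)) (cong (2 *_) (S-2 n)))
  where
  open +-*-Solver
  double : ∀ x → suc (2 * x + 1) ≡ 2 * suc x
  double = solve 1 (λ x → con 1 :+ (con 2 :* x :+ con 1) := con 2 :* (con 1 :+ x)) refl

-- Two more steps preserve f 0 - f 4 = 1 and replace f 0 by f 2 + f 0 = f 4 + 2 f 0 = 3 f 0 - 1. The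
-- recurrence of the Stirling numbers with S(n + 1, 2) = 2^n - 1 gives 2^n + S(n + 1, 3) the same
-- rule.
strip-5 : ∀ n → let f = λ y → strip 5 (suc n * 2) y in
          f 0 ≡ 2 ^ n + S (suc n) 3 × f 0 ≡ suc (f 4) × f 2 ≡ f 4 + f 0
strip-5 zero    = refl , refl , refl
strip-5 (suc n) with strip-5 n
... | e₀ , e₄ , e₂ = sum , diff , refl
  where
  open +-*-Solver
  f : ℕ → ℕ
  f y = strip 5 (suc n * 2) y

  diff : f 2 + f 0 ≡ suc (f 4 + f 2)
  diff = trans (cong (λ x → f 2 + x) e₄) (trans (ℕ.+-suc (f 2) (f 4)) (cong suc (ℕ.+-comm (f 2) (f 4))))

  sum : f 2 + f 0 ≡ 2 ^ suc n + S (suc (suc n)) 3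
  sum = ℕ.suc-injective (begin
    suc (f 2 + f 0)                                     ≡⟨ cong (λ x → suc (x + f 0)) e₂ ⟩
    suc (f 4) + f 0 + f 0                               ≡⟨ cong (λ x → x + f 0 + f 0) e₄ ⟨
    f 0 + f 0 + f 0                                     ≡⟨ cong (λ x → x + x + x) e₀ ⟩
    (2 ^ n + s₃) + (2 ^ n + s₃) + (2 ^ n + s₃)          ≡⟨ collect (2 ^ n) s₃ ⟩
    2 ^ suc n + (3 * s₃ + 2 ^ n)                        ≡⟨ cong (λ x → 2 ^ suc n + (3 * s₃ + x)) (S-2 n) ⟨
    2 ^ suc n + (3 * s₃ + suc (S (suc n) 2))            ≡⟨ cong (λ x → 2 ^ suc n + x) (ℕ.+-suc (3 * s₃) _) ⟩
    2 ^ suc n + suc (S (suc (suc n)) 3)                 ≡⟨ ℕ.+-suc (2 ^ suc n) _ ⟩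
    suc (2 ^ suc n + S (suc (suc n)) 3)                 ∎)
    where
    open ≡-Reasoning
    s₃ = S (suc n) 3
    collect : ∀ p s → (p + s) + (p + s) + (p + s) ≡ 2 * p + (3 * s + p)
    collect = solve 2 (λ p s → (p :+ s) :+ (p :+ s) :+ (p :+ s) := con 2 :* p :+ (con 3 :* s :+ p)) refl

Pnest-1 : ∀ n → [t^ 1 ] Pnest (suc n) ≡ 2 ^ n
-- The strip with the single height 0 allows no step, so the count to be subtracted reduces to 0.
Pnest-1 n = trans (sym (ℕ.+-identityʳ _)) (trans (coeff-Pnest n 0) (proj₁ (strip-3 n)))

Pnestᶜ-1 : ∀ n → [t^ 1 ] Pnestᶜ (suc n) ≡ 1
Pnestᶜ-1 n = trans (sym (trans (cong (λ x → [t^ 1 ] Pnestᶜ (suc n) + x) (strip-outside {0} (n * 2) {0} z≤n)) (ℕ.+-identityʳ _)))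
  (trans (coeff-Pnestᶜ n 0) (strip-2 n))

Pnest-2 : ∀ n → [t^ 2 ] Pnest (suc n) ≡ S (suc n) 3
Pnest-2 n = ℕ.+-cancelˡ-≡ (2 ^ n) _ _ (trans (ℕ.+-comm (2 ^ n) _)
  (trans (cong (λ x → [t^ 2 ] Pnest (suc n) + x) (sym (proj₁ (strip-3 n)))) (trans (coeff-Pnest n 1) (proj₁ (strip-5 n)))))

Pnestᶜ-2 : ∀ n → + [t^ 2 ] Pnestᶜ (suc n) ≡ F (+ (2 * suc n) ℤ.- + 3) ℤ.- 1ℤ
Pnestᶜ-2 n = trans (sym (cancel (+ [t^ 2 ] Pnestᶜ (suc n)))) (cong (ℤ._- 1ℤ)
  (trans (cong (λ x → + ([t^ 2 ] Pnestᶜ (suc n) + x)) (sym (strip-2 n))) (trans (cong +_ (coeff-Pnestᶜ n 1)) (fibonacci n))))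
  where
  cancel : ∀ x → x ℤ.+ 1ℤ ℤ.- 1ℤ ≡ x
  cancel = solve-∀
  fibonacci : ∀ n → + strip 4 (n * 2) 0 ≡ F (+ (2 * suc n) ℤ.- + 3)
  -- For a single vertex the index is 2 - 3 = -1, and F(-1) = 1 counts the empty walk.
  fibonacci zero    = refl
  fibonacci (suc n) = trans (proj₁ (strip-4 n)) (cong (λ x → F (+ x ℤ.- + 3)) (ℕ.*-comm (suc (suc n)) 2))

-- Ranges of i and closed formulas

⌈⌉≤⇒ : ∀ {n i} → ⌈ (n + 2) / 4 ⌉ ≤ i → n + 2 ≤ 4 * i
⌈⌉≤⇒ {n} {i} le = ℕ.+-cancelʳ-≤ 4 (n + 2) (4 * i) (begin
  n + 2 + 4                                         ≡⟨ ℕ.+-suc (n + 2) 3 ⟩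
  suc (n + 2 + 3)                                   ≡⟨ cong suc (m≡m%n+[m/n]*n (n + 2 + 3) 4) ⟩
  suc ((n + 2 + 3) % 4) + (n + 2 + 3) / 4 * 4       ≤⟨ ℕ.+-mono-≤ (m%n<n (n + 2 + 3) 4) (ℕ.*-monoˡ-≤ 4 le) ⟩
  4 + i * 4                                         ≡⟨ ℕ.+-comm 4 (i * 4) ⟩
  i * 4 + 4                                         ≡⟨ cong (_+ 4) (ℕ.*-comm i 4) ⟩
  4 * i + 4                                         ∎)
  where open ℕ.≤-Reasoning

/<⇒ : ∀ {n i} → (n + 2) / 4 < i → n + 2 < 4 * i
/<⇒ {n} {i} lt = begin-strict
  n + 2                           ≡⟨ m≡m%n+[m/n]*n (n + 2) 4 ⟩
  (n + 2) % 4 + (n + 2) / 4 * 4   <⟨ ℕ.+-monoˡ-< ((n + 2) / 4 * 4) (m%n<n (n + 2) 4) ⟩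
  suc ((n + 2) / 4) * 4           ≤⟨ ℕ.*-monoˡ-≤ 4 lt ⟩
  i * 4                           ≡⟨ ℕ.*-comm i 4 ⟩
  4 * i                           ∎
  where open ℕ.≤-Reasoning

Pnest-range : ∀ {n j} → ⌈ (n + 2) / 4 ⌉ ≤ suc j → n ≤ 2 * suc (j * 2)
Pnest-range {n} {j} le = ℕ.+-cancelʳ-≤ 2 n _ (ℕ.≤-trans (⌈⌉≤⇒ le) (ℕ.≤-reflexive (expand j)))
  where
  open +-*-Solver
  expand : ∀ j → 4 * suc j ≡ 2 * suc (j * 2) + 2
  expand = solve 1 (λ j → con 4 :* (con 1 :+ j) := con 2 :* (con 1 :+ j :* con 2) :+ con 2) refl

Pnestᶜ-range : ∀ {n j} → (suc n + 2) / 4 < suc j → n ≤ 2 * (j * 2)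
Pnestᶜ-range {n} {j} lt = ℕ.+-cancelʳ-≤ 4 n _ (ℕ.≤-trans (ℕ.≤-reflexive (shift n))
  (ℕ.≤-trans (/<⇒ {suc n} lt) (ℕ.≤-reflexive (expand j))))
  where
  open +-*-Solver
  shift : ∀ n → n + 4 ≡ suc (suc n + 2)
  shift = solve 1 (λ n → n :+ con 4 := con 1 :+ (con 1 :+ n :+ con 2)) refl
  expand : ∀ j → 4 * suc j ≡ 2 * (j * 2) + 4
  expand = solve 1 (λ j → con 4 :* (con 1 :+ j) := con 2 :* (j :* con 2) :+ con 4) refl

range-positive : ∀ {n i} → n + 2 ≤ 4 * i → ∃ λ j → i ≡ suc j
range-positive {n} {zero}  le = contradiction (ℕ.≤-trans (ℕ.m≤n+m 2 n) le) λ ()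
range-positive {n} {suc j} _  = j , refl

-- Here B = 2i - 1, so s = 2i + 1 and 2s² - 5 = 8i(i + 1) - 3.
Pnest-formula : ∀ n j → let i = suc j in
  fromℤ (growth n (suc (j * 2))) ≡
  fromℤ (+ (4 * (2 * i + 1)) ℤ.* (+ (8 * i * (i + 1)) ℤ.- + (3 * (n + 1))) ℤ.* + ((2 * n + 1) !))
    ℚ.* (1/[ + n ℤ.- + (2 * i) ℤ.+ + 1 ]! ℚ.* 1/[ + (n + 2 * i + 3) ]!)
Pnest-formula n j = trans (growth-quotient n (suc (j * 2))) (cong₂ (λ x y → fromℤ x ℚ.* y)
  (cong₂ ℤ._*_ numerator (cong (λ x → + ((x + 1) !)) (ℕ.*-comm n 2)))
  (cong₂ (λ x y → 1/[ x ]! ℚ.* 1/[ + y ]!) argument (solve 2 (λ n j → n :+ (con 1 :+ j :* con 2) :+ con 4 := n :+ con 2 :* (con 1 :+ j) :+ con 3) refl n j)))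
  where
  open +-*-Solver
  i = suc j
  numerator : + 4 ℤ.* cubic (+ n) (+ suc (j * 2) ℤ.+ + 2) ≡ + (4 * (2 * i + 1)) ℤ.* (+ (8 * i * (i + 1)) ℤ.- + (3 * (n + 1)))
  numerator = begin
    + 4 ℤ.* cubic (+ n) (1ℤ ℤ.+ + (j * 2) ℤ.+ + 2)
      ≡⟨ cong (λ x → + 4 ℤ.* cubic (+ n) (1ℤ ℤ.+ x ℤ.+ + 2)) (ℤ.pos-* j 2) ⟩
    + 4 ℤ.* cubic (+ n) (1ℤ ℤ.+ + j ℤ.* + 2 ℤ.+ + 2)
      ≡⟨ identity (+ n) (+ j) ⟩
    + 4 ℤ.* (+ 2 ℤ.* + i ℤ.+ 1ℤ) ℤ.* (+ 8 ℤ.* + i ℤ.* (+ i ℤ.+ 1ℤ) ℤ.- + 3 ℤ.* (+ n ℤ.+ 1ℤ))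
      ≡⟨ cong₂ ℤ._*_ (trans (ℤ.pos-* 4 (2 * i + 1)) (cong (λ x → + 4 ℤ.* (x ℤ.+ 1ℤ)) (ℤ.pos-* 2 i)))
           (cong₂ ℤ._-_ (trans (ℤ.pos-* (8 * i) (i + 1)) (cong (ℤ._* (+ i ℤ.+ 1ℤ)) (ℤ.pos-* 8 i))) (ℤ.pos-* 3 (n + 1))) ⟨
    + (4 * (2 * i + 1)) ℤ.* (+ (8 * i * (i + 1)) ℤ.- + (3 * (n + 1))) ∎
    where
    open ≡-Reasoning
    identity : ∀ n j → + 4 ℤ.* ((1ℤ ℤ.+ j ℤ.* + 2 ℤ.+ + 2) ℤ.* (+ 2 ℤ.* (1ℤ ℤ.+ j ℤ.* + 2 ℤ.+ + 2) ℤ.* (1ℤ ℤ.+ j ℤ.* + 2 ℤ.+ + 2) ℤ.- + 3 ℤ.* n ℤ.- + 5)) ≡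
      + 4 ℤ.* (+ 2 ℤ.* (1ℤ ℤ.+ j) ℤ.+ 1ℤ) ℤ.* (+ 8 ℤ.* (1ℤ ℤ.+ j) ℤ.* ((1ℤ ℤ.+ j) ℤ.+ 1ℤ) ℤ.- + 3 ℤ.* (n ℤ.+ 1ℤ))
    identity = solve-∀
  argument : + n ℤ.- + suc (j * 2) ≡ + n ℤ.- + (2 * i) ℤ.+ + 1
  argument = trans (cong (λ x → + n ℤ.- (1ℤ ℤ.+ x)) (ℤ.pos-* j 2))
    (trans (identity (+ n) (+ j)) (cong (λ x → + n ℤ.- x ℤ.+ + 1) (sym (ℤ.pos-* 2 i))))
    where
    identity : ∀ n j → n ℤ.- (1ℤ ℤ.+ j ℤ.* + 2) ≡ n ℤ.- + 2 ℤ.* (1ℤ ℤ.+ j) ℤ.+ + 1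
    identity = solve-∀

-- Here N = n - 1 and s = 2i, so the cubic is 2i(8i² - 3n - 2). The factor 2n - 1 split off from (2n
-- - 1)! is multiplied in, and (3n + 2)(2n - 1) = 6n² + n - 2.
Pnestᶜ-formula : ∀ m j → let n = suc m; i = suc j in
  fromℤ (growth m (j * 2)) ≡
  fromℤ (+ (8 * i) ℤ.* (+ (8 * i ^ 2) ℤ.* (+ (2 * n) ℤ.- + 1) ℤ.- (+ (6 * n ^ 2 + n) ℤ.- + 2)) ℤ.* + ((2 * n ∸ 2) !))
    ℚ.* (1/[ + n ℤ.- + (2 * i) ℤ.+ + 1 ]! ℚ.* 1/[ + (n + 2 * i + 1) ]!)
Pnestᶜ-formula m j = trans (growth-quotient m (j * 2)) (cong₂ (λ x y → fromℤ x ℚ.* y) numerator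
  (cong₂ (λ x y → 1/[ x ]! ℚ.* 1/[ + y ]!) argument
    (solve 2 (λ m j → m :+ j :* con 2 :+ con 4 := con 1 :+ m :+ con 2 :* (con 1 :+ j) :+ con 1) refl m j)))
  where
  open +-*-Solver
  n′ = suc m
  i = suc j
  square-pos : ∀ k → + (k ^ 2) ≡ + k ℤ.* + k
  square-pos k = trans (ℤ.pos-* k (k * 1)) (cong (λ x → + k ℤ.* + x) (ℕ.*-identityʳ k))
  factorial : + ((m * 2 + 1) !) ≡ (+ m ℤ.* + 2 ℤ.+ 1ℤ) ℤ.* + ((2 * n′ ∸ 2) !)
  factorial = trans (cong (λ x → + (x !)) (ℕ.+-comm (m * 2) 1)) (trans (ℤ.pos-* (suc (m * 2)) ((m * 2) !))
    (cong₂ ℤ._*_ (trans (cong (λ x → 1ℤ ℤ.+ x) (ℤ.pos-* m 2)) (ℤ.+-comm 1ℤ (+ m ℤ.* + 2)))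
      (cong (λ x → + ((x ∸ 2) !)) (ℕ.*-comm n′ 2))))
  numerator : + 4 ℤ.* cubic (+ m) (+ (j * 2) ℤ.+ + 2) ℤ.* + ((m * 2 + 1) !) ≡
    + (8 * i) ℤ.* (+ (8 * i ^ 2) ℤ.* (+ (2 * n′) ℤ.- + 1) ℤ.- (+ (6 * n′ ^ 2 + n′) ℤ.- + 2)) ℤ.* + ((2 * n′ ∸ 2) !)
  numerator = begin
    + 4 ℤ.* cubic (+ m) (+ (j * 2) ℤ.+ + 2) ℤ.* + ((m * 2 + 1) !)
      ≡⟨ cong₂ (λ x y → + 4 ℤ.* cubic (+ m) (x ℤ.+ + 2) ℤ.* y) (ℤ.pos-* j 2) factorial ⟩
    + 4 ℤ.* cubic (+ m) (+ j ℤ.* + 2 ℤ.+ + 2) ℤ.* ((+ m ℤ.* + 2 ℤ.+ 1ℤ) ℤ.* + ((2 * n′ ∸ 2) !))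
      ≡⟨ identity (+ m) (+ j) (+ ((2 * n′ ∸ 2) !)) ⟩
    + 8 ℤ.* + i ℤ.* (+ 8 ℤ.* (+ i ℤ.* + i) ℤ.* (+ 2 ℤ.* + n′ ℤ.- + 1) ℤ.- (+ 6 ℤ.* (+ n′ ℤ.* + n′) ℤ.+ + n′ ℤ.- + 2)) ℤ.* + ((2 * n′ ∸ 2) !)
      ≡⟨ cong (ℤ._* + ((2 * n′ ∸ 2) !)) (cong₂ ℤ._*_ (ℤ.pos-* 8 i) (cong₂ ℤ._-_
           (cong₂ (λ x y → x ℤ.* (y ℤ.- + 1)) (trans (ℤ.pos-* 8 (i ^ 2)) (cong (+ 8 ℤ.*_) (square-pos i))) (ℤ.pos-* 2 n′))
           (cong (λ x → x ℤ.+ + n′ ℤ.- + 2) (trans (ℤ.pos-* 6 (n′ ^ 2)) (cong (+ 6 ℤ.*_) (square-pos n′)))))) ⟨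
    + (8 * i) ℤ.* (+ (8 * i ^ 2) ℤ.* (+ (2 * n′) ℤ.- + 1) ℤ.- (+ (6 * n′ ^ 2 + n′) ℤ.- + 2)) ℤ.* + ((2 * n′ ∸ 2) !) ∎
    where
    open ≡-Reasoning
    identity : ∀ m j f →
      + 4 ℤ.* ((j ℤ.* + 2 ℤ.+ + 2) ℤ.* (+ 2 ℤ.* (j ℤ.* + 2 ℤ.+ + 2) ℤ.* (j ℤ.* + 2 ℤ.+ + 2) ℤ.- + 3 ℤ.* m ℤ.- + 5)) ℤ.* ((m ℤ.* + 2 ℤ.+ 1ℤ) ℤ.* f) ≡
      + 8 ℤ.* (1ℤ ℤ.+ j) ℤ.* (+ 8 ℤ.* ((1ℤ ℤ.+ j) ℤ.* (1ℤ ℤ.+ j)) ℤ.* (+ 2 ℤ.* (1ℤ ℤ.+ m) ℤ.- + 1)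
        ℤ.- (+ 6 ℤ.* ((1ℤ ℤ.+ m) ℤ.* (1ℤ ℤ.+ m)) ℤ.+ (1ℤ ℤ.+ m) ℤ.- + 2)) ℤ.* f
    identity = solve-∀
  argument : + m ℤ.- + (j * 2) ≡ + n′ ℤ.- + (2 * i) ℤ.+ + 1
  argument = trans (cong (λ x → + m ℤ.- x) (ℤ.pos-* j 2))
    (trans (identity (+ m) (+ j)) (cong (λ x → + n′ ℤ.- x ℤ.+ + 1) (sym (ℤ.pos-* 2 i))))
    where
    identity : ∀ m j → m ℤ.- j ℤ.* + 2 ≡ (1ℤ ℤ.+ m) ℤ.- + 2 ℤ.* (1ℤ ℤ.+ j) ℤ.+ + 1
    identity = solve-∀

-- Top coefficients and conclusion

parity : ∀ n → ∃ λ j → n ≡ j * 2 ⊎ n ≡ suc (j * 2)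
parity zero    = 0 , inj₁ refl
parity (suc n) with parity n
... | j , inj₁ refl = j , inj₂ refl
... | j , inj₂ refl = suc j , inj₁ refl

odd : ∀ {n} → 2 ∤ n → ∃ λ j → n ≡ suc (j * 2)
odd {n} 2∤n with parity n
... | j , inj₁ refl = contradiction (n∣m*n j) 2∤n
... | j , inj₂ eq   = j , eq

even : ∀ {n} → 1 ≤ n → 2 ∣ n → ∃ λ j → n ≡ suc j * 2
even (s≤s _) (divides (suc j) eq) = j , eq

⌊double/2⌋ : ∀ j → ⌊ j * 2 /2⌋ ≡ j
⌊double/2⌋ zero    = refl
⌊double/2⌋ (suc j) = cong suc (⌊double/2⌋ j)

⌊1+double/2⌋ : ∀ j → ⌊ suc (j * 2) /2⌋ ≡ j
⌊1+double/2⌋ zero    = refl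
⌊1+double/2⌋ (suc j) = cong suc (⌊1+double/2⌋ j)

log-concave : ∀ {x y z : ℕ} N B → + x ≡ growth N B → + y ≡ growth N (2 + B) → + z ≡ growth N (4 + B) → x * z ≤ y ^ 2
log-concave {x} {y} {z} N B eqx eqy eqz = ℤ.drop‿+≤+ (subst₂ ℤ._≤_
  (trans (cong₂ ℤ._*_ (sym eqx) (sym eqz)) (sym (ℤ.pos-* x z)))
  (trans (cong₂ ℤ._*_ (sym eqy) (sym eqy)) (trans (sym (ℤ.pos-* y y)) (cong (λ w → + (y * w)) (sym (ℕ.*-identityʳ y)))))
  (growth-log-concave N B))

2+m≤2*[1+m] : ∀ m → 2 + m ≤ 2 * suc m
2+m≤2*[1+m] m = ℕ.≤-trans (ℕ.≤-reflexive (ℕ.+-comm 1 (suc m))) (ℕ.+-monoʳ-≤ (suc m) (s≤s z≤n))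

Pnest-top-odd : ∀ j → let n = suc (j * 2) in [t^ ⌈ n /2⌉ ] Pnest n ≡ 1
Pnest-top-odd j = trans (cong (λ i → [t^ suc i ] Pnest n′) (⌊double/2⌋ j))
  (ℤ.+-injective (trans (Pnest-growth (j * 2) j (ℕ.m≤m+n n′ (n′ + 0))) (growth-0 n′)))
  where n′ = suc (j * 2)

Pnest-top-even : ∀ j → let n = suc j * 2 in [t^ ⌈ n /2⌉ ] Pnest n ≡ 2 * (n ∸ 1)
Pnest-top-even j = trans (cong (λ i → [t^ suc i ] Pnest (suc j * 2)) (⌊1+double/2⌋ j))
  (ℤ.+-injective (trans (Pnest-growth (suc (j * 2)) j (2+m≤2*[1+m] (j * 2))) (growth-1 (suc (j * 2)))))

Pnestᶜ-top-odd : ∀ j → let n = suc (j * 2) in [t^ ⌈ n /2⌉ ] Pnestᶜ n ≡ 1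
Pnestᶜ-top-odd j = trans (cong (λ i → [t^ suc i ] Pnestᶜ (suc (j * 2))) (⌊double/2⌋ j))
  (ℤ.+-injective (trans (Pnestᶜ-growth (j * 2) j (ℕ.m≤m+n (j * 2) (j * 2 + 0))) (growth-0 (j * 2))))

-- At n = 2 one has N = 1 and B = 0, outside N ≤ 2B, and the value really differs: the single edge
-- gives the coefficient 1, while 2(n - 2) is 0.
Pnestᶜ-top-even : ∀ j → let n = suc j * 2 in n ≢ 2 → [t^ ⌈ n /2⌉ ] Pnestᶜ n ≡ 2 * (n ∸ 2)
Pnestᶜ-top-even zero    n≢2 = contradiction refl n≢2
Pnestᶜ-top-even (suc j) _   = trans (cong (λ i → [t^ suc i ] Pnestᶜ (suc (suc j) * 2)) (⌊1+double/2⌋ (suc j)))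
  (ℤ.+-injective (trans
    (Pnestᶜ-growth (suc b) (suc j) (2+m≤2*[1+m] (suc (j * 2))))
    (growth-1 b)))
  where b = suc j * 2

corollary3p15 : ∀ (n : ℕ) → 1 ≤ n →
    (([t^ 1 ] Pnest n ≡ 2 ^ (n ∸ 1)) × ([t^ 1 ] Pnestᶜ n ≡ 1))
    × (([t^ 2 ] Pnest n ≡ S n 3) × (+ ([t^ 2 ] Pnestᶜ n) ≡ F (+ (2 * n) ℤ.- + 3) ℤ.- 1ℤ))
    × ((∀ (i : ℕ) → i ≥ ⌈ (n + 2) / 4 ⌉ →
    fromℤ (+ ([t^ i ] Pnest n))
    ≡ fromℤ (+ (4 * (2 * i + 1)) ℤ.* (+ (8 * i * (i + 1)) ℤ.- + (3 * (n + 1))) ℤ.* + ((2 * n + 1) !))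
    ℚ.* (1/[ + n ℤ.- + (2 * i) ℤ.+ + 1 ]! ℚ.* 1/[ + (n + 2 * i + 3) ]!))
    × (2 ∤ n → [t^ ⌈ n /2⌉ ] Pnest n ≡ 1)
    × (2 ∣ n → [t^ ⌈ n /2⌉ ] Pnest n ≡ 2 * (n ∸ 1)))
    × ((∀ (i : ℕ) → i > (n + 2) / 4 →
    fromℤ (+ ([t^ i ] Pnestᶜ n))
    ≡ fromℤ (+ (8 * i) ℤ.* (+ (8 * i ^ 2) ℤ.* (+ (2 * n) ℤ.- + 1) ℤ.- (+ (6 * n ^ 2 + n) ℤ.- + 2)) ℤ.* + ((2 * n ∸ 2) !))
    ℚ.* (1/[ + n ℤ.- + (2 * i) ℤ.+ + 1 ]! ℚ.* 1/[ + (n + 2 * i + 1) ]!))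
    × (2 ∤ n → [t^ ⌈ n /2⌉ ] Pnestᶜ n ≡ 1)
    × (2 ∣ n → n ≢ 2 → [t^ ⌈ n /2⌉ ] Pnestᶜ n ≡ 2 * (n ∸ 2)))
    × (∀ (i : ℕ) → ⌈ (n + 2) / 4 ⌉ < i → i ≤ ⌈ n /2⌉ →
    ([t^ i ] Pnest n) ^ 2 ≥ [t^ (i ∸ 1) ] Pnest n * [t^ (i + 1) ] Pnest n)
    × (∀ (i : ℕ) → (n + 2) / 4 + 1 < i → i ≤ ⌈ n /2⌉ →
    ([t^ i ] Pnestᶜ n) ^ 2 ≥ [t^ (i ∸ 1) ] Pnestᶜ n * [t^ (i + 1) ] Pnestᶜ n)
corollary3p15 n@(suc m) 1≤n =
    (Pnest-1 m , Pnestᶜ-1 m)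
  , (Pnest-2 m , Pnestᶜ-2 m)
  , (formula , top-odd , top-even)
  , (formulaᶜ , top-oddᶜ , top-evenᶜ)
  , concave , concaveᶜ
  where
  formula : ∀ i → i ≥ ⌈ (n + 2) / 4 ⌉ → _
  formula i le with range-positive {n} {i} (⌈⌉≤⇒ {n} le)
  ... | j , refl = trans (cong fromℤ (Pnest-growth m j (Pnest-range {n} le))) (Pnest-formula n j)

  top-odd : 2 ∤ n → [t^ ⌈ n /2⌉ ] Pnest n ≡ 1
  top-odd 2∤n with odd 2∤n
  ... | j , eq = subst (λ n → [t^ ⌈ n /2⌉ ] Pnest n ≡ 1) (sym eq) (Pnest-top-odd j)

  top-even : 2 ∣ n → [t^ ⌈ n /2⌉ ] Pnest n ≡ 2 * (n ∸ 1)
  top-even 2∣n with even 1≤n 2∣n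
  ... | j , eq = subst (λ n → [t^ ⌈ n /2⌉ ] Pnest n ≡ 2 * (n ∸ 1)) (sym eq) (Pnest-top-even j)

  formulaᶜ : ∀ i → i > (n + 2) / 4 → _
  formulaᶜ i lt with range-positive {n} {i} (ℕ.<⇒≤ (/<⇒ {n} lt))
  ... | j , refl = trans (cong fromℤ (Pnestᶜ-growth m j (Pnestᶜ-range {m} lt))) (Pnestᶜ-formula m j)

  top-oddᶜ : 2 ∤ n → [t^ ⌈ n /2⌉ ] Pnestᶜ n ≡ 1
  top-oddᶜ 2∤n with odd 2∤n
  ... | j , eq = subst (λ n → [t^ ⌈ n /2⌉ ] Pnestᶜ n ≡ 1) (sym eq) (Pnestᶜ-top-odd j)

  top-evenᶜ : 2 ∣ n → n ≢ 2 → [t^ ⌈ n /2⌉ ] Pnestᶜ n ≡ 2 * (n ∸ 2)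
  top-evenᶜ 2∣n with even 1≤n 2∣n
  ... | j , eq = subst (λ n → n ≢ 2 → [t^ ⌈ n /2⌉ ] Pnestᶜ n ≡ 2 * (n ∸ 2)) (sym eq) (Pnestᶜ-top-even j)

  concave : ∀ i → ⌈ (n + 2) / 4 ⌉ < i → i ≤ ⌈ n /2⌉ → ([t^ i ] Pnest n) ^ 2 ≥ [t^ (i ∸ 1) ] Pnest n * [t^ (i + 1) ] Pnest n
  -- The strict bound puts already the lowest of the three exponents in the range of `Pnest-growth`;
  -- the coefficients are then the growths at B, B + 2 and B + 4 for B = 2j + 1.
  concave (suc i) (s≤s le) _ with range-positive {n} {i} (⌈⌉≤⇒ {n} le)
  ... | j , refl rewrite ℕ.+-comm j 1 = log-concave n (suc (j * 2))
    (Pnest-growth m j (Pnest-range {n} le))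
    (Pnest-growth m (suc j) (Pnest-range {n} (ℕ.m≤n⇒m≤1+n le)))
    (Pnest-growth m (suc (suc j)) (Pnest-range {n} (ℕ.m≤n⇒m≤1+n (ℕ.m≤n⇒m≤1+n le))))

  concaveᶜ : ∀ i → (n + 2) / 4 + 1 < i → i ≤ ⌈ n /2⌉ → ([t^ i ] Pnestᶜ n) ^ 2 ≥ [t^ (i ∸ 1) ] Pnestᶜ n * [t^ (i + 1) ] Pnestᶜ n
  concaveᶜ (suc i) (s≤s le) _ with ℕ.≤-trans (ℕ.≤-reflexive (ℕ.+-comm 1 ((n + 2) / 4))) le
  ... | lt with range-positive {n} {i} (ℕ.<⇒≤ (/<⇒ {n} lt))
  ...   | j , refl rewrite ℕ.+-comm j 1 = log-concave m (j * 2)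
    (Pnestᶜ-growth m j (Pnestᶜ-range {m} lt))
    (Pnestᶜ-growth m (suc j) (Pnestᶜ-range {m} (ℕ.m≤n⇒m≤1+n lt)))
    (Pnestᶜ-growth m (suc (suc j)) (Pnestᶜ-range {m} (ℕ.m≤n⇒m≤1+n (ℕ.m≤n⇒m≤1+n lt))))
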